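{- There is an absolute constant $C>0$ such that the following holds. Let $N\ge 2$ be even, let $J\subseteq\{3,4,5,\dots\}$, and let nonnegative integers $n_j$, $j\in J$, satisfy $\sum_{j\in J} j\,n_j=N$. Let $\alpha$ be uniform on $\mathcal{C}_J$ and, independently, $\beta$ uniform on $\mathcal{C}_2$, and let $V_N$ be the number of cycles of $\gamma=\alpha\beta$ (equivalently, the number of vertices of the random surface obtained by the gluing). Let $C_N^e$ (resp. $C_N^o$) be the number of cycles of a permutation chosen uniformly at random from all even (resp. all odd) permutations of $[N]$. If $\alpha$ and $\beta$ have the same parity, then $\|P_{V_N}-P_{C_N^e}\|_{TV}\le CN^{ -1}$; if they have opposite parity, then $\|P_{V_N}-P_{C_N^o}\|_{TV}\le CN^{ -1}$. Here $P_X$ denotes the distribution of the random variable $X$.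
   Context: $\mathcal{C}_J$ is the conjugacy class of $S_N$ of permutations of $[N]$ with exactly $n_j$ cycles of length $j$ for each $j\in J$ and no other cycles; $\mathcal{C}_2$ is the class of fixed-point-free involutions of $[N]$ (products of $N/2$ disjoint transpositions). Interpretation: one takes $n=\sum_j n_j$ oriented polygons, $n_j$ of them with $j$ sides, labels all $N$ sides by $[N]$; $\alpha$ maps each side to the next side of its polygon, $\beta$ pairs sides that are glued (with opposite orientations), and the vertices of the resulting oriented surface correspond to the cycles of $\alpha\beta$. For distributions $P,Q$ on the integers, $\|P-Q\|_{TV}=\max_A|P(A)-Q(A)|$. -}

module Defs where

open import Data.Bool using (Bool; true; false; _∧_; not; if_then_else_; T)
open import Data.Nat using (ℕ; zero; suc; _+_; _*_; _≡ᵇ_; _<ᵇ_; _%_)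
open import Data.Fin using (Fin; toℕ)
open import Data.List using (List; []; _∷_; [_]; map; concatMap; length; filterᵇ; allFin; upTo)
open import Data.Bool.ListAction using (and)
open import Data.Nat.ListAction using (sum)
open import Data.Vec using (Vec; lookup; toList)
  renaming ([] to []ᵛ; _∷_ to _∷ᵛ_)

-- A permutation of [N] = Fin N is represented by its value table:
-- σ : Vec (Fin N) N with σ(i) = lookup σ i, which must be injective.
Tab : ℕ → Set
Tab N = Vec (Fin N) N

_==_ : {N : ℕ} → Fin N → Fin N → Bool
a == b = toℕ a ≡ᵇ toℕ b

allVec : (N k : ℕ) → List (Vec (Fin N) k)
allVec N zero = [ []ᵛ ]
allVec N (suc k) = concatMap (λ x → map (x ∷ᵛ_) (allVec N k)) (allFin N)

isPerm : {N : ℕ} → Tab N → Bool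
isPerm {N} σ = and (concatMap (λ i → map (λ j → (i == j) ∨' not (lookup σ i == lookup σ j)) (allFin N)) (allFin N))
  where
  _∨'_ : Bool → Bool → Bool
  true ∨' _ = true
  false ∨' b = b

SymN : (N : ℕ) → List (Tab N)
SymN N = filterᵇ isPerm (allVec N N)

compose : {N : ℕ} → Tab N → Tab N → Tab N
compose α β = Data.Vec.map (lookup α) β

iter : {N : ℕ} → Tab N → ℕ → Fin N → Fin N
iter σ zero i = i
iter σ (suc k) i = lookup σ (iter σ k i)

-- least k in {start, ..., start+fuel-1} with σ^k(i) = i (0 if none)
firstReturn : {N : ℕ} → Tab N → Fin N → ℕ → ℕ → ℕ
firstReturn σ i zero k = 0
firstReturn σ i (suc fuel) k = if iter σ k i == i then k else firstReturn σ i fuel (suc k)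

orbitLen : {N : ℕ} → Tab N → Fin N → ℕ
orbitLen {N} σ i = firstReturn σ i N 1

isCycleMin : {N : ℕ} → Tab N → Fin N → Bool
isCycleMin {N} σ i = and (map (λ k → not (toℕ (iter σ k i) <ᵇ toℕ i)) (upTo (suc N)))

cyclesOfLen : {N : ℕ} → Tab N → ℕ → ℕ
cyclesOfLen {N} σ j = length (filterᵇ (λ i → isCycleMin σ i ∧ (orbitLen σ i ≡ᵇ j)) (allFin N))

numCycles : {N : ℕ} → Tab N → ℕ
numCycles {N} σ = length (filterᵇ (isCycleMin σ) (allFin N))

inversions : {N : ℕ} → Tab N → ℕ
inversions {N} σ = length (filterᵇ (λ ij → inv (Data.Product.proj₁ ij) (Data.Product.proj₂ ij))
                     (concatMap (λ i → map (λ j → i Data.Product., j) (allFin N)) (allFin N)))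
  where
  import Data.Product
  inv : Fin _ → Fin _ → Bool
  inv i j = (toℕ i <ᵇ toℕ j) ∧ (toℕ (lookup σ j) <ᵇ toℕ (lookup σ i))

isEven : {N : ℕ} → Tab N → Bool
isEven σ = (inversions σ % 2) ≡ᵇ 0

inCJ : {N : ℕ} → (J : ℕ → Bool) → (n : ℕ → ℕ) → Tab N → Bool
inCJ {N} J n σ = and (map (λ j → cyclesOfLen σ j ≡ᵇ (if J j then n j else 0)) (upTo (suc N)))

CJ : (N : ℕ) → (ℕ → Bool) → (ℕ → ℕ) → List (Tab N)
CJ N J n = filterᵇ (inCJ J n) (SymN N)

inC2 : {N : ℕ} → Tab N → Bool
inC2 {N} σ = and (map (λ j → cyclesOfLen σ j ≡ᵇ (if j ≡ᵇ 2 then N Data.Nat./ 2 else 0)) (upTo (suc N)))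

C2 : (N : ℕ) → List (Tab N)
C2 N = filterᵇ inC2 (SymN N)

EvenPerms OddPerms : (N : ℕ) → List (Tab N)
EvenPerms N = filterᵇ isEven (SymN N)
OddPerms N = filterᵇ (λ σ → not (isEven σ)) (SymN N)

countV : (N : ℕ) → (ℕ → Bool) → (ℕ → ℕ) → (A : ℕ → Bool) → ℕ
countV N J n A = sum (map (λ α → length (filterᵇ (λ β → A (numCycles (compose α β))) (C2 N))) (CJ N J n))

countIn : {N : ℕ} → List (Tab N) → (A : ℕ → Bool) → ℕ
countIn L A = length (filterᵇ (λ σ → A (numCycles σ)) L)

-- |P(A) − Q(A)| ≤ C / N  where P(A) = a/b, Q(A) = c/d, written without division:
-- N * |a d − c b| ≤ C * b * d
TVBound : (C N a b c d : ℕ) → Set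
TVBound C N a b c d = N * Data.Nat.∣ a * d - c * b ∣ Data.Nat.≤ C * (b * d)

weightedSum : (N : ℕ) → (ℕ → Bool) → (ℕ → ℕ) → ℕ
weightedSum N J n = sum (map (λ j → if J j then j * n j else 0) (upTo (suc N)))

{-# OPTIONS --safe #-}

-- Reveal β one pair at a time.  Gluing a side i to a side j replaces α by α ∘ (i j), so
-- the state is the list of the numbers of unmatched sides on the cycles: a cycle
-- with a sides splits into d and a − 2 − d, or merges with one with e sides into
-- a + e − 2; empty cycles are finished vertices.  Which side is revealed next is free.
-- If α is uniform on a parity class, then αβ is uniform on a parity class, so it suffices
-- to compare two starting permutations of the same parity, at distance O(1/N) up to a
-- moment of the numbers of fixed points and 2-cycles.  In both processes reveal a side of
-- a smallest cycle.  As long as this cycle has at least 3 sides, exactly 2 outcomes out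
-- of k − 1 finish a vertex, whatever the state, so the processes can be coupled to finish
-- vertices simultaneously.  The larger of the two numbers of nonempty cycles drops by one
-- unless the side falls on its own cycle, which for m cycles has probability at most
-- 1/m, so up to probability O(1/N) both reach a single cycle, hence the same state, while
-- a positive fraction of the sides is still unmatched.  Cycles with 1 or 2 sides appear
-- O(1) times in expectation and each costs an error O(1/N).  All this is an additive potential which
-- bounds N² times the distance and does not increase on average.
module Submission where

open import Defs
open import Data.Bool using (Bool; T; true; false; not; _∧_; _xor_; if_then_else_)
open import Data.Bool.ListAction using (and)
import Data.Bool.Properties as BoolP
open import Data.Bool.Properties using (not-involutive; not-injective; ∧-comm; ∧-assoc; T-≡; T?)
open import Data.Empty using (⊥; ⊥-elim)
open import Data.Fin using (Fin; toℕ)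
import Data.Fin as Fin
import Data.Fin.Properties as FinP
open import Data.List
  using (List; []; _∷_; _++_; map; length; replicate; concat; concatMap; filterᵇ; allFin; upTo)
import Data.List as List
open import Data.List.Properties using (length-++; map-++; ++-identityʳ; ++-assoc)
import Data.List.Properties as ListP
open import Data.List.Membership.Propositional using (_∈_; _∉_)
open import Data.List.Membership.Propositional.Properties
  using (∈-++⁺ˡ; ∈-++⁺ʳ; ∈-++⁻; ∈-map⁺; ∈-map⁻; ∈-∃++; ∈-allFin; ∈-upTo⁺)
import Data.List.Membership.Propositional.Properties as Mem
open import Data.List.Membership.Propositional.Properties.WithK using (unique∧set⇒bag)
open import Data.List.Relation.Binary.BagAndSetEquality using (∼bag⇒↭)
open import Data.List.Relation.Unary.Any using (here; there)
open import Data.List.Relation.Unary.All as All using (All; []; _∷_)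
import Data.List.Relation.Unary.All.Properties as AllP
open import Data.List.Relation.Unary.AllPairs using ([]; _∷_)
open import Data.List.Relation.Unary.Unique.Propositional using (Unique)
import Data.List.Relation.Unary.Unique.Propositional.Properties as Uniq
open import Data.List.Relation.Binary.Pointwise as PW using (Pointwise; []; _∷_)
import Data.List.Relation.Binary.Permutation.Propositional as ↭
open import Data.List.Relation.Binary.Permutation.Propositional
  using (_↭_; ↭-refl; ↭-reflexive; ↭-sym; ↭-trans; ↭-prep; ↭-swap; ↭⇒↭ₛ)
import Data.List.Relation.Binary.Permutation.Propositional.Properties as Perm
open import Data.List.Relation.Binary.Permutation.Propositional.Properties
  using (↭-length; shift; shifts; All-resp-↭; ∈-resp-↭; ↭-map-inv)
import Data.List.Relation.Binary.Permutation.Setoid.Properties as PermS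
open import Data.Nat
  using (ℕ; zero; suc; pred; _+_; _*_; _∸_; _≤_; _<_; z≤n; s≤s; s≤s⁻¹; ∣_-_∣; _⊔_; _≡ᵇ_; _<ᵇ_; _%_)
import Data.Nat.DivMod as DivMod
open import Data.Nat.DivMod using (m*n/n≡m)
open import Data.Nat.ListAction using (sum)
open import Data.Nat.ListAction.Properties using (sum-++; sum-↭)
open import Data.Nat.Properties hiding (_≟_)
open import Data.Nat.Tactic.RingSolver using (solve-∀)
open import Data.Product using (∃-syntax; _×_; _,_; proj₁; proj₂)
open import Data.Sum using (_⊎_; inj₁; inj₂)
import Data.Sum as Sum
open import Data.Unit using (tt)
open import Data.Vec using (Vec; lookup)
import Data.Vec as Vec
import Data.Vec.Properties as VecP
open import Function using (_∘_; mk⇔; Equivalence)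
open import Relation.Binary.Definitions using (tri<; tri≈; tri>)
open import Relation.Binary.PropositionalEquality
  using (_≡_; _≢_; refl; sym; trans; cong; cong₂; subst; subst₂; setoid; module ≡-Reasoning)
open import Relation.Nullary using (Dec; yes; no; does; contradiction)
open import Relation.Nullary.Decidable using (dec-true; dec-false; does-⇔; _→-dec_; _×-dec_)

-- The squared excess in `potential` is Chebyshev's inequality in disguise. The excess behaves like
-- a walk with bounded steps and no upward drift, so over O(N) steps its second moment grows by O(N)
-- only, whereas two processes that are still apart when N / 24 sides are left have excess at least
-- N / 2. Hence they fail to coalesce in time with probability O(1/N). The obstacle is a split in
-- either of the two processes, which could raise the larger number of nonempty cycles with
-- probability up to 2/m. At m = 2 this would leave no downward drift. Parity removes one of the two
-- chances: a gluing changes the number of cycles, finished ones included, by exactly one, and the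
-- numbers of finished vertices agree, so the two numbers of nonempty cycles have the same parity.
-- If they differ, they differ by at least two, and a split in the smaller process still stays below
-- the maximum. If they are equal, splits are paired with splits. Only 1/m enters the drift, which
-- suffices down to m = 2.

-- The potential

-- The slopes 4 + gain of Ψ absorb the splits, of probability at most 1/m (gain-step), and
-- tend to 5: a slope above 4 makes the excess drift down, and a slope below 11/2 makes it
-- vanish initially, when m ≤ N / 3.
gain : ℕ → ℕ
gain 0 = 14
gain 1 = 14
gain 2 = 14
gain 3 = 6
gain 4 = 4
gain 5 = 3
gain 6 = 2
gain 7 = 2
gain 8 = 2
gain 9 = 2
gain (suc (suc (suc (suc (suc (suc (suc (suc (suc (suc _)))))))))) = 1

Ψ : ℕ → ℕ
Ψ zero = 0
Ψ (suc m) = Ψ m + (4 + gain (suc m))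

-- Up to a factor 6 this is the drift condition: when a split has probability at most 1 / (2 + m),
-- the loss `gain (2 + m)` on a merge outweighs the rise `8 + gain (3 + m)` on a split. From index 2
-- on, each entry of the table is the least natural number that satisfies it, computed backwards
-- from the tail 1, which needs at least ten cycles.
gain-step : ∀ m → gain (2 + m) + 8 + gain (3 + m) ≤ (2 + m) * gain (2 + m)
gain-step 0 = m≤m+n 28 0
gain-step 1 = m≤m+n 18 0
gain-step 2 = m≤m+n 15 1
gain-step 3 = m≤m+n 13 2
gain-step 4 = m≤m+n 12 0
gain-step 5 = m≤m+n 12 2
gain-step 6 = m≤m+n 12 4
gain-step 7 = m≤m+n 11 7
gain-step (suc (suc (suc (suc (suc (suc (suc (suc m)))))))) =
  ≤-trans (m≤m+n 10 m) (≤-reflexive (sym (*-identityʳ (10 + m))))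

-- Pays for the two outcomes that finish a vertex. They raise the excess by 2 * 24 = 6 * 8, and a
-- smallest cycle with r + 3 sides has only r proper splits, which leaves a reserve of 3 * (1 + m)
-- in the drift condition.
gain-large : ∀ m → 8 ≤ 3 * (1 + m) * gain (2 + m)
gain-large 0 = m≤m+n 8 34
gain-large 1 = m≤m+n 8 28
gain-large 2 = m≤m+n 8 28
gain-large 3 = m≤m+n 8 28
gain-large 4 = m≤m+n 8 22
gain-large 5 = m≤m+n 8 28
gain-large 6 = m≤m+n 8 34
gain-large 7 = m≤m+n 8 40
gain-large (suc (suc (suc (suc (suc (suc (suc (suc m)))))))) =
  ≤-trans (m≤m+n 8 (19 + 3 * m)) (≤-reflexive (identity m))
  where
  identity : ∀ m → 8 + (19 + 3 * m) ≡ 3 * (9 + m) * 1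
  identity = solve-∀

gain≤14 : ∀ m → gain m ≤ 14
gain≤14 0 = ≤-refl
gain≤14 1 = ≤-refl
gain≤14 2 = ≤-refl
gain≤14 3 = m≤m+n 6 8
gain≤14 4 = m≤m+n 4 10
gain≤14 5 = m≤m+n 3 11
gain≤14 6 = m≤m+n 2 12
gain≤14 7 = m≤m+n 2 12
gain≤14 8 = m≤m+n 2 12
gain≤14 9 = m≤m+n 2 12
gain≤14 (suc (suc (suc (suc (suc (suc (suc (suc (suc (suc _)))))))))) = m≤m+n 1 13

gain₃≤6 : ∀ m → gain (3 + m) ≤ 6
gain₃≤6 0 = ≤-refl
gain₃≤6 1 = m≤m+n 4 2
gain₃≤6 2 = m≤m+n 3 3
gain₃≤6 3 = m≤m+n 2 4
gain₃≤6 4 = m≤m+n 2 4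
gain₃≤6 5 = m≤m+n 2 4
gain₃≤6 6 = m≤m+n 2 4
gain₃≤6 (suc (suc (suc (suc (suc (suc (suc m))))))) = m≤m+n 1 5

Ψ≤ : ∀ m → Ψ m ≤ 5 * m + 43
Ψ≤ 0 = z≤n
Ψ≤ 1 = m≤m+n 18 30
Ψ≤ 2 = m≤m+n 36 17
Ψ≤ 3 = m≤m+n 46 12
Ψ≤ 4 = m≤m+n 54 9
Ψ≤ 5 = m≤m+n 61 7
Ψ≤ 6 = m≤m+n 67 6
Ψ≤ 7 = m≤m+n 73 5
Ψ≤ 8 = m≤m+n 79 4
Ψ≤ 9 = m≤m+n 85 3
Ψ≤ (suc (suc (suc (suc (suc (suc (suc (suc (suc (suc m)))))))))) = go m
  where
  step : ∀ m → 5 * m + 43 + 5 ≡ 5 * (1 + m) + 43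
  step = solve-∀
  go : ∀ m → Ψ (10 + m) ≤ 5 * (10 + m) + 43
  go zero = m≤m+n 90 3
  go (suc m) = ≤-trans (+-monoˡ-≤ 5 (go m)) (≤-reflexive (step (10 + m)))

Ψ-mono : ∀ {m m'} → m ≤ m' → Ψ m ≤ Ψ m'
Ψ-mono z≤n = z≤n
Ψ-mono {suc m} {suc m'} (s≤s p) with m≤n⇒m<n∨m≡n p
... | inj₂ refl = ≤-refl
... | inj₁ q = ≤-trans (Ψ-mono {suc m} {m'} q) (m≤m+n _ _)

-- The excess of the number m of nonempty cycles over its expected decay
-- when n pairs are still unmatched.
excess : ℕ → ℕ → ℕ → ℕ
excess N n m = (6 * Ψ m + N) ∸ 24 * n

excess-mono : ∀ N n {m m'} → m ≤ m' → excess N n m ≤ excess N n m'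
excess-mono N n p = ∸-monoˡ-≤ (24 * n) (+-monoˡ-≤ N (*-monoʳ-≤ 6 (Ψ-mono p)))

excess-same : ∀ N n m → excess N n m ≤ excess N (suc n) m + 24
excess-same N n m = m≤n+o⇒m∸n≤o _ (24 * n) (≤-trans (m≤n+m∸n P (24 * suc n))
    (≤-reflexive (identity n (P ∸ 24 * suc n))))
  where
  P = 6 * Ψ m + N
  identity : ∀ n y → 24 * suc n + y ≡ 24 * n + (y + 24)
  identity = solve-∀

excess-up : ∀ N n m → excess N n (suc m) ≤ excess N (suc n) m + (48 + 6 * gain (suc m))
excess-up N n m = m≤n+o⇒m∸n≤o _ (24 * n) (≤-trans (≤-reflexive (expand (Ψ m) (gain (suc m)) N))
    (≤-trans (+-monoˡ-≤ _ (m≤n+m∸n P (24 * suc n)))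
    (≤-reflexive (identity n (P ∸ 24 * suc n) (gain (suc m))))))
  where
  P = 6 * Ψ m + N
  expand : ∀ p g N → 6 * (p + (4 + g)) + N ≡ 6 * p + N + (24 + 6 * g)
  expand = solve-∀
  identity : ∀ n y g → 24 * suc n + y + (24 + 6 * g) ≡ 24 * n + (y + (48 + 6 * g))
  identity = solve-∀

excess-down : ∀ N n m → excess N n m ≤ excess N (suc n) (suc m) ∸ 6 * gain (suc m)
excess-down N n m = ≤-reflexive (sym (trans (∸-+-assoc (6 * Ψ (suc m) + N) (24 * suc n) (6 * gain (suc m)))
    (trans (cong₂ _∸_ (expand (Ψ m) (gain (suc m)) N) (rearrange n (gain (suc m))))
           ([m+n]∸[m+o]≡n∸o (24 + 6 * gain (suc m)) _ _))))
  where
  expand : ∀ p g N → 6 * (p + (4 + g)) + N ≡ (24 + 6 * g) + (6 * p + N)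
  expand = solve-∀
  rearrange : ∀ n g → 24 * suc n + 6 * g ≡ (24 + 6 * g) + 24 * n
  rearrange = solve-∀

-- Truncation does no harm to the second moment: for `e ≤ x` both sides agree, and for larger `e`
-- the claim is that (e - x)² is not negative.
square-∸ : ∀ x e → (x ∸ e) * (x ∸ e) + 2 * x * e ≤ x * x + e * e
square-∸ x e with ≤-total e x
... | inj₁ e≤x with m≤n⇒∃[o]m+o≡n e≤x
...   | d , refl rewrite m+n∸m≡n e d = ≤-reflexive (identity e d)
  where
  identity : ∀ e d → d * d + 2 * (e + d) * e ≡ (e + d) * (e + d) + e * e
  identity = solve-∀
square-∸ x e | inj₂ x≤e with m≤n⇒∃[o]m+o≡n x≤e
...   | d , refl rewrite m≤n⇒m∸n≡0 x≤e = ≤-trans (m≤m+n _ (d * d)) (≤-reflexive (identity x d))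
  where
  identity : ∀ x d → 2 * x * (x + d) + d * d ≡ x * x + (x + d) * (x + d)
  identity = solve-∀

-- One step of the second-moment estimate. By `drift` the mean jump is not positive, so the cross
-- terms 2 * x * jump are absorbed, and only the squared jumps remain, each at most D * D.
weighted-squares : ∀ D x nb ng nz e e' → nb * e' + nz * 24 ≤ ng * e → e ≤ D → e' ≤ D → 24 ≤ D →
  nb * ((x + e') * (x + e')) + ng * ((x ∸ e) * (x ∸ e)) + nz * ((x + 24) * (x + 24))
    ≤ (nb + ng + nz) * (x * x + D * D)
weighted-squares D x nb ng nz e e' drift e≤D e'≤D 24≤D =
  +-cancelʳ-≤ (ng * (2 * x * e)) _ _ (begin
    nb * ((x + e') * (x + e')) + ng * y + nz * ((x + 24) * (x + 24)) + ng * (2 * x * e)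
      ≡⟨ regroup nb ng nz x e e' y ⟩
    nb * (x * x + e' * e') + ng * (y + 2 * x * e) + nz * (x * x + 24 * 24) + 2 * x * (nb * e' + nz * 24)
      ≤⟨ +-mono-≤ (+-mono-≤ (+-mono-≤ (*-monoʳ-≤ nb (+-monoʳ-≤ _ (*-mono-≤ e'≤D e'≤D)))
            (*-monoʳ-≤ ng (≤-trans (square-∸ x e) (+-monoʳ-≤ _ (*-mono-≤ e≤D e≤D)))))
            (*-monoʳ-≤ nz (+-monoʳ-≤ _ (*-mono-≤ 24≤D 24≤D)))) (*-monoʳ-≤ (2 * x) drift) ⟩
    nb * (x * x + D * D) + ng * (x * x + D * D) + nz * (x * x + D * D) + 2 * x * (ng * e)
      ≡⟨ collect nb ng nz x e D ⟩
    (nb + ng + nz) * (x * x + D * D) + ng * (2 * x * e) ∎)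
  where
  open ≤-Reasoning
  y = (x ∸ e) * (x ∸ e)
  regroup : ∀ nb ng nz x e e' y →
    nb * ((x + e') * (x + e')) + ng * y + nz * ((x + 24) * (x + 24)) + ng * (2 * x * e)
    ≡ nb * (x * x + e' * e') + ng * (y + 2 * x * e) + nz * (x * x + 24 * 24) + 2 * x * (nb * e' + nz * 24)
  regroup = solve-∀
  collect : ∀ nb ng nz x e D →
    nb * (x * x + D * D) + ng * (x * x + D * D) + nz * (x * x + D * D) + 2 * x * (ng * e)
    ≡ (nb + ng + nz) * (x * x + D * D) + ng * (2 * x * e)
  collect = solve-∀

drift-with-zeros : ∀ m n nb ng → nb + ng + 2 ≡ 2 * n + 1 → (2 + m) * nb + 3 * (2 + m) ≤ 2 * suc n →
  nb * (48 + 6 * gain (3 + m)) + 2 * 24 ≤ ng * (6 * gain (2 + m))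
drift-with-zeros m n nb ng total few = +-cancelʳ-≤ (nb * (6 * g)) _ _ (begin
    nb * (48 + 6 * g') + 2 * 24 + nb * (6 * g)
      ≡⟨ regroup nb g g' ⟩
    6 * nb * (g + 8 + g') + 6 * 8
      ≤⟨ +-mono-≤ (*-monoʳ-≤ (6 * nb) (gain-step m)) (*-monoʳ-≤ 6 (gain-large m)) ⟩
    6 * nb * ((2 + m) * g) + 6 * (3 * (1 + m) * g)
      ≡⟨ collect nb m g ⟩
    ((2 + m) * nb + 3 * (1 + m)) * (6 * g)
      ≤⟨ *-monoˡ-≤ (6 * g) (+-cancelʳ-≤ 3 _ _ (≤-trans (≤-reflexive (shift-three m nb))
            (≤-trans few (≤-reflexive count)))) ⟩
    (ng + nb) * (6 * g) ≡⟨ *-distribʳ-+ (6 * g) ng nb ⟩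
    ng * (6 * g) + nb * (6 * g) ∎)
  where
  open ≤-Reasoning
  g = gain (2 + m)
  g' = gain (3 + m)
  regroup : ∀ nb g g' → nb * (48 + 6 * g') + 2 * 24 + nb * (6 * g) ≡ 6 * nb * (g + 8 + g') + 6 * 8
  regroup = solve-∀
  collect : ∀ nb m g → 6 * nb * ((2 + m) * g) + 6 * (3 * (1 + m) * g)
    ≡ ((2 + m) * nb + 3 * (1 + m)) * (6 * g)
  collect = solve-∀
  shift-three : ∀ m nb → (2 + m) * nb + 3 * (1 + m) + 3 ≡ (2 + m) * nb + 3 * (2 + m)
  shift-three = solve-∀
  twice : ∀ n → 2 * suc n ≡ 2 * n + 1 + 1
  twice = solve-∀
  swap3 : ∀ nb ng → nb + ng + 2 + 1 ≡ ng + nb + 3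
  swap3 = solve-∀
  count : 2 * suc n ≡ ng + nb + 3
  count = trans (twice n) (trans (cong (_+ 1) (sym total)) (swap3 nb ng))

-- For steps in which some process peels a cycle with 1 or 2 sides. Outcomes that finish a vertex
-- are then charged separately instead of being matched. If both processes peel such cycles, no
-- split is left to count, hence the second alternative.
drift-without-zeros : ∀ m n nb ng → nb + ng ≡ 2 * n + 1 →
  (2 + m) * nb + 3 * (2 + m) ≤ 2 * suc n ⊎ nb ≡ 0 →
  nb * (48 + 6 * gain (3 + m)) + 0 * 24 ≤ ng * (6 * gain (2 + m))
drift-without-zeros m n nb ng total (inj₂ refl) = z≤n
drift-without-zeros m n nb ng total (inj₁ few) = +-cancelʳ-≤ (nb * (6 * g)) _ _ (begin
    nb * (48 + 6 * g') + 0 * 24 + nb * (6 * g)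
      ≡⟨ regroup nb g g' ⟩
    6 * nb * (g + 8 + g')
      ≤⟨ *-monoʳ-≤ (6 * nb) (gain-step m) ⟩
    6 * nb * ((2 + m) * g)
      ≡⟨ collect nb m g ⟩
    ((2 + m) * nb) * (6 * g)
      ≤⟨ *-monoˡ-≤ (6 * g) (+-cancelʳ-≤ 1 _ _ (≤-trans
            (+-monoʳ-≤ ((2 + m) * nb) (≤-trans (m≤m+n 1 (5 + 3 * m)) (≤-reflexive (six m))))
            (≤-trans few (≤-reflexive count)))) ⟩
    (ng + nb) * (6 * g) ≡⟨ *-distribʳ-+ (6 * g) ng nb ⟩
    ng * (6 * g) + nb * (6 * g) ∎)
  where
  open ≤-Reasoning
  g = gain (2 + m)
  g' = gain (3 + m)
  regroup : ∀ nb g g' → nb * (48 + 6 * g') + 0 * 24 + nb * (6 * g) ≡ 6 * nb * (g + 8 + g')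
  regroup = solve-∀
  collect : ∀ nb m g → 6 * nb * ((2 + m) * g) ≡ ((2 + m) * nb) * (6 * g)
  collect = solve-∀
  six : ∀ m → 1 + (5 + 3 * m) ≡ 3 * (2 + m)
  six = solve-∀
  twice : ∀ n → 2 * suc n ≡ 2 * n + 1 + 1
  twice = solve-∀
  count : 2 * suc n ≡ ng + nb + 1
  count = trans (twice n) (cong (_+ 1) (trans (sym total) (+-comm nb ng)))

abstract
  -- It bounds N² once at most N / 24 sides are left, and its linear term pays
  -- for the variance of the excess and for the small cycles created by splits.
  potential : ℕ → ℕ → ℕ → ℕ
  potential N n m = 4 * (excess N n m * excess N n m) + 2 * n * 100000

  potential-mono : ∀ N n {m m'} → m ≤ m' → potential N n m ≤ potential N n m'
  potential-mono N n p = +-monoˡ-≤ _ (*-monoʳ-≤ 4 (*-mono-≤ (excess-mono N n p) (excess-mono N n p)))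

  potential-drift : ∀ N n m nb ng nz → nb + ng + nz ≡ 2 * n + 1 → N ≤ 48 * suc n →
    nb * (48 + 6 * gain (3 + m)) + nz * 24 ≤ ng * (6 * gain (2 + m)) →
    nb * potential N n (3 + m) + ng * potential N n (1 + m) + nz * potential N n (2 + m) + N * 2688
      ≤ (2 * n + 1) * potential N (suc n) (2 + m)
  potential-drift N n m nb ng nz total N≤ drift = begin
      nb * potential N n (3 + m) + ng * potential N n (1 + m) + nz * potential N n (2 + m) + N * 2688
        ≤⟨ +-mono-≤ (+-mono-≤ (+-mono-≤
             (*-monoʳ-≤ nb (+-monoˡ-≤ _ (*-monoʳ-≤ 4 (*-mono-≤ (excess-up N n (2 + m)) (excess-up N n (2 + m))))))
             (*-monoʳ-≤ ng (+-monoˡ-≤ _ (*-monoʳ-≤ 4 (*-mono-≤ (excess-down N n (1 + m)) (excess-down N n (1 + m)))))))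
             (*-monoʳ-≤ nz (+-monoˡ-≤ _ (*-monoʳ-≤ 4 (*-mono-≤ (excess-same N n (2 + m)) (excess-same N n (2 + m)))))))
             (*-monoˡ-≤ 2688 N≤) ⟩
      nb * (4 * bad + c) + ng * (4 * good + c) + nz * (4 * zer + c) + 48 * suc n * 2688
        ≡⟨ regroup nb ng nz bad good zer c (suc n) ⟩
      4 * (nb * bad + ng * good + nz * zer) + (nb + ng + nz) * c + suc n * 129024
        -- Every jump is at most 84, namely 6 * 14 for a merge and 48 + 6 * 6 for a split; 132
        -- leaves some room.
        ≤⟨ +-monoˡ-≤ _ (+-monoˡ-≤ _ (*-monoʳ-≤ 4 (weighted-squares 132 x nb ng nz e e' drift
             (≤-trans (*-monoʳ-≤ 6 (gain≤14 (2 + m))) (m≤m+n 84 48))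
             (≤-trans (+-monoʳ-≤ 48 (*-monoʳ-≤ 6 (gain₃≤6 m))) (m≤m+n 84 48)) (m≤m+n 24 108)))) ⟩
      4 * ((nb + ng + nz) * (x * x + 132 * 132)) + (nb + ng + nz) * c + suc n * 129024
        ≡⟨ cong (λ t → 4 * (t * (x * x + 132 * 132)) + t * c + suc n * 129024) total ⟩
      4 * ((2 * n + 1) * (x * x + 132 * 132)) + (2 * n + 1) * c + suc n * 129024
        -- With one pair less the linear term falls by 200000 in each of the 2n + 1 outcomes. This
        -- covers 4 * 132 * 132 per outcome for the variance and 129024 * (n + 1), with 129024 = 48
        -- * 2688, for the charges; the added term is what is left over.
        ≤⟨ m≤m+n _ (n * 131584 + 1280) ⟩
      _ ≡⟨ final n x ⟩
      (2 * n + 1) * potential N (suc n) (2 + m) ∎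
    where
    open ≤-Reasoning
    x e e' bad good zer c : ℕ
    x = excess N (suc n) (2 + m)
    e = 6 * gain (2 + m)
    e' = 48 + 6 * gain (3 + m)
    bad = (x + e') * (x + e')
    good = (x ∸ e) * (x ∸ e)
    zer = (x + 24) * (x + 24)
    c = 2 * n * 100000
    regroup : ∀ nb ng nz bad good zer c s →
      nb * (4 * bad + c) + ng * (4 * good + c) + nz * (4 * zer + c) + 48 * s * 2688
      ≡ 4 * (nb * bad + ng * good + nz * zer) + (nb + ng + nz) * c + s * 129024
    regroup = solve-∀
    final : ∀ n x → 4 * ((2 * n + 1) * (x * x + 132 * 132)) + (2 * n + 1) * (2 * n * 100000) + suc n * 129024 + (n * 131584 + 1280)
       ≡ (2 * n + 1) * (4 * (x * x) + 2 * suc n * 100000)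
    final = solve-∀

  -- Whatever m is, the excess is at least N - 24 * (n + 1), hence at least N / 2, and the factor 4
  -- in the potential turns this into N².
  potential-large : ∀ N n m → 48 * suc n ≤ N → N * N ≤ potential N (suc n) m
  potential-large N n m small = ≤-trans square (m≤m+n _ _)
    where
    x : ℕ
    x = excess N (suc n) m
    N≤2x : N ≤ 2 * x
    N≤2x = +-cancelʳ-≤ (48 * suc n) _ _ (begin
        N + 48 * suc n ≤⟨ +-monoʳ-≤ N small ⟩
        N + N ≤⟨ +-mono-≤ N≤ N≤ ⟩
        (24 * suc n + x) + (24 * suc n + x) ≡⟨ identity (suc n) x ⟩
        2 * x + 48 * suc n ∎)
      where
      open ≤-Reasoning
      N≤ : N ≤ 24 * suc n + x
      N≤ = ≤-trans (m≤n+m N (6 * Ψ m)) (m≤n+m∸n _ (24 * suc n))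
      identity : ∀ s x → (24 * s + x) + (24 * s + x) ≡ 2 * x + 48 * s
      identity = solve-∀
    square : N * N ≤ 4 * (x * x)
    square = ≤-trans (*-mono-≤ N≤2x N≤2x) (≤-reflexive (identity x))
      where
      identity : ∀ x → 2 * x * (2 * x) ≡ 4 * (x * x)
      identity = solve-∀

  potential-def : ∀ N n m → potential N n m ≡ 4 * (excess N n m * excess N n m) + 2 * n * 100000
  potential-def N n m = refl

-- The gluing process on partitions

indicator : Bool → ℕ
indicator true = 1
indicator false = 0

parity : ℕ → Bool
parity zero = false
parity (suc n) = not (parity n)

-- A cycle with r + 1 sides, one of them distinguished, is glued to itself or to another cycle.
splits : ℕ → ℕ → List ℕ → List (List ℕ)
splits d zero ν = []
splits d (suc r) ν = (d ∷ r ∷ ν) ∷ splits (suc d) r ν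

-- A cycle with e sides contributes e equal outcomes, each with (r + 1) + e - 2 sides on the merged
-- cycle. The value of `pred` at 0 does not matter, since nothing is listed for e = 0. The cycles
-- already passed over are kept in `pre`.
merges : ℕ → List ℕ → List ℕ → List (List ℕ)
merges r pre [] = []
merges r pre (e ∷ ν) = replicate e ((r + pred e) ∷ (pre ++ ν)) ++ merges r (e ∷ pre) ν

outcomes : ℕ → List ℕ → List (List ℕ)
outcomes r ν = splits 0 r ν ++ merges r [] ν

-- v is the number of ways to match the 2n remaining sides such that the final number of
-- vertices satisfies A, and the recursion for v holds whichever cycle is peeled first.
Val : (ℕ → Bool) → ℕ → List ℕ → ℕ → Set
Val A zero λs v = v ≡ indicator (A (length λs))
Val A (suc n) λs v = ∀ r ν → λs ↭ suc r ∷ ν →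
  ∃[ vs ] (Pointwise (Val A n) (outcomes r ν) vs × v ≡ sum vs)

oddFactorial : ℕ → ℕ
oddFactorial zero = 1
oddFactorial (suc n) = (2 * n + 1) * oddFactorial n

Val-↭ : ∀ {A} n {λs μs v} → λs ↭ μs → Val A n λs v → Val A n μs v
Val-↭ {A} zero p v≡ = trans v≡ (cong (indicator ∘ A) (↭-length p))
Val-↭ (suc n) p val r ν q = val r ν (↭-trans p q)

cnt : (ℕ → ℕ) → List ℕ → ℕ
cnt f λs = sum (map f λs)

cnt-↭ : ∀ f {λs μs} → λs ↭ μs → cnt f λs ≡ cnt f μs
cnt-↭ f p = sum-↭ (Perm.map⁺ f p)

is0 is1 is2 pos : ℕ → ℕ
is0 zero = 1
is0 (suc _) = 0
is1 1 = 1
is1 _ = 0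
is2 2 = 1
is2 _ = 0
pos zero = 0
pos (suc _) = 1

-- Peeling a cycle of length 2 or 1 lowers this weight by at least 48 (u + 2), where u is
-- the number of outcomes which finish a vertex: n₁ − 1 for a cycle of length 1, one for length 2.
quadratic : ℕ → ℕ → ℕ
quadratic n₁ n₂ = 24 * (n₁ * n₁ + 9 * n₁ + 6 * n₂)

quadratic-mono : ∀ {a a' b b'} → a ≤ a' → b ≤ b' → quadratic a b ≤ quadratic a' b'
quadratic-mono p q = *-monoʳ-≤ 24 (+-mono-≤ (+-mono-≤ (*-mono-≤ p p) (*-monoʳ-≤ 9 p)) (*-monoʳ-≤ 6 q))

ρ : List ℕ → ℕ
ρ λs = quadratic (cnt is1 λs) (cnt is2 λs)

ρ-↭ : ∀ {λs μs} → λs ↭ μs → ρ λs ≡ ρ μs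
ρ-↭ p = cong₂ quadratic (cnt-↭ is1 p) (cnt-↭ is2 p)

smallest-part : ∀ λs → All (_≡ 0) λs ⊎
  ∃[ r ] ∃[ ν ] (λs ↭ suc r ∷ ν × All (λ e → e ≡ 0 ⊎ suc r ≤ e) ν)
smallest-part [] = inj₁ []
smallest-part (x ∷ λs) with smallest-part λs
smallest-part (zero ∷ λs) | inj₁ zeros = inj₁ (refl ∷ zeros)
smallest-part (suc x ∷ λs) | inj₁ zeros = inj₂ (x , λs , ↭-refl , All.map inj₁ zeros)
smallest-part (zero ∷ λs) | inj₂ (r , ν , p , min) =
  inj₂ (r , 0 ∷ ν , ↭-trans (↭-prep 0 p) (↭-swap _ _ ↭-refl) , inj₁ refl ∷ min)
smallest-part (suc x ∷ λs) | inj₂ (r , ν , p , min) with ≤-total r x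
... | inj₁ r≤x = inj₂ (r , suc x ∷ ν , ↭-trans (↭-prep _ p) (↭-swap _ _ ↭-refl) , inj₂ (s≤s r≤x) ∷ min)
... | inj₂ x≤r = inj₂ (x , suc r ∷ ν , ↭-prep _ p ,
        inj₂ (s≤s x≤r) ∷ All.map (λ { (inj₁ e) → inj₁ e ; (inj₂ q) → inj₂ (≤-trans (s≤s x≤r) q) }) min)

pick-two : ∀ λs → (∃[ ν ] λs ↭ 2 ∷ ν) ⊎ cnt is2 λs ≡ 0
pick-two [] = inj₂ refl
pick-two (x ∷ λs) with pick-two λs
pick-two (x ∷ λs) | inj₁ (ν , p) = inj₁ (x ∷ ν , ↭-trans (↭-prep x p) (↭-swap _ _ ↭-refl))
pick-two (0 ∷ λs) | inj₂ none = inj₂ none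
pick-two (1 ∷ λs) | inj₂ none = inj₂ none
pick-two (2 ∷ λs) | inj₂ none = inj₁ (λs , ↭-refl)
pick-two (suc (suc (suc x)) ∷ λs) | inj₂ none = inj₂ none

-- Cycles of length 2 are peeled before those of length 1, because a 1-cycle merging with
-- a 3-cycle leaves a 2-cycle.
data Peel (λs : List ℕ) : Set where
  two : ∀ ν → λs ↭ 2 ∷ ν → Peel λs
  one : ∀ ν → λs ↭ 1 ∷ ν → cnt is2 ν ≡ 0 → Peel λs
  big : ∀ r ν → λs ↭ (3 + r) ∷ ν → All (λ e → e ≡ 0 ⊎ 3 + r ≤ e) ν → Peel λs

all-zero-sum : ∀ {λs} → All (_≡ 0) λs → sum λs ≡ 0
all-zero-sum [] = refl
all-zero-sum (refl ∷ zs) = all-zero-sum zs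

nonzero-part : ∀ n λs → sum λs ≡ 2 * suc n →
  ∃[ r ] ∃[ ν ] (λs ↭ suc r ∷ ν × All (λ e → e ≡ 0 ⊎ suc r ≤ e) ν)
nonzero-part n λs s with smallest-part λs
... | inj₂ found = found
... | inj₁ zeros with trans (sym (all-zero-sum zeros)) s
...   | ()

peel : ∀ n λs → sum λs ≡ 2 * suc n → Peel λs
peel n λs s with pick-two λs
... | inj₁ (ν , p) = two ν p
... | inj₂ none with nonzero-part n λs s
...   | zero , ν , p , min = one ν p (trans (sym (cnt-↭ is2 p)) none)
...   | suc zero , ν , p , min = two ν p
...   | suc (suc r) , ν , p , min = big r ν p min

splits-sum : ∀ d r ν → All (λ o → suc (sum o) ≡ d + r + sum ν) (splits d r ν)
splits-sum d zero ν = []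
splits-sum d (suc r) ν = identity d r (sum ν) ∷
  All.map (λ q → trans q (cong (_+ sum ν) (sym (+-suc d r)))) (splits-sum (suc d) r ν)
  where
  identity : ∀ d r s → suc (d + (r + s)) ≡ d + suc r + s
  identity = solve-∀

merges-All : ∀ {P : List ℕ → Set} r pre ν →
  (∀ e rest → pre ++ ν ↭ suc e ∷ rest → P ((r + e) ∷ rest)) → All P (merges r pre ν)
merges-All r pre [] h = []
merges-All {P} r pre (e ∷ ν) h = AllP.++⁺ (copies e (λ { e' refl → h e' (pre ++ ν) (shift e pre ν) }))
  (merges-All r (e ∷ pre) ν (λ e' rest p → h e' rest (↭-trans (shift e pre ν) p)))
  where
  copies : ∀ e → (∀ e' → e ≡ suc e' → P ((r + e') ∷ (pre ++ ν))) →
    All P (replicate e ((r + pred e) ∷ (pre ++ ν)))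
  copies zero h = []
  copies (suc e) h = AllP.replicate⁺ (suc e) (h e refl)

merges-sum : ∀ r ν → All (λ o → suc (sum o) ≡ r + sum ν) (merges r [] ν)
merges-sum r ν = merges-All r [] ν λ e rest p →
  trans (identity r e (sum rest)) (cong (r +_) (sym (sum-↭ p)))
  where
  identity : ∀ r e s → suc (r + e + s) ≡ r + suc (e + s)
  identity = solve-∀

outcomes-sum : ∀ n r ν → suc r + sum ν ≡ 2 * suc n → All (λ o → sum o ≡ 2 * n) (outcomes r ν)
outcomes-sum n r ν s = All.map (λ q → suc-injective (trans q r+ν)) (AllP.++⁺ (splits-sum 0 r ν) (merges-sum r ν))
  where
  r+ν : r + sum ν ≡ suc (2 * n)
  r+ν = suc-injective (trans s (*-suc 2 n))

length-splits : ∀ d r ν → length (splits d r ν) ≡ r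
length-splits d zero ν = refl
length-splits d (suc r) ν = cong suc (length-splits (suc d) r ν)

length-merges : ∀ r pre ν → length (merges r pre ν) ≡ sum ν
length-merges r pre [] = refl
length-merges r pre (e ∷ ν) = trans (length-++ (replicate e ((r + pred e) ∷ (pre ++ ν))))
  (cong₂ _+_ (ListP.length-replicate e) (length-merges r (e ∷ pre) ν))

length-outcomes : ∀ n r ν → suc r + sum ν ≡ 2 * suc n → length (outcomes r ν) ≡ 2 * n + 1
length-outcomes n r ν s = trans (length-++ (splits 0 r ν))
  (trans (cong₂ _+_ (length-splits 0 r ν) (length-merges r [] ν)) (suc-injective (trans s (twice n))))
  where
  twice : ∀ n → 2 * suc n ≡ suc (2 * n + 1)
  twice = solve-∀

Val-bounded : ∀ {A} n {λs v} → sum λs ≡ 2 * n → Val A n λs v → v ≤ oddFactorial n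
Val-bounded {A} zero {λs} s refl with A (length λs)
... | true = ≤-refl
... | false = z≤n
Val-bounded (suc n) {λs} s val with nonzero-part n λs s
... | r , ν , p , _ with val r ν p
...   | vs , pw , refl = ≤-trans (go pw (outcomes-sum n r ν s'))
          (≤-reflexive (cong (_* oddFactorial n) (length-outcomes n r ν s')))
  where
  s' = trans (sym (sum-↭ p)) s
  go : ∀ {os vs} → Pointwise (Val _ n) os vs → All (λ o → sum o ≡ 2 * n) os →
    sum vs ≤ length os * oddFactorial n
  go [] [] = z≤n
  go (x ∷ pw) (q ∷ qs) = +-mono-≤ (Val-bounded n q x) (go pw qs)

-- The recursion for a single choice of the peeled cycle already determines the value. Two processes
-- that reach the same partition therefore have distance 0 from then on.
Val-unique : ∀ {A} n {λs μs v w} → sum λs ≡ 2 * n → λs ↭ μs → Val A n λs v → Val A n μs w → v ≡ w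
Val-unique {A} zero s p refl refl = cong (indicator ∘ A) (↭-length p)
Val-unique (suc n) {λs} s p val val' with nonzero-part n λs s
... | r , ν , q , _ with val r ν q | val' r ν (↭-trans (↭-sym p) q)
...   | vs , pw , refl | ws , pw' , refl = cong sum (go pw pw' (outcomes-sum n r ν (trans (sym (sum-↭ q)) s)))
  where
  go : ∀ {os vs ws} → Pointwise (Val _ n) os vs → Pointwise (Val _ n) os ws →
    All (λ o → sum o ≡ 2 * n) os → vs ≡ ws
  go [] [] [] = refl
  go (x ∷ pw) (y ∷ pw') (q ∷ qs) = cong₂ _∷_ (Val-unique n q ↭-refl x y) (go pw pw' qs)

-- Term-by-term comparison of two lists of outcomes

dist-+ : ∀ a b c d → ∣ (a + b) - (c + d) ∣ ≤ ∣ a - c ∣ + ∣ b - d ∣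
dist-+ a b c d = ≤-trans (∣-∣-triangle (a + b) (c + b) (c + d))
  (+-mono-≤ (≤-reflexive (trans (cong₂ ∣_-_∣ (+-comm a b) (+-comm c b)) (∣m+n-m+o∣≡∣n-o∣ b a c)))
            (≤-reflexive (∣m+n-m+o∣≡∣n-o∣ c b d)))

val cost : List (ℕ × ℕ) → ℕ
val xs = sum (map proj₁ xs)
cost xs = sum (map proj₂ xs)

Close : ℕ → ℕ → ℕ × ℕ → ℕ × ℕ → Set
Close K t (v , b) (w , c) = K * ∣ v - w ∣ ≤ b + c + t

close-sum : ∀ K t t' v w b c V W B C → K * ∣ v - w ∣ ≤ b + c + t → K * ∣ V - W ∣ ≤ B + C + t' →
  K * ∣ (v + V) - (w + W) ∣ ≤ (b + B) + (c + C) + (t + t')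
close-sum K t t' v w b c V W B C p q = begin
    K * ∣ (v + V) - (w + W) ∣ ≤⟨ *-monoʳ-≤ K (dist-+ v V w W) ⟩
    K * (∣ v - w ∣ + ∣ V - W ∣) ≡⟨ *-distribˡ-+ K _ _ ⟩
    K * ∣ v - w ∣ + K * ∣ V - W ∣ ≤⟨ +-mono-≤ p q ⟩
    (b + c + t) + (B + C + t') ≡⟨ identity b c t B C t' ⟩
    (b + B) + (c + C) + (t + t') ∎
  where
  open ≤-Reasoning
  identity : ∀ b c t B C t' → (b + c + t) + (B + C + t') ≡ (b + B) + (c + C) + (t + t')
  identity = solve-∀

zip-good : ∀ {K tg} {G H : ℕ × ℕ → Set} → (∀ {x y} → G x → H y → Close K tg x y) →
  ∀ {M M'} → All G M → All H M' → length M ≡ length M' →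
  K * ∣ val M - val M' ∣ ≤ cost M + cost M' + length M * tg
zip-good {K} good [] [] refl = ≤-reflexive (*-zeroʳ K)
zip-good {K} {tg} good {(v , b) ∷ M} {(w , c) ∷ M'} (g ∷ gs) (h ∷ hs) eq =
  close-sum K tg (length M * tg) v w b c (val M) (val M') (cost M) (cost M')
    (good g h) (zip-good {K} {tg} good gs hs (suc-injective eq))

-- Pairing splits with splits as far as possible makes the number of pairs
-- that contain a split the larger, not the sum, of the numbers of splits.
zip-sorted : ∀ {K tb tg} {P G P' G' : ℕ × ℕ → Set} →
  (∀ {x} → G x → P x) → (∀ {x} → G' x → P' x) →
  (∀ {x y} → P x → P' y → Close K tb x y) → (∀ {x y} → G x → G' y → Close K tg x y) →
  ∀ {S M S' M'} → All P S → All G M → All P' S' → All G' M' →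
  length S + length M ≡ length S' + length M' →
  ∃[ ng ] ((length S ⊔ length S') + ng ≡ length S + length M ×
    K * ∣ (val S + val M) - (val S' + val M') ∣
      ≤ (cost S + cost M) + (cost S' + cost M') + ((length S ⊔ length S') * tb + ng * tg))
zip-sorted {K} {tb} {tg} wk wk' bad good {[]} {M} {[]} [] gs [] gs' eq = length M , refl , zip-good {K} {tg} good gs gs' eq
zip-sorted {K} {tb} {tg} wk wk' bad good {(v , b) ∷ S} {M} {(w , c) ∷ S'} {M'} (p ∷ ps) gs (q ∷ qs) gs' eq
  with zip-sorted {K} {tb} {tg} wk wk' bad good ps gs qs gs' (suc-injective eq)
... | ng , count , bound = ng , cong suc count , (begin
    K * ∣ (v + val S + val M) - (w + val S' + val M') ∣
      ≡⟨ cong₂ (λ x y → K * ∣ x - y ∣) (+-assoc v _ _) (+-assoc w _ _) ⟩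
    K * ∣ (v + (val S + val M)) - (w + (val S' + val M')) ∣
      ≤⟨ close-sum K tb ((length S ⊔ length S') * tb + ng * tg) v w b c (val S + val M) (val S' + val M')
           (cost S + cost M) (cost S' + cost M') (bad p q) bound ⟩
    _ ≡⟨ identity b (cost S) (cost M) c (cost S') (cost M') tb (length S ⊔ length S') (ng * tg) ⟩
    (b + cost S + cost M) + (c + cost S' + cost M') + ((tb + (length S ⊔ length S') * tb) + ng * tg) ∎)
  where
  open ≤-Reasoning
  identity : ∀ b s m c s' m' t k g → (b + (s + m)) + (c + (s' + m')) + (t + (k * t + g))
    ≡ (b + s + m) + (c + s' + m') + ((t + k * t) + g)
  identity = solve-∀
zip-sorted wk wk' bad good {(v , b) ∷ S} {M} {[]} {[]} (p ∷ ps) gs [] [] ()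
zip-sorted {K} {tb} {tg} wk wk' bad good {(v , b) ∷ S} {M} {[]} {(w , c) ∷ M'} (p ∷ ps) gs [] (q ∷ qs) eq
  with zip-sorted {K} {tb} {tg} wk wk' bad good ps gs [] qs (suc-injective eq)
... | ng , count , bound rewrite ⊔-identityʳ (length S) = ng , cong suc count , (begin
    K * ∣ (v + val S + val M) - (w + val M') ∣
      ≡⟨ cong (λ x → K * ∣ x - (w + val M') ∣) (+-assoc v _ _) ⟩
    K * ∣ (v + (val S + val M)) - (w + val M') ∣
      ≤⟨ close-sum K tb (length S * tb + ng * tg) v w b c (val S + val M) (val M')
           (cost S + cost M) (cost M') (bad p (wk' q)) bound ⟩
    _ ≡⟨ identity b (cost S) (cost M) c (cost M') tb (length S) (ng * tg) ⟩
    (b + cost S + cost M) + (c + cost M') + ((tb + length S * tb) + ng * tg) ∎)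
  where
  open ≤-Reasoning
  identity : ∀ b s m c m' t k g → (b + (s + m)) + (c + m') + (t + (k * t + g))
    ≡ (b + s + m) + (c + m') + ((t + k * t) + g)
  identity = solve-∀
zip-sorted wk wk' bad good {[]} {[]} {(w , c) ∷ S'} {M'} [] [] (q ∷ qs) gs' ()
zip-sorted {K} {tb} {tg} wk wk' bad good {[]} {(v , b) ∷ M} {(w , c) ∷ S'} {M'} [] (p ∷ ps) (q ∷ qs) gs' eq
  with zip-sorted {K} {tb} {tg} wk wk' bad good {[]} {M} [] ps qs gs' (suc-injective eq)
... | ng , count , bound = ng , cong suc count , (begin
    K * ∣ (v + val M) - (w + val S' + val M') ∣
      ≡⟨ cong (λ y → K * ∣ (v + val M) - y ∣) (+-assoc w _ _) ⟩
    K * ∣ (v + val M) - (w + (val S' + val M')) ∣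
      ≤⟨ close-sum K tb (length S' * tb + ng * tg) v w b c (val M) (val S' + val M')
           (cost M) (cost S' + cost M') (bad (wk p) q) bound ⟩
    _ ≡⟨ identity b (cost M) c (cost S') (cost M') tb (length S') (ng * tg) ⟩
    (b + cost M) + (c + cost S' + cost M') + ((tb + length S' * tb) + ng * tg) ∎)
  where
  open ≤-Reasoning
  identity : ∀ b m c s' m' t k g → (b + m) + (c + (s' + m')) + (t + (k * t + g))
    ≡ (b + m) + (c + s' + m') + ((t + k * t) + g)
  identity = solve-∀

Pointwise-All : ∀ {V : List ℕ → ℕ → Set} {P : List ℕ → Set} {os vs} → Pointwise V os vs → All P os →
  Pointwise (λ o v → V o v × P o) os vs
Pointwise-All [] [] = []
Pointwise-All (x ∷ pw) (p ∷ ps) = (x , p) ∷ Pointwise-All pw ps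

merge-items : ∀ {V : List ℕ → ℕ → Set} {r} {P : ℕ × ℕ → Set} (β : ℕ → ℕ) pre ν {vs} →
  (∀ e rest v → pre ++ ν ↭ suc e ∷ rest → V ((r + e) ∷ rest) v → P (v , β (suc e))) →
  Pointwise V (merges r pre ν) vs →
  ∃[ M ] (sum vs ≡ val M × All P M × cost M ≡ sum (map (λ e → e * β e) ν) × length M ≡ sum ν)
merge-items β pre [] h [] = [] , refl , [] , refl , refl
merge-items β pre (zero ∷ ν) h pw =
  merge-items β (0 ∷ pre) ν (λ e rest v p → h e rest v (↭-trans (shift 0 pre ν) p)) pw
merge-items {V} {r} {P} β pre (suc e ∷ ν) h pw = copies (suc e) pw
  where
  copies : ∀ k {vs} →
    Pointwise V (replicate k ((r + e) ∷ (pre ++ ν)) ++ merges r (suc e ∷ pre) ν) vs →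
    ∃[ M ] (sum vs ≡ val M × All P M × cost M ≡ k * β (suc e) + sum (map (λ e → e * β e) ν)
      × length M ≡ k + sum ν)
  copies zero pw =
    merge-items β (suc e ∷ pre) ν (λ e' rest v p → h e' rest v (↭-trans (shift (suc e) pre ν) p)) pw
  copies (suc k) (x ∷ pw) with copies k pw
  ... | M , s , ps , c , l = (_ , β (suc e)) ∷ M , cong (_ +_) s , h e (pre ++ ν) _ (shift (suc e) pre ν) x ∷ ps ,
        trans (cong (β (suc e) +_) c) (sym (+-assoc (β (suc e)) _ _)) , cong suc l

-- Coupling two gluing processes

-- Division by N² and by the number of matchings turns this into a bound for a difference of two
-- probabilities. The number of finished vertices and the parity of the number of cycles are what
-- the coupling keeps equal. The potential sees only the larger number of nonempty cycles, while the
-- weights of the small cycles add up.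
Bound : ℕ → (ℕ → Bool) → ℕ → Set
Bound N A n = ∀ {λs μs v w} → Val A n λs v → Val A n μs w → sum λs ≡ 2 * n → sum μs ≡ 2 * n →
  cnt is0 λs ≡ cnt is0 μs → parity (length λs) ≡ parity (length μs) →
  N * N * ∣ v - w ∣ ≤ (potential N n (cnt pos λs ⊔ cnt pos μs) + N * (ρ λs + ρ μs)) * oddFactorial n

-- Pairs (value, cost): wild items pay for being compared with an arbitrary value.
data Item (N : ℕ) (A : ℕ → Bool) (n z : ℕ) (π : Bool) (cap : ℕ) : ℕ × ℕ → Set where
  wild : ∀ {v b} → v ≤ oddFactorial n → N * N * oddFactorial n ≤ b → Item N A n z π cap (v , b)
  genuine : ∀ {v b} λs → Val A n λs v → sum λs ≡ 2 * n → cnt is0 λs ≡ z → parity (length λs) ≡ π →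
    cnt pos λs ≤ cap → N * ρ λs * oddFactorial n ≤ b → Item N A n z π cap (v , b)

item-weaken : ∀ {N A n z π c c' x} → c ≤ c' → Item N A n z π c x → Item N A n z π c' x
item-weaken p (wild h q) = wild h q
item-weaken p (genuine λs a b c d e f) = genuine λs a b c d (≤-trans e p) f

item-bounded : ∀ {N A n z π c v b} → Item N A n z π c (v , b) → v ≤ oddFactorial n
item-bounded (wild h _) = h
item-bounded {n = n} (genuine λs a b _ _ _ _) = Val-bounded n b a

dist-≤ : ∀ {v w q} → v ≤ q → w ≤ q → ∣ v - w ∣ ≤ q
dist-≤ {v} {w} p q = ≤-trans (∣m-n∣≤m⊔n v w) (⊔-lub p q)

item-close : ∀ {N A n z π c x y} → Bound N A n → Item N A n z π c x → Item N A n z π c y →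
  Close (N * N) (potential N n c * oddFactorial n) x y
item-close {N} {x = v , b} {y = w , d} bound i@(wild h q) j =
  ≤-trans (*-monoʳ-≤ (N * N) (dist-≤ h (item-bounded j))) (≤-trans q (≤-trans (m≤m+n b d) (m≤m+n _ _)))
item-close {N} {x = v , b} {y = w , d} bound i@(genuine _ _ _ _ _ _ _) j@(wild h q) =
  ≤-trans (*-monoʳ-≤ (N * N) (dist-≤ (item-bounded i) h)) (≤-trans q (≤-trans (m≤n+m d b) (m≤m+n _ _)))
item-close {N} {n = n} {c = c} {x = v , b} {y = w , d} bound
  (genuine λs a s z p k f) (genuine μs a' s' z' p' k' f') = begin
    N * N * ∣ v - w ∣ ≤⟨ bound a a' s s' (trans z (sym z')) (trans p (sym p')) ⟩
    (potential N n (cnt pos λs ⊔ cnt pos μs) + N * (ρ λs + ρ μs)) * Q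
      ≤⟨ *-monoˡ-≤ Q (+-monoˡ-≤ _ (potential-mono N n (⊔-lub k k'))) ⟩
    (potential N n c + N * (ρ λs + ρ μs)) * Q ≡⟨ identity (potential N n c) N (ρ λs) (ρ μs) Q ⟩
    (N * ρ λs * Q + N * ρ μs * Q) + potential N n c * Q ≤⟨ +-monoˡ-≤ _ (+-mono-≤ f f') ⟩
    b + d + potential N n c * Q ∎
  where
  open ≤-Reasoning
  Q = oddFactorial n
  identity : ∀ t N r r' Q → (t + N * (r + r')) * Q ≡ (N * r * Q + N * r' * Q) + t * Q
  identity = solve-∀

-- What one process offers to the coupling when 2 + m is the larger number of nonempty cycles. In
-- `spread` the peeled cycle has at least 3 sides: `za` and `zb` are the two outcomes that finish a
-- vertex, those in `S` may exceed the maximum, those in `M` fall below it. The alternative with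
-- empty `S` belongs to the process with fewer cycles. In `compact` the peeled cycle has 1 or 2
-- sides, and the budget has room for two further wild items, because the other process may have to
-- give up its `za` and `zb`.
data Present (N : ℕ) (A : ℕ → Bool) (n z : ℕ) (π : Bool) (m p v R : ℕ) : Set where
  spread : ∀ za zb bz S M → v ≡ za + zb + (val S + val M) →
    Item N A n (suc z) π (2 + m) (za , bz) → Item N A n (suc z) π (2 + m) (zb , bz) →
    All (Item N A n z π (3 + m)) S → All (Item N A n z π (1 + m)) M →
    length S + length M + 2 ≡ 2 * n + 1 →
    (2 + m) * length S + 3 * (2 + m) ≤ 2 * suc n ⊎ (length S ≡ 0 × p < 2 + m) →
    bz + bz + (cost S + cost M) ≤ N * oddFactorial n * 1344 →
    Present N A n z π m p v R
  compact : ∀ M → v ≡ val M → All (Item N A n z π (1 + m)) M → length M ≡ 2 * n + 1 →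
    cost M + 2 * (N * N * oddFactorial n) ≤ (2 * n + 1) * (N * R * oddFactorial n) →
    Present N A n z π m p v R

-- `24 * σ d` is the share of `ρ` charged to a cycle of length d created by a split. It is 11
-- instead of 10 for length 1, because the weight is quadratic and two such cycles cost 24 * 22.
-- `τ d` is the sum of `σ` over all lengths from d on and `κ r` the sum up to r, so that all splits
-- of a cycle together cost a constant.
σ τ κ : ℕ → ℕ
σ 1 = 11
σ 2 = 6
σ _ = 0
τ 0 = 17
τ 1 = 17
τ 2 = 6
τ _ = 0
κ 0 = 0
κ 1 = 11
κ _ = 17

σ-τ : ∀ d → σ d + τ (suc d) ≤ τ d
σ-τ 0 = ≤-refl
σ-τ 1 = ≤-refl
σ-τ 2 = ≤-refl
σ-τ (suc (suc (suc d))) = z≤n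

κ-σ : ∀ r → σ (suc r) + κ r ≤ κ (suc r)
κ-σ 0 = ≤-refl
κ-σ 1 = ≤-refl
κ-σ (suc (suc r)) = ≤-refl

τ≤17 : ∀ d → τ d ≤ 17
τ≤17 0 = ≤-refl
τ≤17 1 = ≤-refl
τ≤17 2 = m≤m+n 6 11
τ≤17 (suc (suc (suc d))) = z≤n

κ≤17 : ∀ d → κ d ≤ 17
κ≤17 0 = z≤n
κ≤17 1 = m≤m+n 11 6
κ≤17 (suc (suc d)) = ≤-refl

σ≤11 : ∀ d → σ d ≤ 11
σ≤11 0 = z≤n
σ≤11 1 = ≤-refl
σ≤11 2 = m≤m+n 6 5
σ≤11 (suc (suc (suc d))) = z≤n

small-pair : ∀ d e → quadratic (is1 d + is1 e) (is2 d + is2 e) ≤ 24 * (σ d + σ e)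
small-pair 0 0 = ≤-refl
small-pair 0 1 = m≤m+n 240 24
small-pair 0 2 = ≤-refl
small-pair 0 (suc (suc (suc e))) = ≤-refl
small-pair 1 0 = m≤m+n 240 24
small-pair 1 1 = ≤-refl
small-pair 1 2 = m≤m+n 384 24
small-pair 1 (suc (suc (suc e))) = m≤m+n 240 24
small-pair 2 0 = ≤-refl
small-pair 2 1 = m≤m+n 384 24
small-pair 2 2 = ≤-refl
small-pair 2 (suc (suc (suc e))) = ≤-refl
small-pair (suc (suc (suc d))) 0 = ≤-refl
small-pair (suc (suc (suc d))) 1 = m≤m+n 240 24
small-pair (suc (suc (suc d))) 2 = ≤-refl
small-pair (suc (suc (suc d))) (suc (suc (suc e))) = ≤-refl

-- The splits are taken from d = 1 on, since d = 0 finishes a vertex. So does the last one, whose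
-- second part is 0; its value is returned separately as `zb`. The charges of the others telescope
-- through `τ` and `κ`.
split-items : ∀ {V : List ℕ → ℕ → Set} {P : ℕ × ℕ → Set} c d r ν rest {vs} → 1 ≤ d →
  (∀ d e v → 1 ≤ d → 1 ≤ e → V (d ∷ e ∷ ν) v → P (v , c * (σ d + σ e))) →
  Pointwise V (splits d (suc r) ν ++ rest) vs →
  ∃[ S ] ∃[ zb ] ∃[ ws ] (sum vs ≡ val S + (zb + sum ws) × All P S × cost S ≤ c * (τ d + κ r) ×
    length S ≡ r × V ((d + r) ∷ 0 ∷ ν) zb × Pointwise V rest ws)
split-items {V} c d zero ν rest 1≤d h (x ∷ pw) =
  [] , _ , _ , refl , [] , z≤n , refl , subst (λ t → V (t ∷ 0 ∷ ν) _) (sym (+-identityʳ d)) x , pw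
split-items {V} c d (suc r) ν rest {v ∷ vs} 1≤d h (x ∷ pw) with split-items c (suc d) r ν rest (s≤s z≤n) h pw
... | S , zb , ws , s , ps , b , l , z , q = (_ , c * (σ d + σ (suc r))) ∷ S , zb , ws ,
      trans (cong (v +_) s) (sym (+-assoc v (val S) _)) , h d (suc r) _ 1≤d (s≤s z≤n) x ∷ ps ,
      (begin
        c * (σ d + σ (suc r)) + cost S ≤⟨ +-monoʳ-≤ _ b ⟩
        c * (σ d + σ (suc r)) + c * (τ (suc d) + κ r) ≡⟨ identity c (σ d) (σ (suc r)) (τ (suc d)) (κ r) ⟩
        c * ((σ d + τ (suc d)) + (σ (suc r) + κ r)) ≤⟨ *-monoʳ-≤ c (+-mono-≤ (σ-τ d) (κ-σ r)) ⟩
        c * (τ d + κ (suc r)) ∎) ,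
      cong suc l , subst (λ t → V (t ∷ 0 ∷ ν) zb) (sym (+-suc d r)) z , q
  where
  open ≤-Reasoning
  identity : ∀ c a b t k → c * (a + b) + c * (t + k) ≡ c * ((a + t) + (b + k))
  identity = solve-∀

min-facts : ∀ r ν → All (λ e → e ≡ 0 ⊎ 3 + r ≤ e) ν →
  cnt is1 ν ≡ 0 × cnt is2 ν ≡ 0 × cnt pos ν * (3 + r) ≤ sum ν
min-facts r [] [] = refl , refl , z≤n
min-facts r (zero ∷ ν) (_ ∷ min) = min-facts r ν min
min-facts r (1 ∷ ν) (inj₂ (s≤s ()) ∷ min)
min-facts r (2 ∷ ν) (inj₂ (s≤s (s≤s ())) ∷ min)
min-facts r (suc (suc (suc e)) ∷ ν) (inj₂ q ∷ min) with min-facts r ν min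
... | a , b , c = a , b , +-mono-≤ q c

pos-pos : ∀ {d} → 1 ≤ d → pos d ≡ 1
pos-pos (s≤s _) = refl

is0-pos : ∀ {d} → 1 ≤ d → is0 d ≡ 0
is0-pos (s≤s _) = refl

present-big : ∀ N A n m r ν {v} → All (λ e → e ≡ 0 ⊎ 3 + r ≤ e) ν → sum ((3 + r) ∷ ν) ≡ 2 * suc n →
  Val A (suc n) ((3 + r) ∷ ν) v → cnt pos ((3 + r) ∷ ν) ≡ 2 + m ⊎ 2 + cnt pos ((3 + r) ∷ ν) ≤ 2 + m → ∀ R →
  Present N A n (cnt is0 ((3 + r) ∷ ν)) (not (parity (length ((3 + r) ∷ ν)))) m (cnt pos ((3 + r) ∷ ν)) v R
present-big N A n m r ν {v} min s val₀ cap R = answer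
  where
  Q = oddFactorial n
  c = 24 * (N * Q)
  q = cnt pos ν
  z = cnt is0 ν
  π = not (not (parity (length ν)))
  n1 = proj₁ (min-facts r ν min)
  n2 = proj₁ (proj₂ (min-facts r ν min))
  runs = val₀ (2 + r) ν ↭-refl
  sums : All (λ o → sum o ≡ 2 * n) (outcomes (2 + r) ν)
  sums = outcomes-sum n (2 + r) ν s
  ρ-pair : ∀ d e → N * ρ (d ∷ e ∷ ν) * Q ≤ c * (σ d + σ e)
  ρ-pair d e = begin
      N * ρ (d ∷ e ∷ ν) * Q
        ≡⟨ cong₂ (λ a b → N * quadratic (is1 d + a) (is2 d + b) * Q)
             (trans (cong (is1 e +_) n1) (+-identityʳ _)) (trans (cong (is2 e +_) n2) (+-identityʳ _)) ⟩
      N * quadratic (is1 d + is1 e) (is2 d + is2 e) * Q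
        ≤⟨ *-monoˡ-≤ Q (*-monoʳ-≤ N (small-pair d e)) ⟩
      N * (24 * (σ d + σ e)) * Q ≡⟨ identity N (σ d + σ e) Q ⟩
      c * (σ d + σ e) ∎
    where
    open ≤-Reasoning
    identity : ∀ N t Q → N * (24 * t) * Q ≡ 24 * (N * Q) * t
    identity = solve-∀
  zero-cost : ∀ {d e} → σ d + σ e ≤ 11 → N * ρ (d ∷ e ∷ ν) * Q ≤ c * 11
  zero-cost {d} {e} h = ≤-trans (ρ-pair d e) (*-monoʳ-≤ c h)
  merge-cost : ∀ {e rest} → ν ↭ suc e ∷ rest → N * ρ ((2 + r + e) ∷ rest) * Q ≤ 0
  merge-cost {e} {rest} p = ≤-reflexive (trans (cong₂ (λ a b → N * quadratic a b * Q) ones twos)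
      (cong (_* Q) (*-zeroʳ N)))
    where
    large : 3 + r ≤ suc e
    large with All-resp-↭ p min
    ... | inj₂ h ∷ _ = h
    -- Two cycles with at least 3 sides merge into one with at least 3 + 3 - 2 sides, so a merge
    -- creates no small cycle and is free of charge.
    4≤ : 4 ≤ 2 + r + e
    4≤ = s≤s (s≤s (≤-trans (m≤m+n 2 r) (≤-trans (s≤s⁻¹ large) (m≤n+m e r))))
    is1-large : ∀ {x} → 4 ≤ x → is1 x ≡ 0
    is1-large (s≤s (s≤s _)) = refl
    is2-large : ∀ {x} → 4 ≤ x → is2 x ≡ 0
    is2-large (s≤s (s≤s (s≤s _))) = refl
    ones : cnt is1 ((2 + r + e) ∷ rest) ≡ 0
    ones = cong₂ _+_ (is1-large 4≤) (m+n≡0⇒n≡0 (is1 (suc e)) (trans (sym (cnt-↭ is1 p)) n1))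
    twos : cnt is2 ((2 + r + e) ∷ rest) ≡ 0
    twos = cong₂ _+_ (is2-large 4≤) (m+n≡0⇒n≡0 (is2 (suc e)) (trans (sym (cnt-↭ is2 p)) n2))
  V : List ℕ → ℕ → Set
  V o v = Val A n o v × sum o ≡ 2 * n
  split-item : ∀ d e v → 1 ≤ d → 1 ≤ e → V (d ∷ e ∷ ν) v → Item N A n z π (2 + q) (v , c * (σ d + σ e))
  split-item d e v 1≤d 1≤e (x , s') = genuine (d ∷ e ∷ ν) x s'
    (cong₂ (λ a b → a + (b + z)) (is0-pos 1≤d) (is0-pos 1≤e)) refl
    (≤-reflexive (cong₂ (λ a b → a + (b + q)) (pos-pos 1≤d) (pos-pos 1≤e))) (ρ-pair d e)
  merge-item : ∀ e rest v → ν ↭ suc e ∷ rest → V ((2 + r + e) ∷ rest) v → Item N A n z π q (v , 0)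
  merge-item e rest v p (x , s') = genuine ((2 + r + e) ∷ rest) x s' (sym (cnt-↭ is0 p))
    (trans (cong parity (sym (↭-length p))) (sym (not-involutive _)))
    (≤-reflexive (sym (cnt-↭ pos p))) (merge-cost p)
  -- Each of the 2 + m nonempty cycles has at least r + 3 of the 2 * (n + 1) unmatched sides. As r
  -- is the number of proper splits, this is the probability 1/m of the drift condition, together
  -- with its reserve.
  few : suc q ≡ 2 + m → (2 + m) * r + 3 * (2 + m) ≤ 2 * suc n
  few eq = begin
      (2 + m) * r + 3 * (2 + m) ≡⟨ identity m r ⟩
      (3 + r) + (1 + m) * (3 + r) ≤⟨ +-monoʳ-≤ (3 + r) (≤-trans (≤-reflexive (cong (_* (3 + r)) (sym (suc-injective eq))))
           (proj₂ (proj₂ (min-facts r ν min)))) ⟩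
      (3 + r) + sum ν ≡⟨ s ⟩
      2 * suc n ∎
    where
    open ≤-Reasoning
    identity : ∀ m r → (2 + m) * r + 3 * (2 + m) ≡ (3 + r) + (1 + m) * (3 + r)
    identity = solve-∀
  answer : Present N A n z π m (suc q) v R
  answer with runs
  ... | vs , pw₀ , v≡ with Pointwise-All pw₀ sums
  ...   | _∷_ {y = za} x pw
    with split-items c 1 r ν (merges (2 + r) [] ν) ≤-refl split-item pw
  ...   | S , zb , ws , s≡ , Ss , S-cost , S-len , y , pw'
    with merge-items (λ _ → 0) [] ν merge-item pw'
  ...   | M , w≡ , Ms , M-cost , M-len = choose cap
    where
    za-item : ∀ {k} → 1 + q ≤ k → Item N A n (suc z) π k (za , c * 11)
    za-item k = genuine (0 ∷ (1 + r) ∷ ν) (proj₁ x) (proj₂ x) refl refl k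
      (zero-cost {0} {1 + r} (σ≤11 (1 + r)))
    zb-item : ∀ {k} → 1 + q ≤ k → Item N A n (suc z) π k (zb , c * 11)
    zb-item k = genuine ((1 + r) ∷ 0 ∷ ν) (proj₁ y) (proj₂ y) refl refl k
      (zero-cost {1 + r} {0} (≤-trans (≤-reflexive (+-identityʳ _)) (σ≤11 (1 + r))))
    value : v ≡ za + zb + (val S + val M)
    value = trans v≡ (trans (cong (za +_) (trans s≡ (cong (λ t → val S + (zb + t)) w≡)))
              (identity za (val S) zb (val M)))
      where
      identity : ∀ a s b m → a + (s + (b + m)) ≡ a + b + (s + m)
      identity = solve-∀
    M-free : cost M ≡ 0
    M-free = trans M-cost (zeros ν)
      where
      zeros : ∀ ν → sum (map (λ e → e * 0) ν) ≡ 0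
      zeros [] = refl
      zeros (e ∷ ν) = cong₂ _+_ (*-zeroʳ e) (zeros ν)
    costs : c * 11 + c * 11 + (cost S + cost M) ≤ N * Q * 1344
    costs = begin
        c * 11 + c * 11 + (cost S + cost M) ≡⟨ cong (λ t → c * 11 + c * 11 + (cost S + t)) M-free ⟩
        c * 11 + c * 11 + (cost S + 0)
          ≤⟨ +-monoʳ-≤ (c * 11 + c * 11) (+-monoˡ-≤ 0 (≤-trans S-cost (*-monoʳ-≤ c (+-mono-≤ (τ≤17 1) (κ≤17 r))))) ⟩
        -- 1344 = 24 * (11 + 11 + 34): the two outcomes that finish a vertex, and all proper splits
        -- together.
        c * 11 + c * 11 + (c * 34 + 0) ≡⟨ identity (N * Q) ⟩
        N * Q * 1344 ∎
      where
      open ≤-Reasoning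
      identity : ∀ t → 24 * t * 11 + 24 * t * 11 + (24 * t * 34 + 0) ≡ t * 1344
      identity = solve-∀
    count : length S + length M + 2 ≡ 2 * n + 1
    count = trans (cong₂ (λ a b → a + b + 2) S-len M-len)
        (+-cancelʳ-≡ 1 _ _ (trans (identity r (sum ν)) (trans s (twice n))))
      where
      identity : ∀ r s → r + s + 2 + 1 ≡ 3 + r + s
      identity = solve-∀
      twice : ∀ n → 2 * suc n ≡ 2 * n + 1 + 1
      twice = solve-∀
    choose : suc q ≡ 2 + m ⊎ 2 + suc q ≤ 2 + m → Present N A n z π m (suc q) v R
    choose (inj₁ eq) = spread za zb (c * 11) S M value (za-item (≤-reflexive eq)) (zb-item (≤-reflexive eq))
      (All.map (item-weaken (≤-reflexive (cong suc eq))) Ss)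
      (All.map (item-weaken (≤-reflexive (suc-injective eq))) Ms) count
      (inj₁ (subst (λ t → (2 + m) * t + 3 * (2 + m) ≤ 2 * suc n) (sym S-len) (few eq))) costs
    -- This process has at least two cycles fewer than the maximum, so even after a split it is at
    -- least one below it. Its splits are therefore as good as merges and are moved to `M`.
    choose (inj₂ le) = spread za zb (c * 11) [] (S ++ M) (trans value (cong (za + zb +_) (sym val-++)))
      (za-item q<m) (zb-item q<m) []
      (AllP.++⁺ (All.map (item-weaken (s≤s⁻¹ le)) Ss)
                (All.map (item-weaken (≤-trans (n≤1+n _) (≤-trans (n≤1+n _) (s≤s⁻¹ le)))) Ms))
      (trans (cong (_+ 2) (length-++ S)) count) (inj₂ (refl , ≤-trans (n≤1+n _) le))
      (subst (λ t → c * 11 + c * 11 + t ≤ N * Q * 1344) (sym cost-++) costs)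
      where
      q<m : 1 + q ≤ 2 + m
      q<m = ≤-trans (n≤1+n _) (≤-trans (n≤1+n _) le)
      val-++ : val (S ++ M) ≡ val S + val M
      val-++ = trans (cong sum (map-++ proj₁ S M)) (sum-++ (map proj₁ S) _)
      cost-++ : cost (S ++ M) ≡ cost S + cost M
      cost-++ = trans (cong sum (map-++ proj₂ S M)) (sum-++ (map proj₂ S) _)

sum-const : ∀ b ν → sum (map (λ e → e * b) ν) ≡ sum ν * b
sum-const b [] = refl
sum-const b (e ∷ ν) = trans (cong (e * b +_) (sum-const b ν)) (sym (*-distribʳ-+ b e (sum ν)))

-- N is at most 48 times the number of outcomes. So a wild outcome, which costs N² times the number
-- of remaining matchings, is paid for when `ρ` drops by 48 in all outcomes.
sides-bound : ∀ {N} n → N ≤ 48 * suc n → N ≤ 48 * (2 * n + 1)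
sides-bound n N≤ = ≤-trans N≤ (*-monoʳ-≤ 48 (≤-trans (m≤m+n (suc n) n) (≤-reflexive (double n))))
  where
  double : ∀ n → suc n + n ≡ 2 * n + 1
  double = solve-∀

-- Merging a cycle of length 2 into another one leaves the length of the latter unchanged, so the
-- weight falls to `ρ ν`. The drop 24 * 6 = 3 * 48 pays for the only split, which finishes two
-- vertices and is wild, and for the two wild items that the other process may need.
present-two : ∀ N A n m ν {v} → N ≤ 48 * suc n → sum (2 ∷ ν) ≡ 2 * suc n → Val A (suc n) (2 ∷ ν) v →
  cnt pos (2 ∷ ν) ≤ 2 + m →
  Present N A n (cnt is0 (2 ∷ ν)) (not (parity (length (2 ∷ ν)))) m (cnt pos (2 ∷ ν)) v (ρ (2 ∷ ν))
present-two N A n m ν {v} N≤ s val₀ cap with val₀ 1 ν ↭-refl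
... | vs , pw₀ , v≡ with Pointwise-All pw₀ (outcomes-sum n 1 ν s)
...   | _∷_ {y = z₀} x pw with merge-items (λ _ → N * ρ ν * oddFactorial n) [] ν merge-item pw
  where
  merge-item : ∀ e rest w → ν ↭ suc e ∷ rest → Val A n ((1 + e) ∷ rest) w × sum ((1 + e) ∷ rest) ≡ 2 * n →
    Item N A n (cnt is0 ν) (not (not (parity (length ν)))) (1 + m) (w , N * ρ ν * oddFactorial n)
  merge-item e rest w p (y , s') = genuine ((1 + e) ∷ rest) y s' (sym (cnt-↭ is0 p))
    (trans (cong parity (sym (↭-length p))) (sym (not-involutive _)))
    (≤-trans (≤-reflexive (sym (cnt-↭ pos p))) (s≤s⁻¹ cap))
    (≤-reflexive (cong (λ t → N * t * oddFactorial n) (sym (ρ-↭ p))))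
...     | M , w≡ , Ms , M-cost , M-len =
  compact ((z₀ , N * N * Q) ∷ M) (trans v≡ (cong (z₀ +_) w≡))
    (wild (Val-bounded n (proj₂ x) (proj₁ x)) ≤-refl ∷ Ms)
    (trans (cong suc (trans M-len sumν)) (+-comm 1 (2 * n))) (begin
      N * N * Q + cost M + 2 * (N * N * Q)
        ≡⟨ cong (λ t → N * N * Q + t + 2 * (N * N * Q)) (trans M-cost (trans (sum-const _ ν) (cong (_* (N * ρ ν * Q)) sumν))) ⟩
      N * N * Q + 2 * n * (N * ρ ν * Q) + 2 * (N * N * Q)
        ≡⟨ regroup N Q n (ρ ν) ⟩
      2 * n * (N * ρ ν * Q) + 3 * (N * (N * Q))
        ≤⟨ +-mono-≤ (*-monoˡ-≤ (N * ρ ν * Q) (m≤m+n (2 * n) 1)) (*-monoʳ-≤ 3 (*-monoˡ-≤ (N * Q) (sides-bound n N≤))) ⟩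
      (2 * n + 1) * (N * ρ ν * Q) + 3 * (48 * (2 * n + 1) * (N * Q))
        ≡⟨ collect N Q n (cnt is1 ν) (cnt is2 ν) ⟩
      (2 * n + 1) * (N * ρ (2 ∷ ν) * Q) ∎)
  where
  open ≤-Reasoning
  Q = oddFactorial n
  sumν : sum ν ≡ 2 * n
  sumν = suc-injective (suc-injective (trans s (*-suc 2 n)))
  regroup : ∀ N Q n r → N * N * Q + 2 * n * (N * r * Q) + 2 * (N * N * Q) ≡ 2 * n * (N * r * Q) + 3 * (N * (N * Q))
  regroup = solve-∀
  collect : ∀ N Q n a b → (2 * n + 1) * (N * (24 * (a * a + 9 * a + 6 * b)) * Q) + 3 * (48 * (2 * n + 1) * (N * Q))
    ≡ (2 * n + 1) * (N * (24 * (a * a + 9 * a + 6 * suc b)) * Q)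
  collect = solve-∀

-- A cycle of length 1 cannot split, and merging it shortens the other cycle by one. With k other
-- cycles of length 1 there are k wild outcomes; in the remaining ones the weight is at most
-- `quadratic k 1`, since at most one cycle of length 2 appears. This is 48 * (k + 2) below the old
-- weight `quadratic (1 + k) 0`.
present-one : ∀ N A n m ν {v} → N ≤ 48 * suc n → cnt is2 ν ≡ 0 → sum (1 ∷ ν) ≡ 2 * suc n →
  Val A (suc n) (1 ∷ ν) v → cnt pos (1 ∷ ν) ≤ 2 + m →
  Present N A n (cnt is0 (1 ∷ ν)) (not (parity (length (1 ∷ ν)))) m (cnt pos (1 ∷ ν)) v (ρ (1 ∷ ν))
present-one N A n m ν {v} N≤ no2 s val₀ cap = answer
  where
  Q = oddFactorial n
  k = cnt is1 ν
  b' = N * quadratic k 1 * Q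
  β : ℕ → ℕ
  β 1 = N * N * Q
  β _ = b'
  is2≤1 : ∀ e → is2 e ≤ 1
  is2≤1 0 = z≤n
  is2≤1 1 = z≤n
  is2≤1 2 = ≤-refl
  is2≤1 (suc (suc (suc e))) = z≤n
  merge-item : ∀ e rest w → ν ↭ suc e ∷ rest → Val A n (e ∷ rest) w × sum (e ∷ rest) ≡ 2 * n →
    Item N A n (cnt is0 ν) (not (not (parity (length ν)))) (1 + m) (w , β (suc e))
  merge-item zero rest w p (y , s') = wild (Val-bounded n s' y) ≤-refl
  -- A merge with a cycle of length 2 would leave a new cycle of length 1, but there are none of
  -- length 2 by `no2`.
  merge-item (suc zero) rest w p (y , s') with trans (sym no2) (cnt-↭ is2 p)
  ... | ()
  merge-item (suc (suc e)) rest w p (y , s') = genuine (2 + e ∷ rest) y s' (sym (cnt-↭ is0 p))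
    (trans (cong parity (sym (↭-length p))) (sym (not-involutive _)))
    (≤-trans (≤-reflexive (sym (cnt-↭ pos p))) (s≤s⁻¹ cap))
    (*-monoˡ-≤ Q (*-monoʳ-≤ N (quadratic-mono {cnt is1 (2 + e ∷ rest)} {k} {cnt is2 (2 + e ∷ rest)}
      (≤-reflexive (sym (cnt-↭ is1 p)))
      (+-mono-≤ (is2≤1 (2 + e)) (≤-reflexive (m+n≡0⇒n≡0 (is2 (3 + e)) (trans (sym (cnt-↭ is2 p)) no2)))))))
  β-sum : ∀ ν → sum (map (λ e → e * β e) ν) ≤ cnt is1 ν * (N * N * Q) + sum ν * b'
  β-sum [] = z≤n
  β-sum (0 ∷ ν) = β-sum ν
  β-sum (1 ∷ ν) = ≤-trans (+-monoʳ-≤ _ (β-sum ν)) (≤-trans (m≤m+n _ b')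
      (≤-reflexive (identity (N * N * Q) (cnt is1 ν) (sum ν) b')))
    where
    identity : ∀ c k s b → 1 * c + (k * c + s * b) + b ≡ (1 + k) * c + (1 + s) * b
    identity = solve-∀
  β-sum (suc (suc e) ∷ ν) = ≤-trans (+-monoʳ-≤ _ (β-sum ν))
      (≤-reflexive (identity (2 + e) b' (cnt is1 ν * (N * N * Q)) (sum ν)))
    where
    identity : ∀ e b c s → e * b + (c + s * b) ≡ c + (e + s) * b
    identity = solve-∀
  sumν : sum ν ≡ 2 * n + 1
  sumν = suc-injective (trans s (twice n))
    where
    twice : ∀ n → 2 * suc n ≡ suc (2 * n + 1)
    twice = solve-∀
  answer : Present N A n (cnt is0 (1 ∷ ν)) (not (parity (length (1 ∷ ν)))) m (cnt pos (1 ∷ ν)) v (ρ (1 ∷ ν))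
  answer with val₀ 0 ν ↭-refl
  ... | vs , pw₀ , v≡ with Pointwise-All pw₀ (outcomes-sum n 0 ν s)
  ...   | pw with merge-items β [] ν merge-item pw
  ...     | M , w≡ , Ms , M-cost , M-len =
    compact M (trans v≡ w≡) Ms (trans M-len sumν) (begin
      cost M + 2 * (N * N * Q)
        ≤⟨ +-monoˡ-≤ _ (≤-trans (≤-reflexive M-cost) (≤-trans (β-sum ν)
             (≤-reflexive (cong (λ t → k * (N * N * Q) + t * b') sumν)))) ⟩
      k * (N * N * Q) + (2 * n + 1) * b' + 2 * (N * N * Q)
        ≡⟨ regroup N Q k ((2 * n + 1) * b') ⟩
      (2 * n + 1) * b' + (k + 2) * (N * (N * Q))
        ≤⟨ +-monoʳ-≤ _ (*-monoʳ-≤ (k + 2) (*-monoˡ-≤ (N * Q) (sides-bound n N≤))) ⟩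
      (2 * n + 1) * b' + (k + 2) * (48 * (2 * n + 1) * (N * Q))
        ≡⟨ collect N Q n k ⟩
      (2 * n + 1) * (N * quadratic (1 + k) 0 * Q)
        ≡⟨ cong (λ t → (2 * n + 1) * (N * quadratic (1 + k) t * Q)) (sym no2) ⟩
      (2 * n + 1) * (N * ρ (1 ∷ ν) * Q) ∎)
    where
    open ≤-Reasoning
    regroup : ∀ N Q k c → k * (N * N * Q) + c + 2 * (N * N * Q) ≡ c + (k + 2) * (N * (N * Q))
    regroup = solve-∀
    collect : ∀ N Q n k → (2 * n + 1) * (N * (24 * (k * k + 9 * k + 6 * 1)) * Q)
        + (k + 2) * (48 * (2 * n + 1) * (N * Q))
      ≡ (2 * n + 1) * (N * (24 * ((1 + k) * (1 + k) + 9 * (1 + k) + 6 * 0)) * Q)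
    collect = solve-∀

at-most : ∀ {m x} → x ≡ 2 + m ⊎ 2 + x ≤ 2 + m → x ≤ 2 + m
at-most (inj₁ e) = ≤-reflexive e
at-most (inj₂ l) = ≤-trans (m≤n+m _ 2) l

present : ∀ N A n m {λs v} → N ≤ 48 * suc n → sum λs ≡ 2 * suc n → Val A (suc n) λs v →
  cnt pos λs ≡ 2 + m ⊎ 2 + cnt pos λs ≤ 2 + m →
  Present N A n (cnt is0 λs) (not (parity (length λs))) m (cnt pos λs) v (ρ λs)
present N A n m {λs} {v} N≤ s val₀ cap with peel n λs s
... | two ν p rewrite cnt-↭ is0 p | cnt-↭ pos p | ρ-↭ p | ↭-length p =
  present-two N A n m ν N≤ (trans (sym (sum-↭ p)) s) (Val-↭ (suc n) p val₀) (at-most cap)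
... | one ν p no2 rewrite cnt-↭ is0 p | cnt-↭ pos p | ρ-↭ p | ↭-length p =
  present-one N A n m ν N≤ no2 (trans (sym (sum-↭ p)) s) (Val-↭ (suc n) p val₀) (at-most cap)
... | big r ν p min rewrite cnt-↭ is0 p | cnt-↭ pos p | ρ-↭ p | ↭-length p =
  present-big N A n m r ν min (trans (sym (sum-↭ p)) s) (Val-↭ (suc n) p val₀) cap _

-- The outcomes of one process when those that finish a vertex cannot be matched with each other:
-- they are among `M` as wild items. This form is used as soon as one of the two processes peels a
-- small cycle, because then the two numbers of such outcomes may differ.
record Flat (N : ℕ) (A : ℕ → Bool) (n z : ℕ) (π : Bool) (m v B : ℕ) : Set where
  constructor flat
  field
    S M : List (ℕ × ℕ)
    value : v ≡ val S + val M
    S-items : All (Item N A n z π (3 + m)) S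
    M-items : All (Item N A n z π (1 + m)) M
    total : length S + length M ≡ 2 * n + 1
    few : (2 + m) * length S + 3 * (2 + m) ≤ 2 * suc n ⊎ length S ≡ 0
    costs : cost S + cost M ≤ B

few-⊔ : ∀ {c d k a b} → c * a + d ≤ k ⊎ a ≡ 0 → c * b + d ≤ k ⊎ b ≡ 0 → c * (a ⊔ b) + d ≤ k ⊎ a ⊔ b ≡ 0
few-⊔ {a = a} {b} p q with ≤-total a b
... | inj₁ a≤b rewrite m≤n⇒m⊔n≡n a≤b = q
... | inj₂ b≤a rewrite m≥n⇒m⊔n≡m b≤a = p

flat-close : ∀ {N A n z π m v w B C R} → Bound N A n → N ≤ 48 * suc n →
  Flat N A n z π m v B → Flat N A n z π m w C →
  B + C ≤ (2 * n + 1) * (N * R * oddFactorial n) + N * oddFactorial n * 2688 →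
  N * N * ∣ v - w ∣ ≤ (potential N (suc n) (2 + m) + N * R) * oddFactorial (suc n)
flat-close {N} {A} {n} {z} {π} {m} {v} {w} {B} {C} {R} bound N≤ f g paid
  with zip-sorted {N * N} {potential N n (3 + m) * oddFactorial n} {potential N n (1 + m) * oddFactorial n}
         (item-weaken (m≤n+m (1 + m) 2)) (item-weaken (m≤n+m (1 + m) 2)) (item-close bound) (item-close bound)
         (Flat.S-items f) (Flat.M-items f) (Flat.S-items g) (Flat.M-items g)
         (trans (Flat.total f) (sym (Flat.total g)))
... | ng , count , close = begin
    N * N * ∣ v - w ∣
      ≡⟨ cong₂ (λ x y → N * N * ∣ x - y ∣) (Flat.value f) (Flat.value g) ⟩
    N * N * ∣ (val (Flat.S f) + val (Flat.M f)) - (val (Flat.S g) + val (Flat.M g)) ∣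
      ≤⟨ close ⟩
    _ ≤⟨ +-monoˡ-≤ _ (≤-trans (+-mono-≤ (Flat.costs f) (Flat.costs g)) paid) ⟩
    (2 * n + 1) * (N * R * Q) + N * Q * 2688 + (nb * (potential N n (3 + m) * Q) + ng * (potential N n (1 + m) * Q))
      ≡⟨ regroup n N R Q nb ng (potential N n (3 + m)) (potential N n (1 + m)) (potential N n (2 + m)) ⟩
    (2 * n + 1) * (N * R * Q) + (nb * potential N n (3 + m) + ng * potential N n (1 + m) + 0 * potential N n (2 + m) + N * 2688) * Q
      ≤⟨ +-monoʳ-≤ ((2 * n + 1) * (N * R * Q)) (*-monoˡ-≤ Q (potential-drift N n m nb ng 0
           (trans (+-identityʳ _) total) N≤
           (drift-without-zeros m n nb ng total (few-⊔ {2 + m} {3 * (2 + m)} (Flat.few f) (Flat.few g))))) ⟩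
    (2 * n + 1) * (N * R * Q) + (2 * n + 1) * potential N (suc n) (2 + m) * Q
      ≡⟨ collect n N R Q (potential N (suc n) (2 + m)) ⟩
    (potential N (suc n) (2 + m) + N * R) * oddFactorial (suc n) ∎
  where
  open ≤-Reasoning
  Q = oddFactorial n
  nb = length (Flat.S f) ⊔ length (Flat.S g)
  total : nb + ng ≡ 2 * n + 1
  total = trans count (Flat.total f)
  regroup : ∀ n N R Q nb ng t₃ t₁ t₂ →
    (2 * n + 1) * (N * R * Q) + N * Q * 2688 + (nb * (t₃ * Q) + ng * (t₁ * Q))
    ≡ (2 * n + 1) * (N * R * Q) + (nb * t₃ + ng * t₁ + 0 * t₂ + N * 2688) * Q
  regroup = solve-∀
  collect : ∀ n N R Q t → (2 * n + 1) * (N * R * Q) + (2 * n + 1) * t * Q ≡ (t + N * R) * ((2 * n + 1) * Q)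
  collect = solve-∀

flatten-spread : ∀ {N A n z π m v} za zb bz S M → v ≡ za + zb + (val S + val M) →
  za ≤ oddFactorial n → zb ≤ oddFactorial n →
  All (Item N A n z π (3 + m)) S → All (Item N A n z π (1 + m)) M →
  length S + length M + 2 ≡ 2 * n + 1 →
  (2 + m) * length S + 3 * (2 + m) ≤ 2 * suc n ⊎ length S ≡ 0 →
  bz + bz + (cost S + cost M) ≤ N * oddFactorial n * 1344 →
  Flat N A n z π m v (2 * (N * N * oddFactorial n) + N * oddFactorial n * 1344)
flatten-spread {N} {n = n} za zb bz S M v≡ za≤ zb≤ Ss Ms count few costs =
  flat S ((za , W) ∷ (zb , W) ∷ M) (trans v≡ (rearrange za zb (val S) (val M))) Ss
    (wild za≤ ≤-refl ∷ wild zb≤ ≤-refl ∷ Ms)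
    (trans (shift2 (length S) (length M)) count) few
    (≤-trans (≤-reflexive (rearrange' W (cost S) (cost M)))
      (+-monoʳ-≤ (2 * W) (≤-trans (m≤n+m _ (bz + bz)) costs)))
  where
  W = N * N * oddFactorial n
  rearrange : ∀ a b s m → a + b + (s + m) ≡ s + (a + (b + m))
  rearrange = solve-∀
  rearrange' : ∀ w s m → s + (w + (w + m)) ≡ 2 * w + (s + m)
  rearrange' = solve-∀
  shift2 : ∀ s m → s + suc (suc m) ≡ s + m + 2
  shift2 = solve-∀

flatten-compact : ∀ {N A n z π m v B} M → v ≡ val M → All (Item N A n z π (1 + m)) M →
  length M ≡ 2 * n + 1 → cost M ≤ B → Flat N A n z π m v B
flatten-compact M v≡ Ms count costs = flat [] M v≡ [] Ms count (inj₂ refl) costs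

presented-close : ∀ {N A n z π m p q v w R R'} → Bound N A n → N ≤ 48 * suc n →
  p ≡ 2 + m ⊎ q ≡ 2 + m → Present N A n z π m p v R → Present N A n z π m q w R' →
  N * N * ∣ v - w ∣ ≤ (potential N (suc n) (2 + m) + N * (R + R')) * oddFactorial (suc n)
presented-close {N} {n = n} {R = R} {R'} bound N≤ max
  (compact M v≡ Ms count costs) (compact M' w≡ Ms' count' costs') =
  flat-close bound N≤ (flatten-compact M v≡ Ms count ≤-refl) (flatten-compact M' w≡ Ms' count' ≤-refl)
    (≤-trans (+-mono-≤ (m+n≤o⇒m≤o (cost M) costs) (m+n≤o⇒m≤o (cost M') costs'))
      (≤-trans (≤-reflexive (identity n N R R' (oddFactorial n))) (m≤m+n _ _)))
  where
  identity : ∀ n N R R' Q → (2 * n + 1) * (N * R * Q) + (2 * n + 1) * (N * R' * Q)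
    ≡ (2 * n + 1) * (N * (R + R') * Q)
  identity = solve-∀
presented-close {N} {n = n} {R = R} {R'} bound N≤ max
  (spread za zb bz S M v≡ ia ib Ss Ms count few costs) (compact M' w≡ Ms' count' costs') =
  -- The compact side has no counterparts for `za` and `zb`. They become wild, at the price `2 * W`
  -- that `costs'` holds in reserve.
  flat-close bound N≤
    (flatten-spread za zb bz S M v≡ (item-bounded ia) (item-bounded ib) Ss Ms count (weak few) costs)
    (flatten-compact M' w≡ Ms' count' ≤-refl) (begin
      2 * W + NQ * 1344 + cost M' ≡⟨ regroup W NQ (cost M') ⟩
      (cost M' + 2 * W) + NQ * 1344 ≤⟨ +-mono-≤ costs' (*-monoʳ-≤ NQ (m≤m+n 1344 1344)) ⟩
      (2 * n + 1) * (N * R' * Q) + NQ * 2688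
        ≤⟨ +-monoˡ-≤ _ (*-monoʳ-≤ (2 * n + 1) (*-monoˡ-≤ Q (*-monoʳ-≤ N (m≤n+m R' R)))) ⟩
      (2 * n + 1) * (N * (R + R') * Q) + NQ * 2688 ∎)
  where
  open ≤-Reasoning
  Q = oddFactorial n
  W = N * N * Q
  NQ = N * Q
  weak : ∀ {P Q R : Set} → P ⊎ (Q × R) → P ⊎ Q
  weak (inj₁ p) = inj₁ p
  weak (inj₂ (q , _)) = inj₂ q
  regroup : ∀ w t c → 2 * w + t * 1344 + c ≡ (c + 2 * w) + t * 1344
  regroup = solve-∀
presented-close {N} {A} {n} {z} {π} {m} {p} {q} {v} {w} {R} {R'} bound N≤ max
  f@(compact _ _ _ _ _) g@(spread _ _ _ _ _ _ _ _ _ _ _ _ _) =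
  subst₂ (λ x y → N * N * x ≤ (potential N (suc n) (2 + m) + N * y) * oddFactorial (suc n))
    (∣-∣-comm w v) (+-comm R' R) (presented-close bound N≤ (Sum.swap max) g f)
presented-close {N} {A} {n} {z} {π} {m} {p} {q} {v} {w} {R} {R'} bound N≤ max
  (spread za zb bz S M v≡ ia ib Ss Ms count few costs)
  (spread za' zb' bz' S' M' w≡ ia' ib' Ss' Ms' count' few' costs')
  with zip-sorted {N * N} {potential N n (3 + m) * oddFactorial n} {potential N n (1 + m) * oddFactorial n}
         (item-weaken (m≤n+m (1 + m) 2)) (item-weaken (m≤n+m (1 + m) 2)) (item-close bound) (item-close bound)
         Ss Ms Ss' Ms' (+-cancelʳ-≡ 2 _ _ (trans count (sym count')))
... | ng , zipped , close = begin
    N * N * ∣ v - w ∣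
      ≡⟨ cong₂ (λ x y → N * N * ∣ x - y ∣) v≡ w≡ ⟩
    N * N * ∣ (za + zb + (val S + val M)) - (za' + zb' + (val S' + val M')) ∣
      ≤⟨ close-sum (N * N) (t₂ + t₂) (nb * (potential N n (3 + m) * Q) + ng * (potential N n (1 + m) * Q))
           (za + zb) (za' + zb') (bz + bz) (bz' + bz') (val S + val M) (val S' + val M')
           (cost S + cost M) (cost S' + cost M')
           -- Outcomes that finish a vertex are matched with each other, so the numbers of finished
           -- vertices stay equal; the number of nonempty cycles does not change in them, hence the
           -- potential at 2 + m.
           (close-sum (N * N) t₂ t₂ za za' bz bz' zb zb' bz bz' (item-close bound ia ia') (item-close bound ib ib'))
           close ⟩
    (bz + bz + (cost S + cost M)) + (bz' + bz' + (cost S' + cost M'))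
      + (t₂ + t₂ + (nb * (potential N n (3 + m) * Q) + ng * (potential N n (1 + m) * Q)))
      ≤⟨ +-monoˡ-≤ _ (+-mono-≤ costs costs') ⟩
    N * Q * 1344 + N * Q * 1344 + (t₂ + t₂ + (nb * (potential N n (3 + m) * Q) + ng * (potential N n (1 + m) * Q)))
      ≡⟨ regroup N Q nb ng (potential N n (3 + m)) (potential N n (1 + m)) (potential N n (2 + m)) ⟩
    (nb * potential N n (3 + m) + ng * potential N n (1 + m) + 2 * potential N n (2 + m) + N * 2688) * Q
      ≤⟨ *-monoˡ-≤ Q (potential-drift N n m nb ng 2 total N≤ (drift-with-zeros m n nb ng total (few-max max few few'))) ⟩
    (2 * n + 1) * potential N (suc n) (2 + m) * Q
      ≤⟨ *-monoˡ-≤ Q (*-monoʳ-≤ (2 * n + 1) (m≤m+n _ (N * (R + R')))) ⟩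
    (2 * n + 1) * (potential N (suc n) (2 + m) + N * (R + R')) * Q
      ≡⟨ collect n Q (potential N (suc n) (2 + m) + N * (R + R')) ⟩
    (potential N (suc n) (2 + m) + N * (R + R')) * oddFactorial (suc n) ∎
  where
  open ≤-Reasoning
  Q = oddFactorial n
  t₂ = potential N n (2 + m) * Q
  nb = length S ⊔ length S'
  total : nb + ng + 2 ≡ 2 * n + 1
  total = trans (cong (_+ 2) zipped) count
  Few : ℕ → ℕ → Set
  Few p k = (2 + m) * k + 3 * (2 + m) ≤ 2 * suc n ⊎ (k ≡ 0 × p < 2 + m)
  few-max : ∀ {p q a b} → p ≡ 2 + m ⊎ q ≡ 2 + m → Few p a → Few q b →
    (2 + m) * (a ⊔ b) + 3 * (2 + m) ≤ 2 * suc n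
  few-max {a = a} {b} max (inj₁ f) (inj₁ g) with ≤-total a b
  ... | inj₁ le rewrite m≤n⇒m⊔n≡n le = g
  ... | inj₂ ge rewrite m≥n⇒m⊔n≡m ge = f
  few-max {a = a} max (inj₁ f) (inj₂ (refl , _)) rewrite ⊔-identityʳ a = f
  few-max max (inj₂ (refl , _)) (inj₁ g) = g
  few-max (inj₁ refl) (inj₂ (_ , l)) (inj₂ _) = ⊥-elim (<-irrefl refl l)
  few-max (inj₂ refl) (inj₂ _) (inj₂ (_ , l)) = ⊥-elim (<-irrefl refl l)
  regroup : ∀ N Q nb ng t₃ t₁ t₂ →
    N * Q * 1344 + N * Q * 1344 + (t₂ * Q + t₂ * Q + (nb * (t₃ * Q) + ng * (t₁ * Q)))
    ≡ (nb * t₃ + ng * t₁ + 2 * t₂ + N * 2688) * Q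
  regroup = solve-∀
  collect : ∀ n Q t → (2 * n + 1) * t * Q ≡ t * ((2 * n + 1) * Q)
  collect = solve-∀

-- Coalescence and the induction on the number of unmatched pairs

length-zeros : ∀ λs → length λs ≡ cnt is0 λs + cnt pos λs
length-zeros [] = refl
length-zeros (zero ∷ λs) = cong suc (length-zeros λs)
length-zeros (suc x ∷ λs) = trans (cong suc (length-zeros λs)) (sym (+-suc (cnt is0 λs) (cnt pos λs)))

parity-cancel : ∀ z {p q} → parity (z + p) ≡ parity (z + q) → parity p ≡ parity q
parity-cancel zero e = e
parity-cancel (suc z) e = parity-cancel z (not-injective e)

parity-gap : ∀ {p q} → parity p ≡ parity q → p < q → 2 + p ≤ q
parity-gap {zero} {suc (suc q)} e l = s≤s (s≤s z≤n)
parity-gap {zero} {suc zero} () l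
parity-gap {suc p} {suc q} e (s≤s l) = s≤s (parity-gap (not-injective e) l)

no-parts : ∀ {λs} → cnt pos λs ≡ 0 → All (_≡ 0) λs
no-parts {[]} e = []
no-parts {zero ∷ λs} e = refl ∷ no-parts e

all-zeros-unique : ∀ {λs μs} → All (_≡ 0) λs → All (_≡ 0) μs → cnt is0 λs ≡ cnt is0 μs → λs ≡ μs
all-zeros-unique [] [] e = refl
all-zeros-unique [] (refl ∷ zs) ()
all-zeros-unique (refl ∷ zs) [] ()
all-zeros-unique (refl ∷ zs) (refl ∷ zs') e = cong (0 ∷_) (all-zeros-unique zs zs' (suc-injective e))

-- This is coalescence: the length of the only nonempty cycle is the number of unmatched sides, and
-- all other cycles are finished vertices, whose numbers agree.
single-part : ∀ n {λs μs} → sum λs ≡ 2 * suc n → sum μs ≡ 2 * suc n → cnt is0 λs ≡ cnt is0 μs →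
  cnt pos λs ≤ 1 → cnt pos μs ≤ 1 → λs ↭ μs
single-part n {λs} {μs} s s' z p q with nonzero-part n λs s | nonzero-part n μs s'
... | r , ν , e , _ | r' , ν' , e' , _ = ↭-trans e (↭-trans (↭-reflexive same) (↭-sym e'))
  where
  rest≡0 : ∀ {r ν ξ} → ξ ↭ suc r ∷ ν → cnt pos ξ ≤ 1 → All (_≡ 0) ν
  rest≡0 f l = no-parts (n≤0⇒n≡0 (s≤s⁻¹ (≤-trans (≤-reflexive (sym (cnt-↭ pos f))) l)))
  Zν = rest≡0 e p
  Zν' = rest≡0 e' q
  head : ∀ {r ν ξ} → ξ ↭ suc r ∷ ν → All (_≡ 0) ν → sum ξ ≡ 2 * suc n → suc r ≡ 2 * suc n
  head {r} f zs t = trans (sym (+-identityʳ _)) (trans (cong (suc r +_) (sym (all-zero-sum zs))) (trans (sym (sum-↭ f)) t))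
  same : suc r ∷ ν ≡ suc r' ∷ ν'
  same = cong₂ _∷_ (trans (head e Zν s) (sym (head e' Zν' s')))
    (all-zeros-unique Zν Zν' (trans (sym (cnt-↭ is0 e)) (trans z (cnt-↭ is0 e'))))

small-state : ∀ N n m v w → 48 * suc n ≤ N → v ≤ oddFactorial (suc n) → w ≤ oddFactorial (suc n) →
  ∀ R → N * N * ∣ v - w ∣ ≤ (potential N (suc n) m + R) * oddFactorial (suc n)
small-state N n m v w small v≤ w≤ R =
  *-mono-≤ (≤-trans (potential-large N n m small) (m≤m+n _ R)) (dist-≤ v≤ w≤)

bound-step : ∀ N A n → Bound N A n → Bound N A (suc n)
bound-step N A n bound {λs} {μs} {v} {w} val₀ val₁ s s' z par with ≤-total (48 * suc n) N
... | inj₁ small = small-state N n (cnt pos λs ⊔ cnt pos μs) v w small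
        (Val-bounded (suc n) s val₀) (Val-bounded (suc n) s' val₁) (N * (ρ λs + ρ μs))
... | inj₂ N≤ = go (cnt pos λs ⊔ cnt pos μs) refl
  where
  p q : ℕ
  p = cnt pos λs
  q = cnt pos μs
  par-pq : parity p ≡ parity q
  par-pq = parity-cancel (cnt is0 λs) (trans (cong parity (sym (length-zeros λs)))
    (trans par (trans (cong parity (length-zeros μs)) (cong (λ t → parity (t + q)) (sym z)))))
  coalesced : p ⊔ q ≤ 1 → v ≡ w
  coalesced l = Val-unique (suc n) s
    (single-part n s s' z (≤-trans (m≤m⊔n p q) l) (≤-trans (m≤n⊔m p q) l)) val₀ val₁
  equal : v ≡ w → ∀ {t} → N * N * ∣ v - w ∣ ≤ t
  equal e = ≤-trans (≤-reflexive (trans (cong (N * N *_) (m≡n⇒∣m-n∣≡0 e)) (*-zeroʳ (N * N)))) z≤n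
  caps : ∀ m → p ⊔ q ≡ 2 + m → (p ≡ 2 + m ⊎ q ≡ 2 + m) × (p ≡ 2 + m ⊎ 2 + p ≤ 2 + m) × (q ≡ 2 + m ⊎ 2 + q ≤ 2 + m)
  caps m e with <-cmp p q
  ... | tri< lt _ _ = let q≡ = trans (sym (m≤n⇒m⊔n≡n (<⇒≤ lt))) e in
          inj₂ q≡ , inj₂ (subst (2 + p ≤_) q≡ (parity-gap par-pq lt)) , inj₁ q≡
  ... | tri≈ _ p≡q _ = let q≡ = trans (sym (m≤n⇒m⊔n≡n (≤-reflexive p≡q))) e in
          inj₂ q≡ , inj₁ (trans p≡q q≡) , inj₁ q≡
  ... | tri> _ _ gt = let p≡ = trans (sym (m≥n⇒m⊔n≡m (<⇒≤ gt))) e in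
          inj₁ p≡ , inj₁ p≡ , inj₂ (subst (2 + q ≤_) p≡ (parity-gap (sym par-pq) gt))
  go : ∀ k → p ⊔ q ≡ k →
    N * N * ∣ v - w ∣ ≤ (potential N (suc n) (p ⊔ q) + N * (ρ λs + ρ μs)) * oddFactorial (suc n)
  go zero e = equal (coalesced (≤-trans (≤-reflexive e) z≤n))
  go (suc zero) e = equal (coalesced (≤-reflexive e))
  go (suc (suc m)) e with caps m e
  ... | max , cp , cq = subst (λ t → N * N * ∣ v - w ∣ ≤ (potential N (suc n) t + N * (ρ λs + ρ μs)) * oddFactorial (suc n))
          (sym e) (presented-close bound N≤ max (present N A n m N≤ s val₀ cp)
            (subst₂ (λ z π → Present N A n z π m q w (ρ μs)) (sym z) (cong not (sym par))
              (present N A n m N≤ s' val₁ cq)))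

coupling-bound : ∀ N A n → Bound N A n
coupling-bound N A zero {λs} {μs} {v} {w} val₀ val₁ s s' z par =
  ≤-trans (≤-reflexive (trans (cong (N * N *_) (m≡n⇒∣m-n∣≡0 same)) (*-zeroʳ (N * N)))) z≤n
  where
  zeros : ∀ λs → sum λs ≡ 0 → All (_≡ 0) λs
  zeros [] e = []
  zeros (x ∷ λs) e = m+n≡0⇒m≡0 x e ∷ zeros λs (m+n≡0⇒n≡0 x e)
  same : v ≡ w
  same = trans val₀ (trans (cong (λ l → indicator (A (length l))) (all-zeros-unique (zeros λs s) (zeros μs s') z)) (sym val₁))
coupling-bound N A (suc n) = bound-step N A n (coupling-bound N A n)

-- Sums, cycle lists and transpositions

total : ∀ {A : Set} → (A → ℕ) → List A → ℕ
total f xs = sum (map f xs)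

count : ∀ {A : Set} → (A → Bool) → List A → ℕ
count p = total (λ x → indicator (p x))

module _ {A : Set} where

  length-filterᵇ : ∀ (p : A → Bool) xs → length (filterᵇ p xs) ≡ count p xs
  length-filterᵇ p [] = refl
  length-filterᵇ p (x ∷ xs) with p x
  ... | true = cong suc (length-filterᵇ p xs)
  ... | false = length-filterᵇ p xs

  total-cong : ∀ {f g : A → ℕ} xs → (∀ x → x ∈ xs → f x ≡ g x) → total f xs ≡ total g xs
  total-cong [] h = refl
  total-cong (x ∷ xs) h = cong₂ _+_ (h x (here refl)) (total-cong xs (λ y y∈ → h y (there y∈)))

  total-mono : ∀ {f g : A → ℕ} xs → (∀ x → x ∈ xs → f x ≤ g x) → total f xs ≤ total g xs
  total-mono [] h = z≤n
  total-mono (x ∷ xs) h = +-mono-≤ (h x (here refl)) (total-mono xs (λ y y∈ → h y (there y∈)))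

  total-+ : ∀ (f g : A → ℕ) xs → total (λ x → f x + g x) xs ≡ total f xs + total g xs
  total-+ f g [] = refl
  total-+ f g (x ∷ xs) = trans (cong (f x + g x +_) (total-+ f g xs))
    (identity (f x) (g x) (total f xs) (total g xs))
    where
    identity : ∀ a b c d → a + b + (c + d) ≡ (a + c) + (b + d)
    identity = solve-∀

  total-* : ∀ c (f : A → ℕ) xs → total (λ x → c * f x) xs ≡ c * total f xs
  total-* c f [] = sym (*-zeroʳ c)
  total-* c f (x ∷ xs) = trans (cong (c * f x +_) (total-* c f xs)) (sym (*-distribˡ-+ c (f x) _))

  total-const : ∀ c (xs : List A) → total (λ _ → c) xs ≡ length xs * c
  total-const c [] = refl
  total-const c (x ∷ xs) = cong (c +_) (total-const c xs)

  total-↭ : ∀ (f : A → ℕ) {xs ys} → xs ↭ ys → total f xs ≡ total f ys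
  total-↭ f p = sum-↭ (Perm.map⁺ f p)

  total-++ : ∀ (f : A → ℕ) xs ys → total f (xs ++ ys) ≡ total f xs + total f ys
  total-++ f xs ys = trans (cong sum (map-++ f xs ys)) (sum-++ (map f xs) (map f ys))

  total-concat : ∀ (f : A → ℕ) xss → total f (concat xss) ≡ total (total f) xss
  total-concat f [] = refl
  total-concat f (xs ∷ xss) = trans (total-++ f xs (concat xss)) (cong (total f xs +_) (total-concat f xss))

  count-cong : ∀ {p q : A → Bool} xs → (∀ x → x ∈ xs → p x ≡ q x) → count p xs ≡ count q xs
  count-cong xs h = total-cong xs (λ x x∈ → cong indicator (h x x∈))

  count-filterᵇ : ∀ (p q : A → Bool) xs → count p (filterᵇ q xs) ≡ count (λ x → q x ∧ p x) xs
  count-filterᵇ p q [] = refl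
  count-filterᵇ p q (x ∷ xs) with q x
  ... | true = cong (_ +_) (count-filterᵇ p q xs)
  ... | false = count-filterᵇ p q xs

  count-none : ∀ {p : A → Bool} xs → (∀ x → x ∈ xs → p x ≡ false) → count p xs ≡ 0
  count-none xs h = trans (count-cong xs h) (trans (total-const 0 xs) (*-zeroʳ (length xs)))

total-swap : ∀ {A B : Set} (f : A → B → ℕ) xs ys →
  total (λ x → total (f x) ys) xs ≡ total (λ y → total (λ x → f x y) xs) ys
total-swap f [] ys = sym (trans (total-const 0 ys) (*-zeroʳ (length ys)))
total-swap f (x ∷ xs) ys = trans (cong (total (f x) ys +_) (total-swap f xs ys))
  (sym (total-+ (f x) (λ y → total (λ x → f x y) xs) ys))

module _ {B : Set} (_≟_ : (x y : B) → Dec (x ≡ y)) where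

  count-one : ∀ y ys → Unique ys → y ∈ ys → count (λ z → does (y ≟ z)) ys ≡ 1
  count-one y (.y ∷ ys) (u ∷ us) (here refl) = cong₂ _+_ (cong indicator (dec-true (y ≟ y) refl))
    (count-none ys (λ z z∈ → dec-false (y ≟ z) (All.lookup u z∈)))
  count-one y (z ∷ ys) (u ∷ us) (there y∈) = cong₂ _+_
    (cong indicator (dec-false (y ≟ z) (λ e → All.lookup u y∈ (sym e)))) (count-one y ys us y∈)

  count-fibres : ∀ {A : Set} (p : A → Bool) (f : A → B) xs ys → Unique ys →
    (∀ x → x ∈ xs → p x ≡ true → f x ∈ ys) →
    count p xs ≡ total (λ y → count (λ x → p x ∧ does (f x ≟ y)) xs) ys
  count-fibres {A} p f xs ys u h = trans (total-cong xs pointwise)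
    (total-swap (λ x y → indicator (p x ∧ does (f x ≟ y))) xs ys)
    where
    pointwise : ∀ x → x ∈ xs → indicator (p x) ≡ count (λ y → p x ∧ does (f x ≟ y)) ys
    pointwise x x∈ with p x in eq
    ... | true = sym (count-one (f x) ys u (h x x∈ eq))
    ... | false = sym (count-none {p = λ _ → false} ys (λ _ _ → refl))

Unique-↭ : ∀ {A : Set} {xs ys : List A} → xs ↭ ys → Unique xs → Unique ys
Unique-↭ {A} p = PermS.Unique-resp-↭ (setoid A) (↭⇒↭ₛ p)

concat-↭ : ∀ {A : Set} {xss yss : List (List A)} → xss ↭ yss → concat xss ↭ concat yss
concat-↭ ↭.refl = ↭-refl
concat-↭ (↭.prep xs p) = Perm.++⁺ˡ xs (concat-↭ p)
concat-↭ (↭.swap xs ys p) = ↭-trans (shifts xs ys) (Perm.++⁺ˡ ys (Perm.++⁺ˡ xs (concat-↭ p)))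
concat-↭ (↭.trans p q) = ↭-trans (concat-↭ p) (concat-↭ q)

and-true : ∀ {bs} → All T bs → T (and bs)
and-true [] = tt
and-true {true ∷ bs} (_ ∷ ts) = and-true ts

true-and : ∀ {bs} → T (and bs) → All T bs
true-and {[]} _ = []
true-and {true ∷ bs} t = tt ∷ true-and t

module _ {N : ℕ} where

  -- The list holds the points strictly between the two ends, so that cutting a path at an inner
  -- point and joining two paths are inverse to each other, and a cycle is a path back to its first
  -- point.
  Path : (Fin N → Fin N) → Fin N → List (Fin N) → Fin N → Set
  Path σ x [] y = σ x ≡ y
  Path σ x (z ∷ zs) y = σ x ≡ z × Path σ z zs y

  Cycle : (Fin N → Fin N) → List (Fin N) → Set
  Cycle σ [] = ⊥
  Cycle σ (x ∷ xs) = Path σ x xs x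

  -- The single rearrangement `cover` says at once that the cycles are disjoint, repeat no point and
  -- exhaust `Fin N`. Neither their order nor their starting points are normalised, so any point can
  -- be rotated to the front.
  record CycleList (σ : Fin N → Fin N) (cs : List (List (Fin N))) : Set where
    constructor cycleList
    field
      cycles : All (Cycle σ) cs
      cover : concat cs ↭ allFin N

  open CycleList

  path-split : ∀ {σ x y z} ys {zs} → Path σ x (ys ++ z ∷ zs) y → Path σ x ys z × Path σ z zs y
  path-split [] (e , p) = e , p
  path-split (w ∷ ys) (e , p) = (e , proj₁ (path-split ys p)) , proj₂ (path-split ys p)

  path-join : ∀ {σ x y z} ys {zs} → Path σ x ys z → Path σ z zs y → Path σ x (ys ++ z ∷ zs) y
  path-join [] e q = e , q
  path-join (w ∷ ys) (e , p) q = e , path-join ys p q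

  path-change : ∀ {σ τ : Fin N → Fin N} {x x' y} zs → τ x' ≡ σ x → All (λ z → τ z ≡ σ z) zs →
    Path σ x zs y → Path τ x' zs y
  path-change [] e [] p = trans e p
  path-change (z ∷ zs) e (h ∷ hs) (q , p) = trans e q , path-change zs h hs p

  cycle-change : ∀ {σ τ : Fin N → Fin N} c → All (λ z → τ z ≡ σ z) c → Cycle σ c → Cycle τ c
  cycle-change (x ∷ xs) (h ∷ hs) p = path-change xs h hs p

  cycle-rotate : ∀ {σ} ys {z zs} → Cycle σ (ys ++ z ∷ zs) → Cycle σ (z ∷ zs ++ ys)
  cycle-rotate [] {zs = zs} p = subst (λ t → Path _ _ t _) (sym (++-identityʳ zs)) p
  cycle-rotate (y ∷ ys) {zs = zs} p with path-split ys p
  ... | a , b = path-join zs b a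

  cycleList-cong : ∀ {σ τ cs} → (∀ x → τ x ≡ σ x) → CycleList σ cs → CycleList τ cs
  cycleList-cong h (cycleList cyc cov) =
    cycleList (All.map (λ {c} → cycle-change c (All.universal h c)) cyc) cov

  cycleList-↭ : ∀ {σ cs cs'} → cs ↭ cs' → CycleList σ cs → CycleList σ cs'
  cycleList-↭ p (cycleList cyc cov) =
    cycleList (All-resp-↭ p cyc) (↭-trans (concat-↭ (↭-sym p)) cov)

  cycleList-rotate : ∀ {σ} ys {z zs rest} → CycleList σ ((ys ++ z ∷ zs) ∷ rest) →
    CycleList σ ((z ∷ zs ++ ys) ∷ rest)
  cycleList-rotate ys {z} {zs} {rest} (cycleList (c ∷ cyc) cov) = cycleList (cycle-rotate ys c ∷ cyc)
    (↭-trans (Perm.++⁺ʳ (concat rest) (Perm.++-comm (z ∷ zs) ys)) cov)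

  cover-unique : ∀ {cs} → concat cs ↭ allFin N → Unique (concat cs)
  cover-unique cov = Unique-↭ (↭-sym cov) (Uniq.allFin⁺ N)

  transpose : Fin N → Fin N → Fin N → Fin N
  transpose i j x = if does (x FinP.≟ i) then j else (if does (x FinP.≟ j) then i else x)

  transpose-i : ∀ i j → transpose i j i ≡ j
  transpose-i i j rewrite dec-true (i FinP.≟ i) refl = refl

  transpose-j : ∀ i j → transpose i j j ≡ i
  transpose-j i j with j FinP.≟ i
  ... | yes e = e
  ... | no _ rewrite dec-true (j FinP.≟ j) refl = refl

  transpose-other : ∀ i j x → x ≢ i → x ≢ j → transpose i j x ≡ x
  transpose-other i j x a b rewrite dec-false (x FinP.≟ i) a | dec-false (x FinP.≟ j) b = refl

  transpose-involutive : ∀ i j x → transpose i j (transpose i j x) ≡ x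
  transpose-involutive i j x with x FinP.≟ i
  ... | yes refl = transpose-j i j
  ... | no x≢i with x FinP.≟ j
  ...   | yes refl = transpose-i i j
  ...   | no x≢j = transpose-other i j x x≢i x≢j

  avoid : ∀ {i j : Fin N} {L} → Unique (i ∷ j ∷ L) → All (λ z → z ≢ i × z ≢ j) L
  avoid ((_ ∷ is) ∷ js ∷ _) = All.zipWith (λ (a , b) → (λ e → a (sym e)) , (λ e → b (sym e))) (is , js)

  fixed-off : ∀ (σ : Fin N → Fin N) {i j} xs → All (λ z → z ≢ i × z ≢ j) xs →
    All (λ z → σ (transpose i j z) ≡ σ z) xs
  fixed-off σ {i} {j} xs = All.map (λ {z} (a , b) → cong σ (transpose-other i j z a b))

  concat-avoid : ∀ {P : Fin N → Set} cs → All P (concat cs) → All (All P) cs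
  concat-avoid cs = AllP.concat⁻

  split-cover : ∀ (i j : Fin N) ys zs L → (i ∷ ys ++ j ∷ zs) ++ L ↭ i ∷ j ∷ ys ++ zs ++ L
  split-cover i j ys zs L = ↭-prep i (↭-trans (↭-reflexive (++-assoc ys (j ∷ zs) L)) (shift j ys (zs ++ L)))

  avoid-split : ∀ {i j : Fin N} {ys zs cs} → concat ((i ∷ ys ++ j ∷ zs) ∷ cs) ↭ allFin N →
    let P = λ z → z ≢ i × z ≢ j in All P ys × All P zs × All P (concat cs)
  avoid-split {i} {j} {ys} {zs} {cs} cov =
    AllP.++⁻ˡ ys off , AllP.++⁻ˡ zs (AllP.++⁻ʳ ys off) , AllP.++⁻ʳ zs (AllP.++⁻ʳ ys off)
    where
    off = avoid (Unique-↭ (split-cover i j ys zs (concat cs)) (cover-unique {(i ∷ ys ++ j ∷ zs) ∷ cs} cov))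

  merge-cover : ∀ (i j : Fin N) xs ys L → (i ∷ xs) ++ (j ∷ ys) ++ L ↭ (i ∷ ys ++ j ∷ xs) ++ L
  merge-cover i j xs ys L = ↭-prep i (↭-trans (shifts xs (j ∷ ys))
    (↭-trans (↭-sym (shift j ys (xs ++ L))) (↭-reflexive (sym (++-assoc ys (j ∷ xs) L)))))

  -- After composition with the transposition, i continues where j did and j where i did, and
  -- nothing else changes. So the arc after i closes up behind j, and the arc after j behind i. The
  -- same exchange glues two cycles in `cycle-merge`.
  cycle-split : ∀ {σ i j ys zs rest} → CycleList σ ((i ∷ ys ++ j ∷ zs) ∷ rest) →
    CycleList (λ x → σ (transpose i j x)) ((j ∷ ys) ∷ (i ∷ zs) ∷ rest)
  cycle-split {σ} {i} {j} {ys} {zs} {rest} (cycleList (c ∷ cyc) cov)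
    with avoid-split {ys = ys} {zs} {rest} cov | path-split ys c
  ... | a , b , d | p , q = cycleList
    (path-change ys (cong σ (transpose-j i j)) (fixed-off σ ys a) p ∷
     path-change zs (cong σ (transpose-i i j)) (fixed-off σ zs b) q ∷
     All.zipWith (λ {c} (h , e) → cycle-change c h e)
       (All.map (λ {c} → fixed-off σ c) (concat-avoid rest d) , cyc))
    (↭-trans (perm (concat rest)) cov)
    where
    perm : ∀ L → (j ∷ ys) ++ (i ∷ zs) ++ L ↭ (i ∷ ys ++ j ∷ zs) ++ L
    perm L = ↭-trans (shifts (j ∷ ys) (i ∷ zs)) (merge-cover i j zs ys L)

  cycle-merge : ∀ {σ i j xs ys rest} → CycleList σ ((i ∷ xs) ∷ (j ∷ ys) ∷ rest) →
    CycleList (λ x → σ (transpose i j x)) ((i ∷ ys ++ j ∷ xs) ∷ rest)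
  cycle-merge {σ} {i} {j} {xs} {ys} {rest} (cycleList (p ∷ q ∷ cyc) cov)
    with ↭-trans (↭-sym (merge-cover i j xs ys (concat rest))) cov
  ... | cov' with avoid-split {ys = ys} {xs} {rest} cov'
  ...   | a , b , d = cycleList
    (path-join ys (path-change ys (cong σ (transpose-i i j)) (fixed-off σ ys a) q)
                  (path-change xs (cong σ (transpose-j i j)) (fixed-off σ xs b) p) ∷
     All.zipWith (λ {c} (h , e) → cycle-change c h e)
       (All.map (λ {c} → fixed-off σ c) (concat-avoid rest d) , cyc))
    cov'

open CycleList

length-total : ∀ {A : Set} (xs : List A) → length xs ≡ total (λ _ → 1) xs
length-total xs = sym (trans (total-const 1 xs) (*-identityʳ (length xs)))

total-cong-All : ∀ {A : Set} {P : A → Set} {f g : A → ℕ} xs → All P xs → (∀ x → P x → f x ≡ g x) →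
  total f xs ≡ total g xs
total-cong-All xs ps h = total-cong xs (λ x x∈ → h x (All.lookup ps x∈))

Unique-++ˡ : ∀ {A : Set} (xs : List A) {ys} → Unique (xs ++ ys) → Unique xs
Unique-++ˡ [] u = []
Unique-++ˡ (x ∷ xs) (h ∷ u) = AllP.++⁻ˡ xs h ∷ Unique-++ˡ xs u

Unique-++ʳ : ∀ {A : Set} (xs : List A) {ys} → Unique (xs ++ ys) → Unique ys
Unique-++ʳ [] u = u
Unique-++ʳ (x ∷ xs) (h ∷ u) = Unique-++ʳ xs u

Unique-concat : ∀ {A : Set} (xss : List (List A)) → Unique (concat xss) → All Unique xss
Unique-concat [] u = []
Unique-concat (xs ∷ xss) u = Unique-++ˡ xs u ∷ Unique-concat xss (Unique-++ʳ xs u)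

length-member : ∀ {A : Set} (xss : List (List A)) → All (λ xs → length xs ≤ length (concat xss)) xss
length-member [] = []
length-member (xs ∷ xss) = ≤-trans (m≤m+n _ _) (≤-reflexive (sym (length-++ xs))) ∷
  All.map (λ h → ≤-trans h (≤-trans (m≤n+m _ (length xs)) (≤-reflexive (sym (length-++ xs))))) (length-member xss)

smallest : ∀ {N} x (xs : List (Fin N)) → ∃[ m ] ∃[ ys ] ∃[ zs ]
  (x ∷ xs ≡ ys ++ m ∷ zs × All (λ y → toℕ m ≤ toℕ y) (x ∷ xs))
smallest x [] = x , [] , [] , refl , ≤-refl ∷ []
smallest x (y ∷ xs) with smallest y xs
... | m , ys , zs , eq , min with ≤-total (toℕ x) (toℕ m)
...   | inj₁ x≤m = x , [] , y ∷ xs , refl , ≤-refl ∷ All.map (≤-trans x≤m) min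
...   | inj₂ m≤x = m , x ∷ ys , zs , cong (x ∷_) eq , m≤x ∷ min

-- Agreement of cycle lists with the computed cycle counts

module _ {N : ℕ} where

  iter-shift : ∀ (σ : Tab N) k x → iter σ (suc k) x ≡ iter σ k (lookup σ x)
  iter-shift σ zero x = refl
  iter-shift σ (suc k) x = cong (lookup σ) (iter-shift σ k x)

  path-iter : ∀ (σ : Tab N) {x y} zs → Path (lookup σ) x zs y → iter σ (suc (length zs)) x ≡ y
  path-iter σ [] e = e
  path-iter σ {x} (z ∷ zs) (refl , p) = trans (iter-shift σ (suc (length zs)) x) (path-iter σ zs p)

  path-next : ∀ {σ : Fin N → Fin N} {x y z} zs → Path σ x zs y → z ∈ x ∷ zs → σ z ∈ y ∷ zs
  path-next [] e (here refl) = here e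
  path-next (w ∷ zs) (e , p) (here refl) = there (here e)
  path-next (w ∷ zs) (e , p) (there z∈) with path-next zs p z∈
  ... | here q = here q
  ... | there q = there (there q)

  cycle-closed : ∀ {σ : Fin N → Fin N} c {z} → Cycle σ c → z ∈ c → σ z ∈ c
  cycle-closed (x ∷ xs) p z∈ = path-next xs p z∈

  cycle-iter : ∀ (σ : Tab N) c {z} k → Cycle (lookup σ) c → z ∈ c → iter σ k z ∈ c
  cycle-iter σ c zero p z∈ = z∈
  cycle-iter σ c (suc k) p z∈ = cycle-closed c p (cycle-iter σ c k p z∈)

  not-<ᵇ : ∀ a b → b ≤ a → not (a <ᵇ b) ≡ true
  not-<ᵇ a b b≤a with a <ᵇ b in eq
  ... | false = refl
  ... | true = ⊥-elim (<⇒≱ (<ᵇ⇒< a b (subst T (sym eq) tt)) b≤a)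

  cycleMin-true : ∀ (σ : Tab N) c m → Cycle (lookup σ) c → m ∈ c → All (λ y → toℕ m ≤ toℕ y) c →
    isCycleMin σ m ≡ true
  cycleMin-true σ c m p m∈ min = Equivalence.to T-≡ (and-true (AllP.map⁺ (All.universal
    (λ k → Equivalence.from T-≡ (not-<ᵇ (toℕ (iter σ k m)) (toℕ m) (All.lookup min (cycle-iter σ c k p m∈))))
    (upTo (suc N)))))

  cycleMin-false : ∀ (σ : Tab N) y k → k ≤ N → toℕ (iter σ k y) < toℕ y → isCycleMin σ y ≡ false
  cycleMin-false σ y k k≤N lt with isCycleMin σ y in eq
  ... | false = refl
  ... | true = ⊥-elim (refute (All.lookup minimal (∈-upTo⁺ (s≤s k≤N))))
    where
    minimal : All (λ k → T (not (toℕ (iter σ k y) <ᵇ toℕ y))) (upTo (suc N))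
    minimal = AllP.map⁻ (true-and (subst T (sym eq) tt))
    refute : T (not (toℕ (iter σ k y) <ᵇ toℕ y)) → ⊥
    refute t with toℕ (iter σ k y) <ᵇ toℕ y | <⇒<ᵇ lt
    ... | true | _ = t

  -- From any other point of the cycle the remaining arc leads to the minimum in at most N steps,
  -- which is within the range that `isCycleMin` searches. So exactly one point per cycle passes the
  -- test.
  count-cycleMin : ∀ (σ : Tab N) c → Cycle (lookup σ) c → Unique c → length c ≤ N →
    count (isCycleMin σ) c ≡ 1
  count-cycleMin σ (x ∷ xs) p u len with smallest x xs
  ... | m , ys , zs , eq , min = trans (total-↭ _ rot) (cong₂ _+_
          (cong indicator (cycleMin-true σ (m ∷ tl) m p' (here refl) min')) (count-none tl larger))
    where
    tl : List (Fin N)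
    tl = zs ++ ys
    rot : x ∷ xs ↭ m ∷ tl
    rot = ↭-trans (↭-reflexive eq) (Perm.++-comm ys (m ∷ zs))
    p' : Cycle (lookup σ) (m ∷ tl)
    p' = cycle-rotate ys (subst (Cycle (lookup σ)) eq p)
    min' : All (λ y → toℕ m ≤ toℕ y) (m ∷ tl)
    min' = All-resp-↭ rot min
    u' : Unique (m ∷ tl)
    u' = Unique-↭ rot u
    larger : ∀ y → y ∈ tl → isCycleMin σ y ≡ false
    larger y y∈ with ∈-∃++ y∈ | u'
    ... | as , bs , eq' | m∉ ∷ _ = cycleMin-false σ y (suc (length bs)) bound
            (subst (λ t → toℕ t < toℕ y) (sym back)
              (≤∧≢⇒< (All.lookup min' (there y∈)) (λ e → All.lookup m∉ y∈ (FinP.toℕ-injective e))))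
      where
      back : iter σ (suc (length bs)) y ≡ m
      back = path-iter σ bs (proj₂ (path-split as (subst (λ t → Path (lookup σ) m t m) eq' p')))
      bound : suc (length bs) ≤ N
      bound = ≤-trans (≤-trans (m≤n+m (suc (length bs)) (length as))
        (≤-trans (≤-reflexive (trans (sym (length-++ as)) (cong length (sym eq')))) (n≤1+n (length tl))))
        (≤-trans (≤-reflexive (sym (↭-length rot))) len)

  firstReturn-path : ∀ (σ : Tab N) i fuel k zs → Path (lookup σ) (iter σ k i) zs i → i ∉ zs →
    suc (length zs) ≤ fuel → firstReturn σ i fuel (suc k) ≡ suc k + length zs
  firstReturn-path σ i (suc fuel) k [] e i∉ l
    rewrite e | Equivalence.to T-≡ (≡⇒≡ᵇ (toℕ i) (toℕ i) refl) = cong suc (sym (+-identityʳ k))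
  firstReturn-path σ i (suc fuel) k (z ∷ zs) (e , p) i∉ (s≤s l)
    with toℕ (lookup σ (iter σ k i)) ≡ᵇ toℕ i in eq
  ... | true = ⊥-elim (i∉ (here (trans (sym (FinP.toℕ-injective
          (≡ᵇ⇒≡ (toℕ (lookup σ (iter σ k i))) (toℕ i) (Equivalence.from T-≡ eq)))) e)))
  ... | false = trans (firstReturn-path σ i fuel (suc k) zs (subst (λ t → Path (lookup σ) t zs i) (sym e) p)
          (λ i∈ → i∉ (there i∈)) l) (cong suc (sym (+-suc k (length zs))))

  orbitLen-cycle : ∀ (σ : Tab N) c i → Cycle (lookup σ) c → Unique c → length c ≤ N → i ∈ c →
    orbitLen σ i ≡ length c
  orbitLen-cycle σ c i p u len i∈ with ∈-∃++ i∈
  ... | ys , zs , refl = trans (firstReturn-path σ i N 0 (zs ++ ys) (cycle-rotate ys p)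
          (Uniq.Unique[x∷xs]⇒x∉xs (Unique-↭ rot u)) (≤-trans (≤-reflexive (sym (↭-length rot))) len))
          (sym (↭-length rot))
    where
    rot : ys ++ i ∷ zs ↭ i ∷ zs ++ ys
    rot = Perm.++-comm ys (i ∷ zs)

  cover-length : ∀ {cs} → concat cs ↭ allFin N → length (concat cs) ≡ N
  cover-length cov = trans (↭-length cov) (ListP.length-tabulate (λ x → x))

  ProperCycle : Tab N → List (Fin N) → Set
  ProperCycle σ c = Cycle (lookup σ) c × Unique c × length c ≤ N

  proper-cycles : ∀ (σ : Tab N) {cs} → CycleList (lookup σ) cs → All (ProperCycle σ) cs
  proper-cycles σ {cs} (cycleList cyc cov) = All.zipWith (λ (a , b , c) → a , b , c)
    (cyc , All.zipWith (λ (a , b) → a , b) (Unique-concat cs (cover-unique {cs = cs} cov) ,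
      All.map (λ h → ≤-trans h (≤-reflexive (cover-length {cs} cov))) (length-member cs)))

  numCycles-length : ∀ (σ : Tab N) {cs} → CycleList (lookup σ) cs → numCycles σ ≡ length cs
  numCycles-length σ {cs} cl = trans (length-filterᵇ (isCycleMin σ) (allFin N))
    (trans (total-↭ _ (↭-sym (cover cl))) (trans (total-concat _ cs)
      (trans (total-cong-All cs (proper-cycles σ cl) (λ c (p , u , l) → count-cycleMin σ c p u l))
        (sym (length-total cs)))))

  cyclesOfLen-count : ∀ (σ : Tab N) {cs} → CycleList (lookup σ) cs → ∀ j →
    cyclesOfLen σ j ≡ count (λ c → length c ≡ᵇ j) cs
  cyclesOfLen-count σ {cs} cl j = trans (length-filterᵇ _ (allFin N))
    (trans (total-↭ _ (↭-sym (cover cl))) (trans (total-concat _ cs)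
      (total-cong-All cs (proper-cycles σ cl) one-cycle)))
    where
    one-cycle : ∀ c → ProperCycle σ c → count (λ i → isCycleMin σ i ∧ (orbitLen σ i ≡ᵇ j)) c ≡ indicator (length c ≡ᵇ j)
    one-cycle c (p , u , l) = trans (count-cong c (λ i i∈ → cong (λ t → isCycleMin σ i ∧ (t ≡ᵇ j)) (orbitLen-cycle σ c i p u l i∈)))
      (select (length c ≡ᵇ j))
      where
      select : ∀ b → count (λ i → isCycleMin σ i ∧ b) c ≡ indicator b
      select true = trans (count-cong c (λ i _ → BoolP.∧-identityʳ (isCycleMin σ i))) (count-cycleMin σ c p u l)
      select false = count-none c (λ i _ → BoolP.∧-zeroʳ (isCycleMin σ i))

-- The sign of a permutation

parity-+ : ∀ m n → parity (m + n) ≡ parity m xor parity n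
parity-+ zero n = refl
parity-+ (suc m) n = trans (cong not (parity-+ m n)) (BoolP.not-distribˡ-xor (parity m) (parity n))

parity-total : ∀ {A : Set} {f g : A → ℕ} xs → All (λ x → parity (f x) ≡ parity (g x)) xs →
  parity (total f xs) ≡ parity (total g xs)
parity-total [] [] = refl
parity-total {f = f} {g} (x ∷ xs) (e ∷ es) = trans (parity-+ (f x) _)
  (trans (cong₂ _xor_ e (parity-total xs es)) (sym (parity-+ (g x) _)))

%2-parity : ∀ n → (n % 2 ≡ᵇ 0) ≡ not (parity n)
%2-parity zero = refl
%2-parity (suc zero) = refl
%2-parity (suc (suc n)) = trans (%2-parity n) (cong not (sym (not-involutive (parity n))))

total-map : ∀ {A B : Set} (f : B → ℕ) (g : A → B) xs → total f (map g xs) ≡ total (λ x → f (g x)) xs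
total-map f g [] = refl
total-map f g (x ∷ xs) = cong (f (g x) +_) (total-map f g xs)

total-concatMap : ∀ {A B : Set} (f : B → ℕ) (g : A → List B) xs →
  total f (concatMap g xs) ≡ total (λ x → total f (g x)) xs
total-concatMap f g xs = trans (total-concat f (map g xs)) (total-map (total f) g xs)

module _ {N : ℕ} where

  Injective : (Fin N → Fin N) → Set
  Injective f = ∀ {x y} → f x ≡ f y → x ≡ y

  surjective : ∀ {f} → Injective f → ∀ y → ∃[ x ] f x ≡ y
  surjective {f} inj y with FinP.any? (λ x → f x FinP.≟ y)
  ... | yes found = found
  ... | no none with FinP.pigeonhole (n<1+n N) (λ { Fin.zero → y ; (Fin.suc x) → f x })
  ...   | Fin.zero , Fin.suc j , _ , e = contradiction (j , sym e) none
  ...   | Fin.suc i , Fin.suc j , lt , e = ⊥-elim (FinP.<-irrefl (cong Fin.suc (inj e)) lt)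

  involution-injective : ∀ {f} → (∀ x → f (f x) ≡ x) → Injective f
  involution-injective {f} inv {x} {y} e = trans (sym (inv x)) (trans (cong f e) (inv y))

  transpose-injective : ∀ i j → Injective (transpose i j)
  transpose-injective i j = involution-injective (transpose-involutive i j)

  -- Selection sort: if f t = s, then f composed with the transposition of s and t fixes s and all
  -- points that f fixes, so the list of points that may be moved shrinks. The transpositions act on
  -- the right, as a gluing does on α.
  swap-induction : (P : (Fin N → Fin N) → Set) → (∀ {f g} → (∀ x → f x ≡ g x) → P f → P g) →
    P (λ x → x) → (∀ f i j → i ≢ j → Injective f → P f → P (λ x → f (transpose i j x))) →
    ∀ f → Injective f → P f
  swap-induction P ext base step f inj = go (allFin N) f inj (λ x x∉ → ⊥-elim (x∉ (∈-allFin x)))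
    where
    go : ∀ L f → Injective f → (∀ x → x ∉ L → f x ≡ x) → P f
    go [] f inj fixed = ext (λ x → sym (fixed x (λ ()))) base
    go (s ∷ L) f inj fixed with f s FinP.≟ s
    ... | yes fs≡s = go L f inj fixed'
      where
      fixed' : ∀ x → x ∉ L → f x ≡ x
      fixed' x x∉ with x FinP.≟ s
      ... | yes refl = fs≡s
      ... | no x≢s = fixed x (λ { (here e) → x≢s e ; (there x∈) → x∉ x∈ })
    ... | no fs≢s with surjective inj s
    ...   | t , ft≡s = ext (λ x → cong f (transpose-involutive s t x))
            (step f' s t s≢t inj' (go L f' inj' fixed'))
      where
      f' : Fin N → Fin N
      f' x = f (transpose s t x)
      inj' : Injective f'
      inj' e = transpose-injective s t (inj e)
      s≢t : s ≢ t
      s≢t refl = fs≢s ft≡s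
      fixed' : ∀ x → x ∉ L → f' x ≡ x
      fixed' x x∉ with x FinP.≟ s
      ... | yes refl = ft≡s
      ... | no x≢s with x FinP.≟ t
      ...   | yes refl = ⊥-elim (x≢s (trans (sym (fixed x (λ { (here e) → x≢s e ; (there x∈) → x∉ x∈ }))) ft≡s))
      ...   | no x≢t = fixed x (λ { (here e) → x≢s e ; (there x∈) → x∉ x∈ })

  inverted : (Fin N → Fin N) → Fin N → Fin N → ℕ
  inverted f a b = indicator ((toℕ a <ᵇ toℕ b) ∧ (toℕ (f b) <ᵇ toℕ (f a)))

  invCount : (Fin N → Fin N) → List (Fin N) → ℕ
  invCount f L = total (λ a → total (inverted f a) L) L

  invCount-↭ : ∀ f {L M} → L ↭ M → invCount f L ≡ invCount f M
  invCount-↭ f {L} {M} p = trans (total-↭ (λ a → total (inverted f a) L) p)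
    (total-cong M (λ a _ → total-↭ (inverted f a) p))

  invCount-cong : ∀ {f g} L → (∀ x → f x ≡ g x) → invCount f L ≡ invCount g L
  invCount-cong L h = total-cong L (λ a _ → total-cong L (λ b _ →
    cong₂ (λ x y → indicator ((toℕ a <ᵇ toℕ b) ∧ (toℕ x <ᵇ toℕ y))) (h b) (h a)))

  inversions-invCount : ∀ σ → inversions σ ≡ invCount (lookup σ) (allFin N)
  inversions-invCount σ = trans (length-filterᵇ _ (concatMap (λ i → map (λ j → i , j) (allFin N)) (allFin N)))
    (trans (total-concatMap _ (λ i → map (λ j → i , j) (allFin N)) (allFin N))
      (total-cong (allFin N) (λ i _ → total-map _ (λ j → i , j) (allFin N))))

  evenF : (Fin N → Fin N) → Bool
  evenF f = not (parity (invCount f (allFin N)))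

  evenF-cong : ∀ {f g} → (∀ x → f x ≡ g x) → evenF f ≡ evenF g
  evenF-cong h = cong (λ t → not (parity t)) (invCount-cong (allFin N) h)

  isEven-evenF : ∀ σ → isEven σ ≡ evenF (lookup σ)
  isEven-evenF σ = trans (%2-parity (inversions σ)) (cong (λ t → not (parity t)) (inversions-invCount σ))

  <ᵇ-flip : ∀ {a b : Fin N} → a ≢ b → (toℕ b <ᵇ toℕ a) ≡ not (toℕ a <ᵇ toℕ b)
  <ᵇ-flip {a} {b} a≢b with toℕ a <ᵇ toℕ b in p | toℕ b <ᵇ toℕ a in q
  ... | true | false = refl
  ... | false | true = refl
  ... | true | true = ⊥-elim (<-asym (<ᵇ⇒< (toℕ a) (toℕ b) (subst T (sym p) tt)) (<ᵇ⇒< (toℕ b) (toℕ a) (subst T (sym q) tt)))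
  ... | false | false with <-cmp (toℕ a) (toℕ b)
  ...   | tri< lt _ _ = ⊥-elim (subst T p (<⇒<ᵇ lt))
  ...   | tri≈ _ e _ = ⊥-elim (a≢b (FinP.toℕ-injective e))
  ...   | tri> _ _ gt = ⊥-elim (subst T q (<⇒<ᵇ gt))

  <ᵇ-irrefl : ∀ (a : Fin N) → (toℕ a <ᵇ toℕ a) ≡ false
  <ᵇ-irrefl a with toℕ a <ᵇ toℕ a in p
  ... | false = refl
  ... | true = ⊥-elim (<-irrefl refl (<ᵇ⇒< (toℕ a) (toℕ a) (subst T (sym p) tt)))

  inverted-diag : ∀ f a → inverted f a a ≡ 0
  inverted-diag f a rewrite <ᵇ-irrefl a = refl

  cross : (Fin N → Fin N) → Fin N → Fin N → Fin N → ℕ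
  cross f i j b = (inverted f i b + inverted f j b) + (inverted f b i + inverted f b j)

  expand-invCount : ∀ f i j R → invCount f (i ∷ j ∷ R)
    ≡ (inverted f i j + inverted f j i) + (total (cross f i j) R + invCount f R)
  expand-invCount f i j R rewrite inverted-diag f i | inverted-diag f j
    | total-+ (λ b → inverted f i b + inverted f j b) (λ b → inverted f b i + inverted f b j) R
    | total-+ (inverted f i) (inverted f j) R
    | total-+ (λ b → inverted f b i) (λ b → inverted f b j) R =
    trans (cong (λ t → inverted f i j + total (inverted f i) R + (inverted f j i + total (inverted f j) R + t))
      (trans (total-cong R (λ a _ → sym (+-assoc (inverted f a i) (inverted f a j) (total (inverted f a) R))))
        (trans (total-+ (λ a → inverted f a i + inverted f a j) (λ a → total (inverted f a) R) R)
          (cong (_+ invCount f R) (total-+ (λ b → inverted f b i) (λ b → inverted f b j) R)))))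
    (identity (inverted f i j) (total (inverted f i) R) (inverted f j i) (total (inverted f j) R)
      (total (λ b → inverted f b i) R) (total (λ b → inverted f b j) R) (invCount f R))
    where
    identity : ∀ ij I ji J I' J' c → ij + I + (ji + J + (I' + J' + c)) ≡ ij + ji + (I + J + (I' + J') + c)
    identity = solve-∀

  -- In the application u and w tell whether i and j precede b, and p and q whether the values at i
  -- and j exceed the value at b. Exchanging these two values exchanges p and q.
  cross-parity : ∀ u w p q →
    parity ((indicator (u ∧ p) + indicator (w ∧ q)) + (indicator (not u ∧ not p) + indicator (not w ∧ not q)))
    ≡ parity ((indicator (u ∧ q) + indicator (w ∧ p)) + (indicator (not u ∧ not q) + indicator (not w ∧ not p)))
  cross-parity true true true true = refl
  cross-parity true true true false = refl
  cross-parity true true false true = refl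
  cross-parity true true false false = refl
  cross-parity true false true true = refl
  cross-parity true false true false = refl
  cross-parity true false false true = refl
  cross-parity true false false false = refl
  cross-parity false true true true = refl
  cross-parity false true true false = refl
  cross-parity false true false true = refl
  cross-parity false true false false = refl
  cross-parity false false true true = refl
  cross-parity false false true false = refl
  cross-parity false false false true = refl
  cross-parity false false false false = refl

  pair-parity : ∀ u p → parity (indicator (u ∧ not p) + indicator (not u ∧ p))
    ≡ not (parity (indicator (u ∧ p) + indicator (not u ∧ not p)))
  pair-parity true true = refl
  pair-parity true false = refl
  pair-parity false true = refl
  pair-parity false false = refl

  -- Swapping the values at i and j changes the order of the pair {i, j} and,
  -- for every other b, preserves the parity of the inversions of b with i and j.
  evenF-transpose : ∀ f i j → i ≢ j → Injective f → evenF (λ x → f (transpose i j x)) ≡ not (evenF f)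
  evenF-transpose f i j i≢j inj with ∈-∃++ (∈-allFin i)
  ... | as , bs , eq with ∈-∃++ (j∈ (∈-resp-↭ (↭-trans (↭-reflexive eq) (shift i as bs)) (∈-allFin j)))
    where
    j∈ : j ∈ i ∷ as ++ bs → j ∈ as ++ bs
    j∈ (here e) = ⊥-elim (i≢j (sym e))
    j∈ (there h) = h
  ...   | cs , ds , eq' = cong not (trans (cong parity (trans (invCount-↭ g perm) (expand-invCount g i j R)))
            (trans (parity-+ (inverted g i j + inverted g j i) _) (trans (cong₂ _xor_ pair rest)
              (trans (sym (BoolP.not-distribˡ-xor (parity (inverted f i j + inverted f j i)) _))
                (cong not (trans (sym (parity-+ (inverted f i j + inverted f j i) _))
                  (cong parity (sym (trans (invCount-↭ f perm) (expand-invCount f i j R))))))))))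
    where
    g : Fin N → Fin N
    g x = f (transpose i j x)
    R : List (Fin N)
    R = cs ++ ds
    perm : allFin N ↭ i ∷ j ∷ R
    perm = ↭-trans (↭-reflexive eq) (↭-trans (shift i as bs) (↭-prep i
      (↭-trans (↭-reflexive eq') (shift j cs ds))))
    off : All (λ z → z ≢ i × z ≢ j) R
    off = avoid (Unique-↭ perm (Uniq.allFin⁺ N))
    pair : parity (inverted g i j + inverted g j i) ≡ not (parity (inverted f i j + inverted f j i))
    pair rewrite transpose-i i j | transpose-j i j | <ᵇ-flip i≢j | <ᵇ-flip (λ e → i≢j (inj e)) =
      trans (sym (not-involutive _)) (cong not (sym (pair-parity u p)))
      where
      u p : Bool
      u = toℕ i <ᵇ toℕ j
      p = toℕ (f i) <ᵇ toℕ (f j)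
    cross-g : ∀ b → b ≢ i × b ≢ j → parity (cross g i j b) ≡ parity (cross f i j b)
    cross-g b (b≢i , b≢j) rewrite transpose-i i j | transpose-j i j | transpose-other i j b b≢i b≢j
      | <ᵇ-flip (λ e → b≢i (sym e)) | <ᵇ-flip (λ e → b≢j (sym e))
      | <ᵇ-flip {f b} {f i} (λ e → b≢i (inj e)) | <ᵇ-flip {f b} {f j} (λ e → b≢j (inj e)) =
      sym (cross-parity (toℕ i <ᵇ toℕ b) (toℕ j <ᵇ toℕ b) (toℕ (f b) <ᵇ toℕ (f i)) (toℕ (f b) <ᵇ toℕ (f j)))
    inner : invCount g R ≡ invCount f R
    inner = total-cong R (λ a a∈ → total-cong R (λ b b∈ → cong₂ (λ x y → indicator ((toℕ a <ᵇ toℕ b) ∧ (toℕ x <ᵇ toℕ y)))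
      (same b b∈) (same a a∈)))
      where
      same : ∀ z → z ∈ R → g z ≡ f z
      same z z∈ = All.lookup (fixed-off f R off) z∈
    rest : parity (total (cross g i j) R + invCount g R) ≡ parity (total (cross f i j) R + invCount f R)
    rest = trans (parity-+ (total (cross g i j) R) _)
      (trans (cong₂ _xor_ (parity-total R (All.map (cross-g _) off)) (cong parity inner))
        (sym (parity-+ (total (cross f i j) R) _)))

-- Cycle decompositions, the sign homomorphism and the enumerated classes

T-eq : ∀ {a b : ℕ} → T (a ≡ᵇ b) → a ≡ b
T-eq {a} {b} = ≡ᵇ⇒≡ a b

false-and : ∀ {bs} → and bs ≡ false → ∃[ b ] (b ∈ bs × b ≡ false)
false-and {false ∷ bs} e = false , here refl , refl
false-and {true ∷ bs} e with false-and {bs} e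
... | b , b∈ , h = b , there b∈ , h

∈-filterᵇ⁻ : ∀ {A : Set} (p : A → Bool) {x} xs → x ∈ filterᵇ p xs → x ∈ xs × T (p x)
∈-filterᵇ⁻ p xs x∈ = Mem.∈-filter⁻ (λ x → T? (p x)) x∈

module _ {N : ℕ} where

  focus : ∀ {x : Fin N} cs → x ∈ concat cs → ∃[ ys ] ∃[ zs ] ∃[ rest ] cs ↭ (ys ++ x ∷ zs) ∷ rest
  focus cs x∈ with Mem.∈-concat⁻′ cs x∈
  ... | c , x∈c , c∈cs with ∈-∃++ x∈c | ∈-∃++ c∈cs
  ...   | ys , zs , refl | as , bs , refl = ys , zs , as ++ bs , shift _ as bs

  focus-cycle : ∀ {σ cs} (x : Fin N) → CycleList σ cs → x ∈ concat cs →
    ∃[ xs ] ∃[ rest ] (CycleList σ ((x ∷ xs) ∷ rest) × length cs ≡ suc (length rest))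
  focus-cycle {cs = cs} x cl x∈ with focus cs x∈
  ... | ys , zs , rest , p = zs ++ ys , rest , cycleList-rotate ys (cycleList-↭ p cl) , ↭-length p

  transpose-cycles : ∀ {σ cs} (i j : Fin N) → i ≢ j → CycleList σ cs →
    ∃[ cs' ] (CycleList (λ x → σ (transpose i j x)) cs' × parity (length cs') ≡ not (parity (length cs)))
  transpose-cycles {σ} {cs} i j i≢j cl with focus-cycle i cl (∈-resp-↭ (↭-sym (cover cl)) (∈-allFin i))
  ... | xs , rest , cl' , len with ∈-++⁻ (i ∷ xs) (∈-resp-↭ (↭-sym (cover cl')) (∈-allFin j))
  ...   | inj₁ (here e) = ⊥-elim (i≢j (sym e))
  ...   | inj₁ (there j∈) with ∈-∃++ j∈
  ...     | ys , zs , refl = _ , cycle-split {ys = ys} cl' , cong (λ t → not (parity t)) (sym len)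
  transpose-cycles {σ} {cs} i j i≢j cl | xs , rest , cl' , len | inj₂ j∈ with focus rest j∈
  ... | ys , zs , rest' , p = _ ,
        cycle-merge (cycleList-↭ (↭-swap _ _ ↭-refl) (cycleList-rotate ys
          (cycleList-↭ (↭-trans (↭-prep _ p) (↭-swap _ _ ↭-refl)) cl'))) ,
        trans (sym (not-involutive _)) (cong (λ t → not (parity t)) (sym (trans len (cong suc (↭-length p)))))

  singletons : List (Fin N) → List (List (Fin N))
  singletons = map (λ x → x ∷ [])

  concat-singletons : ∀ xs → concat (singletons xs) ≡ xs
  concat-singletons [] = refl
  concat-singletons (x ∷ xs) = cong (x ∷_) (concat-singletons xs)

  identity-cycles : CycleList (λ x → x) (singletons (allFin N))
  identity-cycles = cycleList (AllP.map⁺ (All.universal (λ x → refl) (allFin N)))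
    (↭-reflexive (concat-singletons (allFin N)))

  evenF-identity : evenF (λ (x : Fin N) → x) ≡ true
  evenF-identity = cong (λ t → not (parity t)) (trans (total-cong (allFin N) (λ a _ →
    trans (total-cong (allFin N) (λ b _ → none a b)) (zeros (allFin N)))) (zeros (allFin N)))
    where
    zeros : ∀ (xs : List (Fin N)) → total (λ _ → 0) xs ≡ 0
    zeros xs = trans (total-const 0 xs) (*-zeroʳ (length xs))
    none : ∀ (a b : Fin N) → inverted (λ x → x) a b ≡ 0
    none a b with a FinP.≟ b
    ... | yes refl rewrite <ᵇ-irrefl a = refl
    ... | no a≢b rewrite <ᵇ-flip a≢b with toℕ a <ᵇ toℕ b
    ...   | true = refl
    ...   | false = refl

  -- Existence and the sign formula come from one induction: a transposition flips the sign by
  -- `evenF-transpose` and changes the parity of the number of cycles by `transpose-cycles`.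
  cycles-exist : ∀ f → Injective f → ∃[ cs ] (CycleList f cs × evenF f ≡ not (parity (N + length cs)))
  cycles-exist = swap-induction (λ f → ∃[ cs ] (CycleList f cs × evenF f ≡ not (parity (N + length cs))))
    (λ {f} {g} h (cs , cl , e) → cs , cycleList-cong (λ x → sym (h x)) cl , trans (sym (evenF-cong h)) e)
    (singletons (allFin N) , identity-cycles , trans evenF-identity (cong not (sym even)))
    step
    where
    even : parity (N + length (singletons (allFin N))) ≡ false
    even = trans (cong (λ t → parity (N + t)) (trans (ListP.length-map _ (allFin N)) (ListP.length-tabulate (λ x → x))))
      (trans (parity-+ N N) (BoolP.xor-same (parity N)))
    step : ∀ f i j → i ≢ j → Injective f → ∃[ cs ] (CycleList f cs × evenF f ≡ not (parity (N + length cs))) →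
      ∃[ cs ] (CycleList (λ x → f (transpose i j x)) cs ×
        evenF (λ x → f (transpose i j x)) ≡ not (parity (N + length cs)))
    step f i j i≢j inj (cs , cl , e) with transpose-cycles i j i≢j cl
    ... | cs' , cl' , par = cs' , cl' , trans (evenF-transpose f i j i≢j inj) (cong not (trans e (sym flip)))
      where
      flip : parity (N + length cs') ≡ not (parity (N + length cs))
      flip = trans (parity-+ N _) (trans (cong (parity N xor_) par)
        (trans (sym (BoolP.not-distribʳ-xor (parity N) _)) (cong not (sym (parity-+ N _)))))

  evenF-∘ : ∀ f → Injective f → ∀ g → Injective g → evenF (λ x → g (f x)) ≡ not (evenF g xor evenF f)
  evenF-∘ = swap-induction {N} (λ f → ∀ g → Injective g → evenF (λ x → g (f x)) ≡ not (evenF g xor evenF f))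
    (λ {f} {f'} h P g inj → trans (sym (evenF-cong (λ x → cong g (h x))))
      (trans (P g inj) (cong (λ t → not (evenF g xor t)) (evenF-cong h))))
    (λ g inj → trans (sym (not-involutive (evenF g))) (cong not (trans (sym (xor-true (evenF g)))
      (cong (evenF g xor_) (sym evenF-identity)))))
    (λ f i j i≢j f-inj P g g-inj → trans (evenF-transpose (λ x → g (f x)) i j i≢j (λ e → f-inj (g-inj e)))
      (trans (cong not (P g g-inj)) (cong not (trans (BoolP.not-distribʳ-xor (evenF g) (evenF f))
        (cong (evenF g xor_) (sym (evenF-transpose f i j i≢j f-inj)))))))
    where
    xor-true : ∀ b → b xor true ≡ not b
    xor-true true = refl
    xor-true false = refl

  ==-≡ : ∀ {a b : Fin N} → (a == b) ≡ true → a ≡ b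
  ==-≡ {a} {b} e = FinP.toℕ-injective (T-eq (subst T (sym e) tt))

  isPerm-injective : ∀ (σ : Tab N) → T (isPerm σ) → Injective (lookup σ)
  isPerm-injective σ t {x} {y} e
    with x == y in eq | All.lookup (AllP.map⁻ (All.lookup rows (∈-allFin x))) (∈-allFin y)
    where
    rows = AllP.map⁻ (AllP.concat⁻ {xss = map _ (allFin N)} (true-and t))
  ... | true | _ = ==-≡ eq
  ... | false | h = ⊥-elim (subst (λ b → T (not b)) same h)
    where
    same : (lookup σ x == lookup σ y) ≡ true
    same rewrite e = Equivalence.to T-≡ (≡⇒≡ᵇ (toℕ (lookup σ y)) (toℕ (lookup σ y)) refl)

  injective-isPerm : ∀ (σ : Tab N) → Injective (lookup σ) → T (isPerm σ)
  injective-isPerm σ inj with isPerm σ in eq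
  ... | true = tt
  ... | false with false-and {concat (map (λ i → map _ (allFin N)) (allFin N))} eq
  ...   | b , b∈ , b≡false with Mem.∈-concat⁻′ (map (λ i → map _ (allFin N)) (allFin N)) b∈
  ...     | row , b∈row , row∈ with ∈-map⁻ _ row∈
  ...       | x , _ , row≡ with ∈-map⁻ _ (subst (b ∈_) row≡ b∈row)
  ...         | y , _ , b≡ with x == y in eq₁ | trans (sym b≡) b≡false
  ...           | true | ()
  ...           | false | e with lookup σ x == lookup σ y in eq₂ | e
  ...             | true | _ with inj (==-≡ eq₂)
  ...               | refl = subst T eq₁ (≡⇒≡ᵇ (toℕ x) (toℕ x) refl)

  allVec-product : ∀ k → allVec N (suc k) ≡ List.cartesianProductWith Vec._∷_ (allFin N) (allVec N k)
  allVec-product k = go (allFin N)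
    where
    go : ∀ xs → concatMap (λ x → map (x Vec.∷_) (allVec N k)) xs ≡ List.cartesianProductWith Vec._∷_ xs (allVec N k)
    go [] = refl
    go (x ∷ xs) = cong (map (x Vec.∷_) (allVec N k) ++_) (go xs)

  allVec-complete : ∀ k (v : Vec (Fin N) k) → v ∈ allVec N k
  allVec-complete zero Vec.[] = here refl
  allVec-complete (suc k) (x Vec.∷ v) = subst ((x Vec.∷ v) ∈_) (sym (allVec-product k))
    (Mem.∈-cartesianProductWith⁺ Vec._∷_ (∈-allFin x) (allVec-complete k v))

  allVec-unique : ∀ k → Unique (allVec N k)
  allVec-unique zero = [] ∷ []
  allVec-unique (suc k) = subst Unique (sym (allVec-product k))
    (Uniq.cartesianProductWith⁺ Vec._∷_ VecP.∷-injective (Uniq.allFin⁺ N) (allVec-unique k))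

  SymN-∈ : ∀ (σ : Tab N) → Injective (lookup σ) → σ ∈ SymN N
  SymN-∈ σ inj = Mem.∈-filter⁺ _ (allVec-complete N σ) (injective-isPerm σ inj)

  ∈-SymN : ∀ (σ : Tab N) → σ ∈ SymN N → Injective (lookup σ)
  ∈-SymN σ σ∈ = isPerm-injective σ (proj₂ (∈-filterᵇ⁻ isPerm (allVec N N) σ∈))

  SymN-unique : Unique (SymN N)
  SymN-unique = Uniq.filter⁺ _ (allVec-unique N)

  C2-unique : Unique (C2 N)
  C2-unique = Uniq.filter⁺ _ SymN-unique

  Matching : (Fin N → Fin N) → Set
  Matching f = (∀ x → f (f x) ≡ x) × (∀ x → f x ≢ x)

  matching-injective : ∀ {f} → Matching f → Injective f
  matching-injective (inv , _) = involution-injective inv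

  -- The tests `inCJ` and `inC2` cover the lengths up to N only, but no cycle is longer, so every
  -- length that occurs has been tested.
  prescribed-lengths : ∀ (σ : Tab N) {cs} (k : ℕ → ℕ) → CycleList (lookup σ) cs →
    T (and (map (λ j → cyclesOfLen σ j ≡ᵇ k j) (upTo (suc N)))) →
    ∀ {c} → c ∈ cs → 1 ≤ k (length c)
  prescribed-lengths σ {cs} k cl t {c} c∈ = subst (1 ≤_)
    (trans (sym (cyclesOfLen-count σ cl (length c)))
      (T-eq (All.lookup (AllP.map⁻ {f = λ j → cyclesOfLen σ j ≡ᵇ k j} (true-and t))
        (∈-upTo⁺ (s≤s (proj₂ (proj₂ (All.lookup (proper-cycles σ cl) c∈))))))))
    (positive cs c∈)
    where
    positive : ∀ cs → c ∈ cs → 1 ≤ count (λ d → length d ≡ᵇ length c) cs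
    positive (d ∷ cs) (here refl) rewrite Equivalence.to T-≡ (≡⇒≡ᵇ (length d) (length d) refl) = s≤s z≤n
    positive (d ∷ cs) (there c∈) = ≤-trans (positive cs c∈) (m≤n+m _ _)

  C2-matching : ∀ (β : Tab N) → β ∈ C2 N → Matching (lookup β)
  C2-matching β β∈ with ∈-filterᵇ⁻ inC2 (SymN N) β∈
  ... | β∈S , t with cycles-exist (lookup β) (∈-SymN β β∈S)
  ...   | cs , cl , _ = (λ x → proj₁ (at x)) , (λ x → proj₂ (at x))
    where
    len2 : ∀ c → c ∈ cs → length c ≡ 2
    len2 c c∈ with length c ≡ᵇ 2 in eq | prescribed-lengths β (λ j → if j ≡ᵇ 2 then N Data.Nat./ 2 else 0) cl t c∈
    ... | true | _ = T-eq (subst T (sym eq) tt)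
    ... | false | ()
    at : ∀ x → lookup β (lookup β x) ≡ x × lookup β x ≢ x
    at x with focus-cycle x cl (∈-resp-↭ (↭-sym (cover cl)) (∈-allFin x)) | focus cs (∈-resp-↭ (↭-sym (cover cl)) (∈-allFin x))
    ... | _ | ys , zs , rest , p with cycleList-rotate ys (cycleList-↭ p cl)
                                    | len2 (ys ++ x ∷ zs) (∈-resp-↭ (↭-sym p) (here refl))
    ...   | cl' | len with zs ++ ys | trans (sym (↭-length (Perm.++-comm ys (x ∷ zs)))) len
    ...     | y ∷ [] | _ with cycles cl' | cover-unique {cs = (x ∷ y ∷ []) ∷ rest} (cover cl')
    ...       | (e , e') ∷ _ | (x≢y ∷ _) ∷ _ = trans (cong (lookup β) e) e' , (λ fx≡x → x≢y (trans (sym fx≡x) e))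

  matching-C2 : ∀ (β : Tab N) → Matching (lookup β) → β ∈ C2 N
  matching-C2 β m@(inv , moved) with cycles-exist (lookup β) (matching-injective m)
  ... | cs , cl , _ = Mem.∈-filter⁺ _ (SymN-∈ β (matching-injective m)) (and-true (AllP.map⁺ (All.universal
        (λ j → ≡⇒≡ᵇ _ _ (trans (cyclesOfLen-count β cl j) (lengths j))) (upTo (suc N)))))
    where
    len2 : ∀ c → ProperCycle β c → length c ≡ 2
    len2 (x ∷ []) (e , _) = ⊥-elim (moved x e)
    len2 (x ∷ y ∷ []) _ = refl
    len2 (x ∷ y ∷ z ∷ c) ((e , e' , _) , ((_ ∷ x≢z ∷ _) ∷ _) , _) =
      ⊥-elim (x≢z (trans (sym (inv x)) (trans (cong (lookup β) e) e')))
    twos : All (λ c → length c ≡ 2) cs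
    twos = All.map (λ {c} → len2 c) (proper-cycles β cl)
    double : ∀ cs → All (λ (c : List (Fin N)) → length c ≡ 2) cs → length (concat cs) ≡ length cs * 2
    double [] [] = refl
    double (c ∷ cs) (e ∷ es) = trans (ListP.length-++ c) (cong₂ _+_ e (double cs es))
    half : N Data.Nat./ 2 ≡ length cs
    half = trans (cong (Data.Nat._/ 2) (trans (sym (cover-length {cs = cs} (cover cl))) (double cs twos))) (m*n/n≡m (length cs) 2)
    lengths : ∀ j → count (λ c → length c ≡ᵇ j) cs ≡ (if j ≡ᵇ 2 then N Data.Nat./ 2 else 0)
    lengths j = trans (total-cong-All cs twos (λ c e → cong (λ t → indicator (t ≡ᵇ j)) e))
      (trans (total-const (indicator (2 ≡ᵇ j)) cs) (cases j))
      where
      cases : ∀ j → length cs * indicator (2 ≡ᵇ j) ≡ (if j ≡ᵇ 2 then N Data.Nat./ 2 else 0)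
      cases 0 = *-zeroʳ (length cs)
      cases 1 = *-zeroʳ (length cs)
      cases 2 = trans (*-identityʳ (length cs)) (sym half)
      cases (suc (suc (suc j))) = *-zeroʳ (length cs)

-- Gluing labelled polygons

count-find : ∀ {A : Set} (p : A → Bool) xs {r} → count p xs ≡ suc r →
  ∃[ ys ] ∃[ x ] ∃[ zs ] (xs ≡ ys ++ x ∷ zs × p x ≡ true × count p (zs ++ ys) ≡ r)
count-find p (x ∷ xs) e with p x in eq
... | true = [] , x , xs , refl , eq , trans (cong (count p) (++-identityʳ xs)) (suc-injective e)
... | false with count-find p xs e
...   | ys , z , zs , refl , pz , c = x ∷ ys , z , zs , refl , pz ,
        trans (total-↭ _ (shift x zs ys)) (trans (cong (λ b → indicator b + count p (zs ++ ys)) eq) c)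

count-at : ∀ {A : Set} (_≟_ : (x y : A) → Dec (x ≡ y)) (q : A → Bool) y xs → Unique xs → y ∈ xs →
  count (λ x → does (y ≟ x) ∧ q x) xs ≡ indicator (q y)
count-at _≟_ q y (.y ∷ xs) (u ∷ us) (here refl) rewrite dec-true (y ≟ y) refl =
  trans (cong (indicator (q y) +_) (count-none xs (λ x x∈ → cong (_∧ q x) (dec-false (y ≟ x) (All.lookup u x∈)))))
    (+-identityʳ _)
count-at _≟_ q y (x ∷ xs) (u ∷ us) (there y∈) rewrite dec-false (y ≟ x) (λ e → All.lookup u y∈ (sym e)) =
  count-at _≟_ q y xs us y∈

Pointwise-replicate : ∀ {V : List ℕ → ℕ → Set} {o e} vs → All (V o) vs → length vs ≡ e →
  Pointwise V (replicate e o) vs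
Pointwise-replicate [] [] refl = []
Pointwise-replicate (v ∷ vs) (h ∷ hs) refl = h ∷ Pointwise-replicate vs hs refl

module _ {N : ℕ} where

  -- The pairs matched so far, as an involution fixing the live labels.
  record Partial (β₀ : Fin N → Fin N) (live : Fin N → Bool) : Set where
    field
      involutive : ∀ x → β₀ (β₀ x) ≡ x
      fixed : ∀ x → live x ≡ true → β₀ x ≡ x
      moved : ∀ x → live x ≡ false → β₀ x ≢ x

  open Partial

  abstract
    agree? : ∀ (β₀ : Fin N → Fin N) (live : Fin N → Bool) (β : Tab N) →
      Dec (∀ x → live x ≡ false → lookup β x ≡ β₀ x)
    agree? β₀ live β = FinP.all? (λ x → (live x BoolP.≟ false) →-dec (lookup β x FinP.≟ β₀ x))

  Matchings : List (Tab N) → Set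
  Matchings L = Unique L × (∀ β → β ∈ L → Matching (lookup β)) × (∀ β → Matching (lookup β) → β ∈ L)

  value : List (Tab N) → (Tab N → Bool) → (Fin N → Fin N) → (Fin N → Bool) → ℕ
  value L Q β₀ live = count (λ β → does (agree? β₀ live β) ∧ Q β) L

  kill : (Fin N → Bool) → Fin N → Fin N → Fin N → Bool
  kill live i j x = live x ∧ (not (does (i FinP.≟ x)) ∧ not (does (j FinP.≟ x)))

  kill-i : ∀ live i j → kill live i j i ≡ false
  kill-i live i j rewrite dec-true (i FinP.≟ i) refl = BoolP.∧-zeroʳ (live i)

  kill-j : ∀ live i j → kill live i j j ≡ false
  kill-j live i j rewrite dec-true (j FinP.≟ j) refl =
    trans (cong (live j ∧_) (BoolP.∧-zeroʳ _)) (BoolP.∧-zeroʳ (live j))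

  kill-other : ∀ live i j x → x ≢ i → x ≢ j → kill live i j x ≡ live x
  kill-other live i j x a b rewrite dec-false (i FinP.≟ x) (λ e → a (sym e))
    | dec-false (j FinP.≟ x) (λ e → b (sym e)) = BoolP.∧-identityʳ (live x)

  count-kill : ∀ {live i j} xs → All (λ z → z ≢ i × z ≢ j) xs → count (kill live i j) xs ≡ count live xs
  count-kill {live} {i} {j} xs off = count-cong xs (λ x x∈ →
    kill-other live i j x (proj₁ (All.lookup off x∈)) (proj₂ (All.lookup off x∈)))

  live-kill : ∀ {live i j} → live i ≡ true → live j ≡ true → i ≢ j →
    count live (allFin N) ≡ 2 + count (kill live i j) (allFin N)
  live-kill {live} {i} {j} li lj i≢j = trans (total-cong (allFin N) (λ x _ → pointwise x))
    (trans (total-+ (λ x → indicator (does (i FinP.≟ x)))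
      (λ x → indicator (does (j FinP.≟ x)) + indicator (kill live i j x)) (allFin N))
      (cong₂ _+_ (count-one FinP._≟_ i (allFin N) (Uniq.allFin⁺ N) (∈-allFin i))
        (trans (total-+ (λ x → indicator (does (j FinP.≟ x))) (λ x → indicator (kill live i j x)) (allFin N))
          (cong (_+ count (kill live i j) (allFin N))
            (count-one FinP._≟_ j (allFin N) (Uniq.allFin⁺ N) (∈-allFin j))))))
    where
    pointwise : ∀ x → indicator (live x)
      ≡ indicator (does (i FinP.≟ x)) + (indicator (does (j FinP.≟ x)) + indicator (kill live i j x))
    pointwise x with i FinP.≟ x | j FinP.≟ x
    ... | yes refl | yes refl = ⊥-elim (i≢j refl)
    ... | yes refl | no _ rewrite li = refl
    ... | no _ | yes refl rewrite lj = refl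
    ... | no _ | no _ = cong indicator (sym (BoolP.∧-identityʳ (live x)))

  partial-glue : ∀ {β₀ live i j} → Partial β₀ live → live i ≡ true → live j ≡ true → i ≢ j →
    Partial (λ x → β₀ (transpose i j x)) (kill live i j)
  partial-glue {β₀} {live} {i} {j} P li lj i≢j = record { involutive = inv' ; fixed = fixed' ; moved = moved' }
    where
    back : ∀ {k} → live k ≡ true → ∀ x → β₀ x ≡ k → x ≡ k
    back lk x e = trans (sym (involutive P x)) (trans (cong β₀ e) (fixed P _ lk))
    inv' : ∀ x → β₀ (transpose i j (β₀ (transpose i j x))) ≡ x
    inv' x with x FinP.≟ i
    ... | yes refl rewrite fixed P j lj | transpose-j i j = fixed P i li
    ... | no x≢i with x FinP.≟ j
    ...   | yes refl rewrite fixed P i li | transpose-i i j = fixed P j lj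
    ...   | no x≢j rewrite transpose-other i j (β₀ x) (λ e → x≢i (back li x e)) (λ e → x≢j (back lj x e)) =
      involutive P x
    fixed' : ∀ x → kill live i j x ≡ true → β₀ (transpose i j x) ≡ x
    fixed' x k with x FinP.≟ i
    ... | yes refl with trans (sym k) (kill-i live i j)
    ...   | ()
    fixed' x k | no x≢i with x FinP.≟ j
    ... | yes refl with trans (sym k) (kill-j live i j)
    ...   | ()
    fixed' x k | no x≢i | no x≢j = fixed P x (trans (sym (kill-other live i j x x≢i x≢j)) k)
    moved' : ∀ x → kill live i j x ≡ false → β₀ (transpose i j x) ≢ x
    moved' x k with x FinP.≟ i
    ... | yes refl = λ e → i≢j (sym (trans (sym (fixed P j lj)) e))
    ... | no x≢i with x FinP.≟ j
    ...   | yes refl = λ e → i≢j (trans (sym (fixed P i li)) e)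
    ...   | no x≢j = moved P x (trans (sym (kill-other live i j x x≢i x≢j)) k)

  -- Sorts the matchings by the partner of i. The partner is live: on a dead label a matching that
  -- agrees with `β₀` coincides with it, and `β₀`, being an involution that fixes i, sends no other
  -- label to i.
  value-step : ∀ L Q {β₀ live i} js → Matchings L → Partial β₀ live → live i ≡ true → Unique js →
    (∀ j → j ∈ js → live j ≡ true × i ≢ j) → (∀ j → live j ≡ true → i ≢ j → j ∈ js) →
    value L Q β₀ live ≡ total (λ j → value L Q (λ x → β₀ (transpose i j x)) (kill live i j)) js
  value-step L Q {β₀} {live} {i} js (_ , matching , _) P li u sound complete =
    trans (count-fibres FinP._≟_ (λ β → does (agree? β₀ live β) ∧ Q β) (λ β → lookup β i) L js u partner)
      (total-cong js (λ j j∈ → count-cong L (λ β β∈ → refine j (sound j j∈) β (matching β β∈))))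
    where
    partner : ∀ β → β ∈ L → does (agree? β₀ live β) ∧ Q β ≡ true → lookup β i ∈ js
    partner β β∈ e with matching β β∈ | agree? β₀ live β
    ... | inv , mov | yes agree with live (lookup β i) in l
    ...   | true = complete (lookup β i) l (λ eq → mov i (sym eq))
    ...   | false = ⊥-elim (mov i (trans (sym (involutive P (lookup β i)))
              (trans (cong β₀ (trans (sym (agree (lookup β i) l)) (inv i))) (fixed P i li))))
    refine : ∀ j → live j ≡ true × i ≢ j → ∀ β → Matching (lookup β) →
      (does (agree? β₀ live β) ∧ Q β) ∧ does (lookup β i FinP.≟ j)
        ≡ does (agree? (λ x → β₀ (transpose i j x)) (kill live i j) β) ∧ Q β
    refine j (lj , i≢j) β (inv , mov) = trans (rotate (does (agree? β₀ live β)) (Q β) (does (lookup β i FinP.≟ j)))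
      (cong (_∧ Q β) (does-⇔ (mk⇔ to from)
        (agree? β₀ live β ×-dec (lookup β i FinP.≟ j)) (agree? (λ x → β₀ (transpose i j x)) (kill live i j) β)))
      where
      rotate : ∀ a t e → (a ∧ t) ∧ e ≡ (a ∧ e) ∧ t
      rotate a t e = trans (∧-assoc a t e) (trans (cong (a ∧_) (∧-comm t e)) (sym (∧-assoc a e t)))
      to : (∀ x → live x ≡ false → lookup β x ≡ β₀ x) × lookup β i ≡ j →
        ∀ x → kill live i j x ≡ false → lookup β x ≡ β₀ (transpose i j x)
      to (agree , e) x k with x FinP.≟ i
      ... | yes refl = trans e (sym (fixed P j lj))
      ... | no x≢i with x FinP.≟ j
      ...   | yes refl = trans (trans (cong (lookup β) (sym e)) (inv i)) (sym (fixed P i li))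
      ...   | no x≢j = agree x (trans (sym (kill-other live i j x x≢i x≢j)) k)
      from : (∀ x → kill live i j x ≡ false → lookup β x ≡ β₀ (transpose i j x)) →
        (∀ x → live x ≡ false → lookup β x ≡ β₀ x) × lookup β i ≡ j
      from agree = (λ x l → trans (agree x (cong (λ b → b ∧ (not (does (i FinP.≟ x)) ∧ not (does (j FinP.≟ x)))) l)) (cong β₀ (transpose-other i j x (dead l li) (dead l lj)))) ,
        trans (agree i (kill-i live i j)) (trans (cong β₀ (transpose-i i j)) (fixed P j lj))
        where
        dead : ∀ {x k} → live x ≡ false → live k ≡ true → x ≢ k
        dead l l' refl with trans (sym l) l'
        ... | ()

  total-live : ∀ {σ cs} (live : Fin N → Bool) → CycleList σ cs → total (count live) cs ≡ count live (allFin N)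
  total-live {cs = cs} live cl = trans (sym (total-concat _ cs)) (total-↭ _ (cover cl))

  lookup-compose : ∀ (α β : Tab N) x → lookup (compose α β) x ≡ lookup α (lookup β x)
  lookup-compose α β x = VecP.lookup-map x (lookup α) β

  hits : (ℕ → Bool) → Tab N → Tab N → Bool
  hits A α β = A (numCycles (compose α β))

  value-full : ∀ L A α {β₀ live cs} → Matchings L → Partial β₀ live → CycleList (λ x → lookup α (β₀ x)) cs →
    count live (allFin N) ≡ 0 → value L (hits A α) β₀ live ≡ indicator (A (length cs))
  value-full L A α {β₀} {live} {cs} (L-unique , _ , complete) P cl none = trans
    (count-cong L (λ β _ → cong (_∧ hits A α β)
      (does-⇔ (mk⇔ (to β) (from β)) (agree? β₀ live β) (VecP.≡-dec FinP._≟_ b β))))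
    (trans (count-at (VecP.≡-dec FinP._≟_) (hits A α) b L L-unique b∈)
      (cong (λ t → indicator (A t)) (numCycles-length (compose α b) (cycleList-cong
        (λ x → trans (lookup-compose α b x) (cong (lookup α) (lookup-b x))) cl))))
    where
    b : Tab N
    b = Vec.tabulate β₀
    lookup-b : ∀ x → lookup b x ≡ β₀ x
    lookup-b = VecP.lookup∘tabulate β₀
    dead : ∀ x → live x ≡ false
    dead x = go (allFin N) none (∈-allFin x)
      where
      go : ∀ xs → count live xs ≡ 0 → x ∈ xs → live x ≡ false
      go (y ∷ xs) e (here refl) with live y
      ... | false = refl
      go (y ∷ xs) e (there x∈) = go xs (m+n≡0⇒n≡0 (indicator (live y)) e) x∈
    b∈ : b ∈ L
    b∈ = complete b ((λ x → trans (cong (lookup b) (lookup-b x)) (trans (lookup-b (β₀ x)) (involutive P x))) ,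
      (λ x e → moved P x (dead x) (trans (sym (lookup-b x)) e)))
    to : ∀ β → (∀ x → live x ≡ false → lookup β x ≡ β₀ x) → b ≡ β
    to β h = trans (VecP.tabulate-cong (λ x → sym (h x (dead x)))) (VecP.tabulate∘lookup β)
    from : ∀ β → b ≡ β → ∀ x → live x ≡ false → lookup β x ≡ β₀ x
    from β refl x _ = lookup-b x

  -- The state is α composed with `β₀`, which fixes the live labels. Only the numbers of live labels
  -- on its cycles are recorded, and a cycle without live labels is a finished vertex. For whichever
  -- cycle is peeled, one of its live labels i is chosen; its possible partners, listed along its
  -- own cycle and then cycle by cycle, reproduce `splits` followed by `merges`.
  gluing : ∀ L A α n {β₀ live cs} → Matchings L → Partial β₀ live → CycleList (λ x → lookup α (β₀ x)) cs →
    count live (allFin N) ≡ 2 * n → Val A n (map (count live) cs) (value L (hits A α) β₀ live)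
  gluing L A α zero {cs = cs} ML P cl none =
    trans (value-full L A α ML P cl none) (cong (λ t → indicator (A t)) (sym (ListP.length-map _ cs)))
  gluing L A α (suc n) {β₀} {live} {cs} ML P cl total-2n r ν p with ↭-map-inv (count live) p
  ... | c ∷ rest , eq , q with count-find live c (sym (proj₁ (ListP.∷-injective eq)))
  ...   | ys₀ , i , zs₀ , refl , li , r≡ with refl ← proj₂ (ListP.∷-injective eq) =
    map V (filterᵇ live xs) ++ map V (filterᵇ live (concat rest)) ,
    PW.++⁺ (subst (λ t → Pointwise (Val A n) (splits 0 t ν) (map V (filterᵇ live xs))) r≡ (split-values [] xs refl))
           (merge-values [] rest ↭-refl) ,
    trans (value-step L (hits A α) js ML P li js-unique js-sound js-complete)
      (cong sum (map-++ V (filterᵇ live xs) (filterᵇ live (concat rest))))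
    where
    xs : List (Fin N)
    xs = zs₀ ++ ys₀
    V : Fin N → ℕ
    V j = value L (hits A α) (λ x → β₀ (transpose i j x)) (kill live i j)
    cl' : CycleList (λ x → lookup α (β₀ x)) ((i ∷ xs) ∷ rest)
    cl' = cycleList-rotate ys₀ (cycleList-↭ q cl)
    js : List (Fin N)
    js = filterᵇ live xs ++ filterᵇ live (concat rest)
    js-filter : filterᵇ live (xs ++ concat rest) ≡ js
    js-filter = ListP.filter-++ (λ x → T? (live x)) xs (concat rest)
    unique : Unique (i ∷ xs ++ concat rest)
    unique = cover-unique {cs = (i ∷ xs) ∷ rest} (cover cl')
    js-unique : Unique js
    js-unique with unique
    ... | _ ∷ u = subst Unique js-filter (Uniq.filter⁺ _ u)
    live-js : ∀ {j} → j ∈ js → j ∈ xs ++ concat rest × live j ≡ true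
    live-js j∈ with ∈-filterᵇ⁻ live (xs ++ concat rest) (subst (_ ∈_) (sym js-filter) j∈)
    ... | a , t = a , Equivalence.to T-≡ t
    js-sound : ∀ j → j ∈ js → live j ≡ true × i ≢ j
    js-sound j j∈ with live-js j∈ | unique
    ... | a , l | i∉ ∷ _ = l , All.lookup i∉ a
    js-complete : ∀ j → live j ≡ true → i ≢ j → j ∈ js
    js-complete j l i≢j with ∈-resp-↭ (↭-sym (cover cl')) (∈-allFin j)
    ... | here e = ⊥-elim (i≢j (sym e))
    ... | there j∈ = subst (j ∈_) js-filter (Mem.∈-filter⁺ (λ x → T? (live x)) j∈ (Equivalence.from T-≡ l))
    child : ∀ {j cs'} → live j ≡ true → i ≢ j → CycleList (λ x → lookup α (β₀ (transpose i j x))) cs' →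
      Val A n (map (count (kill live i j)) cs') (V j)
    child {j} lj i≢j clj = gluing L A α n ML (partial-glue P li lj i≢j) clj
      (suc-injective (suc-injective (trans (sym (live-kill li lj i≢j)) (trans total-2n (*-suc 2 n)))))
    map-kill : ∀ {j} ds → All (λ z → z ≢ i × z ≢ j) (concat ds) → map (count (kill live i j)) ds ≡ map (count live) ds
    map-kill [] off = refl
    map-kill (d ∷ ds) off = cong₂ _∷_ (count-kill d (AllP.++⁻ˡ d off)) (map-kill ds (AllP.++⁻ʳ d off))
    count-snoc : ∀ pre y → count live (pre ++ y ∷ []) ≡ count live pre + indicator (live y)
    count-snoc pre y = trans (total-++ _ pre (y ∷ [])) (cong (count live pre +_) (+-identityʳ _))
    -- `pre` holds the labels between i and the current one. Only its live labels count, so passing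
    -- a dead label does not move d.
    split-values : ∀ pre suf → xs ≡ pre ++ suf →
      Pointwise (Val A n) (splits (count live pre) (count live suf) ν) (map V (filterᵇ live suf))
    split-values pre [] e = []
    split-values pre (y ∷ suf) e with live y in ly
    ... | false = subst (λ t → Pointwise (Val A n) (splits t (count live suf) ν) (map V (filterᵇ live suf)))
        (trans (count-snoc pre y) (trans (cong (λ b → count live pre + indicator b) ly) (+-identityʳ _)))
        (split-values (pre ++ y ∷ []) suf (trans e (sym (++-assoc pre (y ∷ []) suf))))
    ... | true = subst (λ o → Val A n o (V y)) counts (child ly (λ i≡y → i∉y i≡y) (cycle-split {ys = pre} cl-y)) ∷
        subst (λ t → Pointwise (Val A n) (splits t (count live suf) ν) (map V (filterᵇ live suf)))
          (trans (count-snoc pre y) (trans (cong (λ b → count live pre + indicator b) ly) (+-comm _ 1)))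
          (split-values (pre ++ y ∷ []) suf (trans e (sym (++-assoc pre (y ∷ []) suf))))
      where
      cl-y : CycleList (λ x → lookup α (β₀ x)) ((i ∷ pre ++ y ∷ suf) ∷ rest)
      cl-y = subst (λ t → CycleList (λ x → lookup α (β₀ x)) ((i ∷ t) ∷ rest)) e cl'
      i∉y : i ≢ y
      i∉y with cover-unique {cs = (i ∷ pre ++ y ∷ suf) ∷ rest} (cover cl-y)
      ... | i∉ ∷ _ = All.lookup i∉ (∈-++⁺ˡ (∈-++⁺ʳ pre (here refl)))
      off = avoid-split {ys = pre} {suf} {rest} (cover cl-y)
      counts : map (count (kill live i y)) ((y ∷ pre) ∷ (i ∷ suf) ∷ rest) ≡ count live pre ∷ count live suf ∷ ν
      counts = cong₂ _∷_ (cong₂ (λ b t → indicator b + t) (kill-j live i y) (count-kill pre (proj₁ off)))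
        (cong₂ _∷_ (cong₂ (λ b t → indicator b + t) (kill-i live i y) (count-kill suf (proj₁ (proj₂ off))))
          (map-kill rest (proj₂ (proj₂ off))))
    merge-values : ∀ pre post → rest ↭ pre ++ post →
      Pointwise (Val A n) (merges r (map (count live) pre) (map (count live) post)) (map V (filterᵇ live (concat post)))
    merge-values pre [] e = []
    merge-values pre (d ∷ post) e = subst (Pointwise (Val A n) _)
      (sym (trans (cong (map V) (ListP.filter-++ (λ x → T? (live x)) d (concat post))) (map-++ V (filterᵇ live d) _)))
      (PW.++⁺ (Pointwise-replicate (map V (filterᵇ live d)) (AllP.map⁺ (All.tabulate merged))
                (trans (ListP.length-map V (filterᵇ live d)) (length-filterᵇ live d)))
              (merge-values (d ∷ pre) post (↭-trans e (shift d pre post))))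
      where
      merged : ∀ {j} → j ∈ filterᵇ live d →
        Val A n ((r + pred (count live d)) ∷ (map (count live) pre ++ map (count live) post)) (V j)
      merged {j} j∈ with ∈-filterᵇ⁻ live d j∈
      ... | j∈d , t with ∈-∃++ j∈d
      ...   | ys , zs , refl = subst (λ o → Val A n o (V j)) counts (child lj i≢j clj)
        where
        lj : live j ≡ true
        lj = Equivalence.to T-≡ t
        cl-j : CycleList (λ x → lookup α (β₀ x)) ((i ∷ xs) ∷ (j ∷ zs ++ ys) ∷ pre ++ post)
        cl-j = cycleList-↭ (↭-swap _ _ ↭-refl) (cycleList-rotate ys (cycleList-↭
          (↭-trans (↭-prep _ (↭-trans e (shift d pre post))) (↭-swap _ _ ↭-refl)) cl'))
        clj : CycleList (λ x → lookup α (β₀ (transpose i j x))) ((i ∷ (zs ++ ys) ++ j ∷ xs) ∷ pre ++ post)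
        clj = cycle-merge cl-j
        i≢j : i ≢ j
        i≢j with cover-unique {cs = (i ∷ xs) ∷ (j ∷ zs ++ ys) ∷ pre ++ post} (cover cl-j)
        ... | i∉ ∷ _ = All.lookup i∉ (∈-++⁺ʳ xs (here refl))
        off = avoid-split {ys = zs ++ ys} {xs} {pre ++ post} (cover clj)
        arith : ∀ a b c → a + b + c ≡ c + pred (b + suc a)
        arith a b c rewrite +-suc b a = trans (+-comm (a + b) c) (cong (c +_) (+-comm a b))
        counts : map (count (kill live i j)) ((i ∷ (zs ++ ys) ++ j ∷ xs) ∷ pre ++ post)
          ≡ (r + pred (count live (ys ++ j ∷ zs))) ∷ (map (count live) pre ++ map (count live) post)
        counts = cong₂ _∷_ (trans (cong (λ b → indicator b + count (kill live i j) ((zs ++ ys) ++ j ∷ xs)) (kill-i live i j))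
            (trans (total-++ _ (zs ++ ys) (j ∷ xs))
              (trans (cong₂ _+_ (trans (count-kill (zs ++ ys) (proj₁ off)) (total-++ _ zs ys))
                  (trans (cong (λ b → indicator b + count (kill live i j) xs) (kill-j live i j))
                    (trans (count-kill xs (proj₁ (proj₂ off))) r≡)))
                (trans (arith (count live zs) (count live ys) r)
                  (cong (λ t → r + pred t) (sym (trans (total-++ _ ys (j ∷ zs))
                    (cong (λ b → count live ys + (indicator b + count live zs)) lj))))))))
          (trans (map-kill (pre ++ post) (proj₂ (proj₂ off))) (map-++ (count live) pre post))

-- Averaging over the symmetric group

involution-total : ∀ {A : Set} (h : A → A) (g : A → ℕ) S → (∀ x → h (h x) ≡ x) →
  (∀ x → x ∈ S → h x ∈ S) → Unique S → total (λ x → g (h x)) S ≡ total g S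
involution-total h g S inv closed u = trans (sym (total-map g h S)) (total-↭ g
  (∼bag⇒↭ (unique∧set⇒bag (Uniq.map⁺ (λ e → trans (sym (inv _)) (trans (cong h e) (inv _))) u) u (mk⇔ to from))))
  where
  to : ∀ {x} → x ∈ map h S → x ∈ S
  to x∈ with ∈-map⁻ h x∈
  ... | y , y∈ , refl = closed y y∈
  from : ∀ {x} → x ∈ S → x ∈ map h S
  from {x} x∈ = subst (_∈ map h S) (inv x) (∈-map⁺ h (closed x x∈))

indicator-∧ : ∀ a b → indicator a * indicator b ≡ indicator (a ∧ b)
indicator-∧ true b = +-identityʳ _
indicator-∧ false b = refl

length-allFin : ∀ N → length (allFin N) ≡ N
length-allFin N = ListP.length-tabulate (λ x → x)

module _ {N : ℕ} where

  Perms : List (Tab N) → Set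
  Perms S = Unique S × (∀ σ → σ ∈ S → Injective (lookup σ)) × (∀ σ → Injective (lookup σ) → σ ∈ S)

  tab-ext : ∀ {α β : Tab N} → (∀ x → lookup α x ≡ lookup β x) → α ≡ β
  tab-ext {α} {β} h = trans (sym (VecP.tabulate∘lookup α)) (trans (VecP.tabulate-cong h) (VecP.tabulate∘lookup β))

  compose-injective : ∀ {α β : Tab N} → Injective (lookup α) → Injective (lookup β) → Injective (lookup (compose α β))
  compose-injective {α} {β} i j {x} {y} e = j (i (trans (sym (lookup-compose α β x)) (trans e (lookup-compose α β y))))

  right-total : ∀ {S} → Perms S → ∀ b → (∀ x → lookup b (lookup b x) ≡ x) → (g : Tab N → ℕ) →
    total (λ μ → g (compose μ b)) S ≡ total g S
  right-total {S} (u , inj , all) b inv g = involution-total (λ μ → compose μ b) g S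
    (λ μ → tab-ext (λ x → trans (lookup-compose (compose μ b) b x) (trans (lookup-compose μ b (lookup b x)) (cong (lookup μ) (inv x)))))
    (λ μ μ∈ → all (compose μ b) (compose-injective {μ} {b} (inj μ μ∈) (involution-injective inv))) u

  left-total : ∀ {S} → Perms S → ∀ b → (∀ x → lookup b (lookup b x) ≡ x) → (g : Tab N → ℕ) →
    total (λ μ → g (compose b μ)) S ≡ total g S
  left-total {S} (u , inj , all) b inv g = involution-total (λ μ → compose b μ) g S
    (λ μ → tab-ext (λ x → trans (lookup-compose b (compose b μ) x) (trans (cong (lookup b) (lookup-compose b μ x)) (inv (lookup μ x)))))
    (λ μ μ∈ → all (compose b μ) (compose-injective {b} {μ} (involution-injective inv) (inj μ μ∈))) u

  transposition : Fin N → Fin N → Tab N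
  transposition i j = Vec.tabulate (transpose i j)

  lookup-transposition : ∀ i j x → lookup (transposition i j) x ≡ transpose i j x
  lookup-transposition i j = VecP.lookup∘tabulate (transpose i j)

  transposition-involutive : ∀ i j x → lookup (transposition i j) (lookup (transposition i j) x) ≡ x
  transposition-involutive i j x = trans (cong (lookup (transposition i j)) (lookup-transposition i j x))
    (trans (lookup-transposition i j _) (transpose-involutive i j x))

  maps : Tab N → Fin N → Fin N → Bool
  maps μ i y = does (lookup μ i FinP.≟ y)

  maps-transposed : ∀ μ i y w z → transpose y w z ≡ z → maps (compose (transposition y w) μ) i z ≡ maps μ i z
  maps-transposed μ i y w z fix = does-⇔ (mk⇔ to from) (_ FinP.≟ z) (_ FinP.≟ z)
    where
    form : lookup (compose (transposition y w) μ) i ≡ transpose y w (lookup μ i)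
    form = trans (lookup-compose (transposition y w) μ i) (lookup-transposition y w _)
    to : lookup (compose (transposition y w) μ) i ≡ z → lookup μ i ≡ z
    to e = trans (sym (transpose-involutive y w _)) (trans (cong (transpose y w) (trans (sym form) e)) fix)
    from : lookup μ i ≡ z → lookup (compose (transposition y w) μ) i ≡ z
    from e = trans form (trans (cong (transpose y w) e) fix)

  maps-moved : ∀ μ i y w → maps (compose (transposition y w) μ) i w ≡ maps μ i y
  maps-moved μ i y w = does-⇔ (mk⇔ to from) (_ FinP.≟ w) (_ FinP.≟ y)
    where
    form : lookup (compose (transposition y w) μ) i ≡ transpose y w (lookup μ i)
    form = trans (lookup-compose (transposition y w) μ i) (lookup-transposition y w _)
    to : lookup (compose (transposition y w) μ) i ≡ w → lookup μ i ≡ y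
    to e = trans (sym (transpose-involutive y w _))
      (trans (cong (transpose y w) (trans (sym form) e)) (transpose-j y w))
    from : lookup μ i ≡ y → lookup (compose (transposition y w) μ) i ≡ w
    from e = trans form (trans (cong (transpose y w) e) (transpose-i y w))

  module _ {S : List (Tab N)} (perms : Perms S) where

    -- Left multiplication by the transposition of y and w carries the permutations that send i to y
    -- to those that send i to w, so all N fibres have the same size.
    one-value : ∀ i y → N * count (λ μ → maps μ i y) S ≡ length S
    one-value i y = trans (sym (trans (total-const _ (allFin N)) (cong (_* count (λ μ → maps μ i y) S) (length-allFin N))))
      (trans (total-cong (allFin N) (λ w _ → same w))
        (trans (sym (count-fibres FinP._≟_ (λ _ → true) (λ μ → lookup μ i) S (allFin N) (Uniq.allFin⁺ N) (λ μ _ _ → ∈-allFin (lookup μ i))))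
          (sym (length-total S))))
      where
      same : ∀ w → count (λ μ → maps μ i y) S ≡ count (λ μ → maps μ i w) S
      same w = trans (count-cong S (λ μ _ → sym (maps-moved μ i y w)))
        (left-total perms (transposition y w) (transposition-involutive y w) (λ μ → indicator (maps μ i w)))

    -- For distinct i and j the exact number is `length S` / (N (N - 1)). Moving the value y to any
    -- of the N - 1 values w other than y' keeps the event at j, so (N - 1) * H ≤ K; the factor 2
    -- compares N - 1 with N.
    two-values : ∀ i j y y' → y ≢ y' → 2 ≤ N →
      N * N * count (λ μ → maps μ j y' ∧ maps μ i y) S ≤ 2 * length S
    two-values i j y y' y≢y' 2≤N = +-cancelˡ-≤ (N * N * H) _ _ (begin
        N * N * H + N * N * H ≡⟨ double N H ⟩
        2 * (N * (N * H)) ≤⟨ *-monoʳ-≤ 2 (*-monoʳ-≤ N most) ⟩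
        2 * (N * (H + K)) ≡⟨ regroup N H K ⟩
        2 * N * H + 2 * (N * K) ≤⟨ +-mono-≤ (*-monoˡ-≤ H (*-monoˡ-≤ N 2≤N)) (≤-reflexive (cong (2 *_) (one-value j y'))) ⟩
        N * N * H + 2 * length S ∎)
      where
      open ≤-Reasoning
      double : ∀ N H → N * N * H + N * N * H ≡ 2 * (N * (N * H))
      double = solve-∀
      regroup : ∀ N H K → 2 * (N * (H + K)) ≡ 2 * N * H + 2 * (N * K)
      regroup = solve-∀
      H K : ℕ
      H = count (λ μ → maps μ j y' ∧ maps μ i y) S
      K = count (λ μ → maps μ j y') S
      pointwise : ∀ w → H ≤ H * indicator (does (y' FinP.≟ w)) + count (λ μ → maps μ j y' ∧ maps μ i w) S
      pointwise w with y' FinP.≟ w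
      ... | yes refl = ≤-trans (≤-reflexive (sym (*-identityʳ H))) (m≤m+n _ _)
      ... | no y'≢w = ≤-trans (≤-reflexive (trans (count-cong S (λ μ _ → sym (cong₂ _∧_
              (maps-transposed μ j y w y' (transpose-other y w y' (λ e → y≢y' (sym e)) y'≢w)) (maps-moved μ i y w))))
              (left-total perms (transposition y w) (transposition-involutive y w)
                (λ μ → indicator (maps μ j y' ∧ maps μ i w))))) (m≤n+m _ (H * 0))
      most : N * H ≤ H + K
      most = begin
        N * H ≡⟨ sym (trans (total-const H (allFin N)) (cong (_* H) (length-allFin N))) ⟩
        total (λ _ → H) (allFin N) ≤⟨ total-mono (allFin N) (λ w _ → pointwise w) ⟩
        total (λ w → H * indicator (does (y' FinP.≟ w)) + count (λ μ → maps μ j y' ∧ maps μ i w) S) (allFin N)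
          ≡⟨ total-+ (λ w → H * indicator (does (y' FinP.≟ w))) (λ w → count (λ μ → maps μ j y' ∧ maps μ i w) S) (allFin N) ⟩
        total (λ w → H * indicator (does (y' FinP.≟ w))) (allFin N) + total (λ w → count (λ μ → maps μ j y' ∧ maps μ i w) S) (allFin N)
          ≡⟨ cong₂ _+_ (trans (total-* H (λ w → indicator (does (y' FinP.≟ w))) (allFin N))
               (trans (cong (H *_) (count-one FinP._≟_ y' (allFin N) (Uniq.allFin⁺ N) (∈-allFin y'))) (*-identityʳ H)))
               (sym (count-fibres FinP._≟_ (λ μ → maps μ j y') (λ μ → lookup μ i) S (allFin N) (Uniq.allFin⁺ N) (λ μ _ _ → ∈-allFin (lookup μ i)))) ⟩
        H + K ∎

  -- `twoCycled` counts the points on cycles of length 2, not the cycles: sums over points are easy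
  -- to average, and the double counting only affects constants.
  fixedPoints twoCycled : Tab N → ℕ
  fixedPoints μ = count (λ i → maps μ i i) (allFin N)
  twoCycled μ = count (λ i → maps μ (lookup μ i) i ∧ not (maps μ i i)) (allFin N)

  module _ {S : List (Tab N)} (perms : Perms S) (2≤N : 2 ≤ N) where

    instance
      N≢0 : Data.Nat.NonZero N
      N≢0 = Data.Nat.>-nonZero (≤-trans (s≤s z≤n) 2≤N)

    double-sum : ∀ (H : Fin N → Fin N → ℕ) c → (∀ i j → N * N * H i j ≤ c + indicator (does (i FinP.≟ j)) * (N * length S)) →
      total (λ i → total (H i) (allFin N)) (allFin N) ≤ c + length S
    double-sum H c h = *-cancelˡ-≤ (N * N) {{Data.Nat.Properties.m*n≢0 N N}} (begin
        N * N * total (λ i → total (H i) F) F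
          ≡⟨ sym (trans (total-cong F (λ i _ → total-* (N * N) (H i) F)) (total-* (N * N) (λ i → total (H i) F) F)) ⟩
        total (λ i → total (λ j → N * N * H i j) F) F
          ≤⟨ total-mono F (λ i _ → total-mono F (λ j _ → h i j)) ⟩
        total (λ i → total (λ j → c + indicator (does (i FinP.≟ j)) * M) F) F
          ≡⟨ total-cong F (λ i _ → row i) ⟩
        total (λ _ → N * c + M) F
          ≡⟨ trans (total-const _ F) (cong (_* (N * c + M)) (length-allFin N)) ⟩
        N * (N * c + M) ≡⟨ regroup N c (length S) ⟩
        N * N * (c + length S) ∎)
      where
      open ≤-Reasoning
      F = allFin N
      M = N * length S
      regroup : ∀ N c l → N * (N * c + N * l) ≡ N * N * (c + l)
      regroup = solve-∀
      row : ∀ i → total (λ j → c + indicator (does (i FinP.≟ j)) * M) F ≡ N * c + M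
      row i = trans (total-+ (λ _ → c) (λ j → indicator (does (i FinP.≟ j)) * M) F) (cong₂ _+_
        (trans (total-const c F) (cong (_* c) (length-allFin N)))
        (trans (total-cong F (λ j _ → *-comm (indicator (does (i FinP.≟ j))) M))
          (trans (total-* M (λ j → indicator (does (i FinP.≟ j))) F)
            (trans (cong (M *_) (count-one FinP._≟_ i F (Uniq.allFin⁺ N) (∈-allFin i))) (*-identityʳ M)))))

    -- A second moment, as the squared excess and `quadratic` both contain the square of the number
    -- of cycles of length 1. The N diagonal pairs contribute 1 on average, all others together at
    -- most 2.
    fixedPoints-moment : total (λ μ → fixedPoints μ * fixedPoints μ) S ≤ 3 * length S
    fixedPoints-moment = ≤-trans (≤-reflexive expand) (≤-trans (double-sum H (2 * length S) bound)
        (≤-reflexive (+-comm (2 * length S) (length S))))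
      where
      F = allFin N
      H : Fin N → Fin N → ℕ
      H i j = count (λ μ → maps μ j j ∧ maps μ i i) S
      square : ∀ (f : Fin N → ℕ) → total f F * total f F ≡ total (λ i → total (λ j → f j * f i) F) F
      square f = trans (sym (total-* (total f F) f F)) (total-cong F (λ i _ →
        trans (*-comm (total f F) (f i)) (trans (sym (total-* (f i) f F)) (total-cong F (λ j _ → *-comm (f i) (f j))))))
      expand : total (λ μ → fixedPoints μ * fixedPoints μ) S ≡ total (λ i → total (H i) F) F
      expand = trans (total-cong S (λ μ _ → trans (square (λ i → indicator (maps μ i i)))
          (total-cong F (λ i _ → total-cong F (λ j _ → indicator-∧ (maps μ j j) (maps μ i i))))))
        (trans (total-swap (λ μ i → total (λ j → indicator (maps μ j j ∧ maps μ i i)) F) S F)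
          (total-cong F (λ i _ → total-swap (λ μ j → indicator (maps μ j j ∧ maps μ i i)) S F)))
      bound : ∀ i j → N * N * H i j ≤ 2 * length S + indicator (does (i FinP.≟ j)) * (N * length S)
      bound i j with i FinP.≟ j
      ... | no i≢j = ≤-trans (two-values perms i j i j i≢j 2≤N) (m≤m+n _ 0)
      ... | yes refl = ≤-trans (≤-reflexive (trans (*-assoc N N _) (cong (N *_)
              (trans (cong (N *_) (count-cong S (λ μ _ → BoolP.∧-idem (maps μ i i)))) (one-value perms i i)))))
              (≤-trans (≤-reflexive (sym (+-identityʳ _))) (m≤n+m _ (2 * length S)))

    twoCycled-moment : total twoCycled S ≤ 3 * length S
    twoCycled-moment = ≤-trans (≤-reflexive expand) (≤-trans (double-sum H (2 * length S) bound)
        (≤-reflexive (+-comm (2 * length S) (length S))))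
      where
      F = allFin N
      H : Fin N → Fin N → ℕ
      H i w = count (λ μ → (maps μ (lookup μ i) i ∧ not (maps μ i i)) ∧ maps μ i w) S
      expand : total twoCycled S ≡ total (λ i → total (H i) F) F
      expand = trans (total-swap (λ μ i → indicator (maps μ (lookup μ i) i ∧ not (maps μ i i))) S F)
        (total-cong F (λ i _ → count-fibres FinP._≟_ (λ μ → maps μ (lookup μ i) i ∧ not (maps μ i i)) (λ μ → lookup μ i) S F
          (Uniq.allFin⁺ N) (λ μ _ _ → ∈-allFin (lookup μ i))))
      indicator-≤ : ∀ a b → (a ≡ true → b ≡ true) → indicator a ≤ indicator b
      indicator-≤ false b h = z≤n
      indicator-≤ true b h rewrite h refl = ≤-refl
      bound : ∀ i w → N * N * H i w ≤ 2 * length S + indicator (does (i FinP.≟ w)) * (N * length S)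
      bound i w with i FinP.≟ w
      ... | yes refl = ≤-trans (≤-reflexive (trans (cong (N * N *_) (count-none S none)) (*-zeroʳ (N * N)))) z≤n
        where
        none : ∀ μ → μ ∈ S → (maps μ (lookup μ i) i ∧ not (maps μ i i)) ∧ maps μ i i ≡ false
        none μ _ with maps μ i i
        ... | true = cong (_∧ true) (BoolP.∧-zeroʳ (maps μ (lookup μ i) i))
        ... | false = BoolP.∧-zeroʳ _
      ... | no i≢w = ≤-trans (*-monoʳ-≤ (N * N) (total-mono S (λ μ _ → indicator-≤ _ _ (implies μ))))
              (≤-trans (two-values perms i w w i (λ e → i≢w (sym e)) 2≤N) (m≤m+n _ 0))
        where
        implies : ∀ μ → (maps μ (lookup μ i) i ∧ not (maps μ i i)) ∧ maps μ i w ≡ true → maps μ w i ∧ maps μ i w ≡ true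
        implies μ e with lookup μ i FinP.≟ w
        ... | yes refl with maps μ (lookup μ i) i | e
        ...   | true | _ = refl
        implies μ e | no _ with trans (sym e) (BoolP.∧-zeroʳ (maps μ (lookup μ i) i ∧ not (maps μ i i)))
        ... | ()

-- The distance between two initial permutations

Val-total : ∀ n {λs v} → sum λs ≡ 2 * n → Val (λ _ → true) n λs v → v ≡ oddFactorial n
Val-total zero s refl = refl
Val-total (suc n) {λs} s val with nonzero-part n λs s
... | r , ν , p , _ with val r ν p
...   | vs , pw , refl = trans (go pw (outcomes-sum n r ν s'))
          (cong (_* oddFactorial n) (length-outcomes n r ν s'))
  where
  s' = trans (sym (sum-↭ p)) s
  go : ∀ {os vs} → Pointwise (Val _ n) os vs → All (λ o → sum o ≡ 2 * n) os →
    sum vs ≡ length os * oddFactorial n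
  go [] [] = refl
  go (x ∷ pw) (q ∷ qs) = cong₂ _+_ (Val-total n q x) (go pw qs)

three-parts : ∀ λs → 3 * cnt pos λs ≤ sum λs + 2 * cnt is1 λs + cnt is2 λs
three-parts [] = z≤n
three-parts (e ∷ λs) = ≤-trans (≤-reflexive (*-distribˡ-+ 3 (pos e) _))
  (≤-trans (+-mono-≤ (part e) (three-parts λs))
    (≤-reflexive (identity e (is1 e) (is2 e) (sum λs) (cnt is1 λs) (cnt is2 λs))))
  where
  part : ∀ e → 3 * pos e ≤ e + 2 * is1 e + is2 e
  part 0 = z≤n
  part 1 = ≤-refl
  part 2 = ≤-refl
  part (suc (suc (suc e))) = ≤-trans (m≤m+n 3 e) (≤-reflexive (sym (trans (+-identityʳ _) (+-identityʳ _))))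
  identity : ∀ e a b s x y → (e + 2 * a + b) + (s + 2 * x + y) ≡ (e + s) + 2 * (a + x) + (b + y)
  identity = solve-∀

-- Without short cycles m ≤ N / 3, so 6 * Ψ m + N is at most 11 * N up to a constant, which is below
-- 24 * n = 12 * N. Short cycles contribute the terms with a and b, and 258 = 6 * 43 comes from
-- `Ψ≤`.
initial-excess : ∀ N n m a b → N ≡ 2 * n → 3 * m ≤ N + 2 * a + b → excess N n m ≤ 20 * a + 10 * b + 258
initial-excess N n m a b refl h = m≤n+o⇒m∸n≤o _ (24 * n) (begin
    6 * Ψ m + 2 * n ≤⟨ +-monoˡ-≤ (2 * n) (*-monoʳ-≤ 6 (Ψ≤ m)) ⟩
    6 * (5 * m + 43) + 2 * n ≡⟨ regroup m n ⟩
    10 * (3 * m) + 258 + 2 * n ≤⟨ +-monoˡ-≤ (2 * n) (+-monoˡ-≤ 258 (*-monoʳ-≤ 10 h)) ⟩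
    10 * (2 * n + 2 * a + b) + 258 + 2 * n ≤⟨ m≤m+n _ (2 * n) ⟩
    10 * (2 * n + 2 * a + b) + 258 + 2 * n + 2 * n ≡⟨ collect n a b ⟩
    24 * n + (20 * a + 10 * b + 258) ∎)
  where
  open ≤-Reasoning
  regroup : ∀ m n → 6 * (5 * m + 43) + 2 * n ≡ 10 * (3 * m) + 258 + 2 * n
  regroup = solve-∀
  collect : ∀ n a b → 10 * (2 * n + 2 * a + b) + 258 + 2 * n + 2 * n ≡ 24 * n + (20 * a + 10 * b + 258)
  collect = solve-∀

square-sum : ∀ a b → 2 * (a * b) ≤ a * a + b * b
square-sum a b with ≤-total a b
... | inj₁ a≤b with m≤n⇒∃[o]m+o≡n a≤b
...   | d , refl = ≤-trans (m≤m+n _ (d * d)) (≤-reflexive (identity a d))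
  where
  identity : ∀ a d → 2 * (a * (a + d)) + d * d ≡ a * a + (a + d) * (a + d)
  identity = solve-∀
square-sum a b | inj₂ b≤a with m≤n⇒∃[o]m+o≡n b≤a
...   | d , refl = ≤-trans (m≤m+n _ (d * d)) (≤-reflexive (identity b d))
  where
  identity : ∀ b d → 2 * ((b + d) * b) + d * d ≡ (b + d) * (b + d) + b * b
  identity = solve-∀

three-squares : ∀ c u v → (u + v + c) * (u + v + c) ≤ 3 * (u * u + v * v + c * c)
three-squares c u v = begin
    (u + v + c) * (u + v + c) ≡⟨ identity c u v ⟩
    u * u + v * v + c * c + (2 * (u * c) + 2 * (v * c) + 2 * (u * v))
      ≤⟨ +-monoʳ-≤ (u * u + v * v + c * c) (+-mono-≤ (+-mono-≤ (square-sum u c) (square-sum v c)) (square-sum u v)) ⟩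
    u * u + v * v + c * c + ((u * u + c * c) + (v * v + c * c) + (u * u + v * v)) ≡⟨ identity' (c * c) (u * u) (v * v) ⟩
    3 * (u * u + v * v + c * c) ∎
  where
  open ≤-Reasoning
  identity : ∀ c u v → (u + v + c) * (u + v + c) ≡ u * u + v * v + c * c + (2 * (u * c) + 2 * (v * c) + 2 * (u * v))
  identity = solve-∀
  identity' : ∀ c u v → u + v + c + ((u + c) + (v + c) + (u + v)) ≡ 3 * (u + v + c)
  identity' = solve-∀

-- The squared excess contains b * b, which is weakened to N * b. So the points on 2-cycles enter
-- linearly and only their mean is needed later. The constant rounds up 798768 + 100000, where
-- 798768 = 12 * 258 * 258.
initial-potential : ∀ N n m a b → 1 ≤ N → N ≡ 2 * n → 3 * m ≤ N + 2 * a + b → b ≤ N →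
  potential N n m + N * quadratic a b ≤ N * ((a * a + b + 1) * 900000)
initial-potential N n m a b 1≤N N≡2n h b≤N = begin
    potential N n m + q
      ≡⟨ cong (_+ q) (trans (potential-def N n m) (cong (λ t → 4 * (x * x) + t * 100000) (sym N≡2n))) ⟩
    4 * (x * x) + N * 100000 + q
      ≤⟨ +-monoˡ-≤ q (+-monoˡ-≤ (N * 100000) (*-monoʳ-≤ 4 (≤-trans (*-mono-≤ excess≤ excess≤) (three-squares 258 (20 * a) (10 * b))))) ⟩
    4 * (3 * (20 * a * (20 * a) + 10 * b * (10 * b) + 66564)) + N * 100000 + q
      ≡⟨ cong (λ t → t + N * 100000 + q) (expand (a * a) (b * b) a b refl refl) ⟩
    1 * (a * a) * 4800 + b * b * 1200 + 1 * 798768 + N * 100000 + q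
      ≤⟨ +-mono-≤ (+-monoˡ-≤ (N * 100000) (+-mono-≤ (+-mono-≤ (*-monoˡ-≤ 4800 (*-monoˡ-≤ (a * a) 1≤N))
           (*-monoˡ-≤ 1200 (*-monoʳ-≤ b b≤N))) (*-monoˡ-≤ 798768 1≤N)))
           (*-monoʳ-≤ N (*-monoʳ-≤ 24 (+-monoˡ-≤ (6 * b) (+-monoʳ-≤ (a * a) (*-monoʳ-≤ 9 (a≤a² a)))))) ⟩
    N * (a * a) * 4800 + b * N * 1200 + N * 798768 + N * 100000 + N * (24 * (a * a + 9 * (a * a) + 6 * b))
      ≤⟨ m≤m+n (N * (a * a) * 4800 + b * N * 1200 + N * 798768 + N * 100000 + N * (24 * (a * a + 9 * (a * a) + 6 * b))) (N * 1232 + N * (a * a) * 894960 + N * b * 898656) ⟩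
    N * (a * a) * 4800 + b * N * 1200 + N * 798768 + N * 100000 + N * (24 * (a * a + 9 * (a * a) + 6 * b))
      + (N * 1232 + N * (a * a) * 894960 + N * b * 898656)
      ≡⟨ collect N (a * a) b ⟩
    N * ((a * a + b + 1) * 900000) ∎
  where
  open ≤-Reasoning
  x q : ℕ
  x = excess N n m
  q = N * quadratic a b
  excess≤ : x ≤ 20 * a + 10 * b + 258
  excess≤ = initial-excess N n m a b N≡2n h
  a≤a² : ∀ a → a ≤ a * a
  a≤a² zero = z≤n
  a≤a² (suc a) = m≤m*n (suc a) (suc a)
  expand : ∀ s t a b → s ≡ a * a → t ≡ b * b → 4 * (3 * (20 * a * (20 * a) + 10 * b * (10 * b) + 66564))
    ≡ 1 * s * 4800 + t * 1200 + 1 * 798768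
  expand s t a b refl refl = identity a b
    where
    identity : ∀ a b → 4 * (3 * (20 * a * (20 * a) + 10 * b * (10 * b) + 66564))
      ≡ 1 * (a * a) * 4800 + b * b * 1200 + 1 * 798768
    identity = solve-∀
  collect : ∀ N s b → N * s * 4800 + b * N * 1200 + N * 798768 + N * 100000 + N * (24 * (s + 9 * s + 6 * b))
    + (N * 1232 + N * s * 894960 + N * b * 898656) ≡ N * ((s + b + 1) * 900000)
  collect = solve-∀

abstract
  scale : ℕ
  scale = 900000

  scale-def : scale ≡ 900000
  scale-def = refl

  scale-positive : 0 < scale
  scale-positive = s≤s z≤n

count-true : ∀ {A : Set} (xs : List A) → count (λ _ → true) xs ≡ length xs
count-true xs = sym (length-total xs)

module _ {N : ℕ} where

  lengths : List (List (Fin N)) → List ℕ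
  lengths = map (count (λ _ → true))

  cnt-lengths : ∀ f cs → cnt f (lengths cs) ≡ total (λ c → f (length c)) cs
  cnt-lengths f cs = trans (total-map f (count (λ _ → true)) cs) (total-cong cs (λ c _ → cong f (count-true c)))

  lengths-sum : ∀ {σ cs} → CycleList σ cs → sum (lengths cs) ≡ N
  lengths-sum {cs = cs} cl = trans (total-live (λ _ → true) cl)
    (trans (count-true (allFin N)) (length-allFin N))

  cycles-nonempty : ∀ {σ : Fin N → Fin N} {cs} → All (Cycle σ) cs → cnt is0 (lengths cs) ≡ 0
  cycles-nonempty [] = refl
  cycles-nonempty {cs = (x ∷ xs) ∷ cs} (_ ∷ cyc) = cycles-nonempty cyc

  no-small : ∀ {cs : List (List (Fin N))} → (∀ c → c ∈ cs → 3 ≤ length c) →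
    cnt is1 (lengths cs) ≡ 0 × cnt is2 (lengths cs) ≡ 0
  no-small {cs} h = trans (cnt-lengths is1 cs) (vanish is1 (λ { (s≤s (s≤s (s≤s _))) → refl }) ) ,
    trans (cnt-lengths is2 cs) (vanish is2 (λ { (s≤s (s≤s (s≤s _))) → refl }))
    where
    vanish : ∀ f → (∀ {k} → 3 ≤ k → f k ≡ 0) → total (λ c → f (length c)) cs ≡ 0
    vanish f e = trans (total-cong cs (λ c c∈ → e (h c c∈))) (trans (total-const 0 cs) (*-zeroʳ (length cs)))

  ones-fixed : ∀ (μ : Tab N) {cs} → CycleList (lookup μ) cs → cnt is1 (lengths cs) ≤ fixedPoints μ
  ones-fixed μ {cs} cl = ≤-trans (≤-reflexive (cnt-lengths is1 cs))
    (≤-trans (total-mono cs (λ c c∈ → each c (All.lookup (proper-cycles μ cl) c∈)))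
      (≤-reflexive (trans (sym (total-concat _ cs)) (total-↭ _ (cover cl)))))
    where
    each : ∀ c → ProperCycle μ c → is1 (length c) ≤ count (λ i → maps μ i i) c
    each [] _ = z≤n
    each (x ∷ []) (e , _) rewrite dec-true (lookup μ x FinP.≟ x) e = ≤-refl
    each (x ∷ y ∷ c) _ = z≤n

  twos-cycled : ∀ (μ : Tab N) {cs} → CycleList (lookup μ) cs → cnt is2 (lengths cs) ≤ twoCycled μ
  twos-cycled μ {cs} cl = ≤-trans (≤-reflexive (cnt-lengths is2 cs))
    (≤-trans (total-mono cs (λ c c∈ → each c (All.lookup (proper-cycles μ cl) c∈)))
      (≤-reflexive (trans (sym (total-concat _ cs)) (total-↭ _ (cover cl)))))
    where
    each : ∀ c → ProperCycle μ c → is2 (length c) ≤ count (λ i → maps μ (lookup μ i) i ∧ not (maps μ i i)) c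
    each [] _ = z≤n
    each (x ∷ []) _ = z≤n
    each (x ∷ y ∷ []) ((e , e') , ((x≢y ∷ _) ∷ _) , _)
      rewrite e | dec-true (lookup μ y FinP.≟ x) e' | dec-false (y FinP.≟ x) (λ e → x≢y (sym e)) = s≤s z≤n
    each (x ∷ y ∷ z ∷ c) _ = z≤n

  evenF-lengths : ∀ {f g : Fin N → Fin N} {cs ds : List (List (Fin N))} →
    evenF f ≡ not (parity (N + length cs)) → evenF g ≡ not (parity (N + length ds)) → evenF f ≡ evenF g →
    parity (length (lengths cs)) ≡ parity (length (lengths ds))
  evenF-lengths {cs = cs} {ds} e e' same = trans (cong parity (ListP.length-map _ cs))
    (trans (parity-cancel N (not-injective (trans (sym e) (trans same e'))))
      (cong parity (sym (ListP.length-map _ ds))))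

  gluings : (ℕ → Bool) → List (Tab N) → Tab N → ℕ
  gluings A L α = count (hits A α) L

  gluings-Val : ∀ {L} → Matchings L → ∀ A n → N ≡ 2 * n → ∀ (α : Tab N) {cs} → CycleList (lookup α) cs →
    Val A n (lengths cs) (gluings A L α)
  gluings-Val {L} ML A n N≡2n α {cs} cl = subst (Val A n (lengths cs))
    (count-cong L (λ β _ → cong (_∧ hits A α β) (dec-true (agree? (λ x → x) (λ _ → true) β) (λ x ()))))
    (gluing L A α n ML start cl (trans (count-true (allFin N)) (trans (length-allFin N) N≡2n)))
    where
    start : Partial (λ x → x) (λ _ → true)
    start = record { involutive = λ x → refl ; fixed = λ x _ → refl ; moved = λ x () }

  -- The process run with the property that always holds counts all matchings, and then each of its
  -- 2n + 1 outcomes counts in full.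
  matchings-count : ∀ {L} → Matchings L → ∀ n → N ≡ 2 * n → length L ≡ oddFactorial n
  matchings-count {L} ML n N≡2n with cycles-exist (λ (x : Fin N) → x) (λ e → e)
  ... | cs , cl , _ = trans (sym (count-true L)) (Val-total n (trans (lengths-sum cl) N≡2n)
        (gluings-Val ML (λ _ → true) n N≡2n (Vec.tabulate (λ x → x)) (cycleList-cong (VecP.lookup∘tabulate (λ x → x)) cl)))

  -- All cycles of α have at least 3 sides, so its weight `ρ` vanishes and every error from small
  -- cycles is due to μ. One of the two factors N is cancelled against the factor N in
  -- `initial-potential`.
  pair-bound : ∀ {L} → Matchings L → ∀ A n → 1 ≤ N → N ≡ 2 * n → ∀ (α μ : Tab N) {cs} →
    CycleList (lookup α) cs → (∀ c → c ∈ cs → 3 ≤ length c) → evenF (lookup α) ≡ not (parity (N + length cs)) →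
    Injective (lookup μ) → evenF (lookup α) ≡ evenF (lookup μ) →
    N * ∣ gluings A L α - gluings A L μ ∣ ≤ (fixedPoints μ * fixedPoints μ + twoCycled μ + 1) * scale * length L
  pair-bound {L} ML A n 1≤N N≡2n α μ {cs} cl large even-α inj same with cycles-exist (lookup μ) inj
  ... | ds , dl , even-μ = *-cancelˡ-≤ N {{Data.Nat.>-nonZero 1≤N}} (begin
      N * (N * D) ≡⟨ sym (*-assoc N N D) ⟩
      N * N * D
        ≤⟨ coupling-bound N A n (gluings-Val ML A n N≡2n α cl) (gluings-Val ML A n N≡2n μ dl)
             (trans (lengths-sum cl) N≡2n) (trans (lengths-sum dl) N≡2n)
             (trans (cycles-nonempty (cycles cl)) (sym (cycles-nonempty (cycles dl))))
             (evenF-lengths {f = lookup α} {g = lookup μ} {cs = cs} {ds} even-α even-μ same) ⟩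
      (potential N n m + N * (ρ (lengths cs) + ρ (lengths ds))) * oddFactorial n
        ≡⟨ cong₂ (λ r q → (potential N n m + N * (r + ρ (lengths ds))) * q)
             (cong₂ quadratic (proj₁ (no-small large)) (proj₂ (no-small large))) (sym (matchings-count ML n N≡2n)) ⟩
      (potential N n m + N * ρ (lengths ds)) * length L
        ≤⟨ *-monoˡ-≤ (length L) (+-monoʳ-≤ (potential N n m) (*-monoʳ-≤ N (quadratic-mono a≤ b≤))) ⟩
      (potential N n m + N * quadratic a b) * length L
        ≤⟨ *-monoˡ-≤ (length L) (≤-trans (initial-potential N n m a b 1≤N N≡2n m≤ b≤N)
             (≤-reflexive (cong (λ c → N * ((a * a + b + 1) * c)) (sym scale-def)))) ⟩
      N * ((a * a + b + 1) * scale) * length L ≡⟨ *-assoc N _ (length L) ⟩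
      N * ((a * a + b + 1) * scale * length L) ∎)
    where
    open ≤-Reasoning
    D = ∣ gluings A L α - gluings A L μ ∣
    m a b : ℕ
    m = cnt pos (lengths cs) ⊔ cnt pos (lengths ds)
    a = fixedPoints μ
    b = twoCycled μ
    a≤ = ones-fixed μ dl
    b≤ = twos-cycled μ dl
    b≤N : b ≤ N
    b≤N = ≤-trans (total-mono (allFin N) (λ i _ → indicator≤1 (maps μ (lookup μ i) i ∧ not (maps μ i i))))
      (≤-reflexive (trans (sym (length-total (allFin N))) (length-allFin N)))
      where
      indicator≤1 : ∀ b → indicator b ≤ 1
      indicator≤1 true = ≤-refl
      indicator≤1 false = z≤n
    parts-α : 3 * cnt pos (lengths cs) ≤ N
    parts-α = ≤-trans (three-parts (lengths cs)) (≤-reflexive (trans (cong₂ (λ x y → sum (lengths cs) + 2 * x + y)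
      (proj₁ (no-small large)) (proj₂ (no-small large))) (trans (+-identityʳ _) (trans (+-identityʳ _) (lengths-sum cl)))))
    parts-μ : 3 * cnt pos (lengths ds) ≤ N + 2 * a + b
    parts-μ = ≤-trans (three-parts (lengths ds)) (+-mono-≤ (+-mono-≤ (≤-reflexive (lengths-sum dl)) (*-monoʳ-≤ 2 a≤)) b≤)
    m≤ : 3 * m ≤ N + 2 * a + b
    m≤ with ≤-total (cnt pos (lengths cs)) (cnt pos (lengths ds))
    ... | inj₁ le rewrite m≤n⇒m⊔n≡n le = parts-μ
    ... | inj₂ ge rewrite m≥n⇒m⊔n≡m ge = ≤-trans parts-α (≤-trans (m≤m+n N (2 * a)) (m≤m+n _ b))

-- Comparison with the uniform distribution on a parity class

dist-total : ∀ {A : Set} (f g : A → ℕ) xs → ∣ total f xs - total g xs ∣ ≤ total (λ x → ∣ f x - g x ∣) xs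
dist-total f g [] = z≤n
dist-total f g (x ∷ xs) = ≤-trans (dist-+ (f x) (total f xs) (g x) (total g xs)) (+-monoʳ-≤ _ (dist-total f g xs))

-- With `true` for even, this is the parity of a product; it also tests membership in a parity
-- class.
same : Bool → Bool → Bool
same ε e = not (ε xor e)

same-shift : ∀ ε b e → same (same ε b) (same e b) ≡ same ε e
same-shift true true true = refl
same-shift true true false = refl
same-shift true false true = refl
same-shift true false false = refl
same-shift false true true = refl
same-shift false true false = refl
same-shift false false true = refl
same-shift false false false = refl

same-sound : ∀ {ε e} → same ε e ≡ true → ε ≡ e
same-sound {true} {true} _ = refl
same-sound {false} {false} _ = refl

module _ {N : ℕ} {S : List (Tab N)} (perms : Perms S) (ev : Tab N → Bool)
  (ev-∘ : ∀ μ β → Injective (lookup μ) → Injective (lookup β) → ev (compose μ β) ≡ same (ev μ) (ev β)) where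

  -- Right multiplication by the odd involution s exchanges the even and the odd permutations.
  class-halves : ∀ s → (∀ x → lookup s (lookup s x) ≡ x) → ev s ≡ false → ∀ ε →
    2 * count (λ μ → same ε (ev μ)) S ≡ length S
  class-halves s inv odd ε = begin
      2 * E ε ≡⟨ cong (E ε +_) (+-identityʳ (E ε)) ⟩
      E ε + E ε ≡⟨ cong (E ε +_) flip ⟩
      E ε + E (not ε) ≡⟨ sym (total-+ (λ μ → indicator (same ε (ev μ))) (λ μ → indicator (same (not ε) (ev μ))) S) ⟩
      total (λ μ → indicator (same ε (ev μ)) + indicator (same (not ε) (ev μ))) S
        ≡⟨ total-cong S (λ μ _ → complementary ε (ev μ)) ⟩
      total (λ _ → 1) S ≡⟨ sym (length-total S) ⟩
      length S ∎
    where
    open ≡-Reasoning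
    E : Bool → ℕ
    E ε = count (λ μ → same ε (ev μ)) S
    complementary : ∀ ε e → indicator (same ε e) + indicator (same (not ε) e) ≡ 1
    complementary true true = refl
    complementary true false = refl
    complementary false true = refl
    complementary false false = refl
    odd-shift : ∀ ε e → same ε (same e false) ≡ same (not ε) e
    odd-shift true true = refl
    odd-shift true false = refl
    odd-shift false true = refl
    odd-shift false false = refl
    flip : E ε ≡ E (not ε)
    flip = trans (sym (right-total perms s inv (λ μ → indicator (same ε (ev μ)))))
      (count-cong S (λ μ μ∈ → trans (cong (same ε) (trans (ev-∘ μ s (proj₁ (proj₂ perms) μ μ∈) (involution-injective inv)) (cong (same (ev μ)) odd)))
        (odd-shift ε (ev μ))))

  module _ {L : List (Tab N)} (ML : Matchings L) (b : Bool) (ev-L : ∀ β → β ∈ L → ev β ≡ b) (A : ℕ → Bool) where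

    target : Bool → ℕ
    target ε = count (λ γ → same ε (ev γ) ∧ A (numCycles γ)) S

    -- Multiplying by a fixed β permutes the symmetric group, so the average of the
    -- gluing counts over a parity class is exactly uniform on the product class.
    class-average : ∀ ε → total (λ μ → indicator (same ε (ev μ)) * gluings A L μ) S ≡ target (same ε b) * length L
    class-average ε = begin
        total (λ μ → indicator (same ε (ev μ)) * gluings A L μ) S
          ≡⟨ total-cong S (λ μ _ → trans (sym (total-* (indicator (same ε (ev μ))) (λ β → indicator (hits A μ β)) L))
               (total-cong L (λ β _ → indicator-∧ (same ε (ev μ)) (hits A μ β)))) ⟩
        total (λ μ → total (λ β → indicator (same ε (ev μ) ∧ hits A μ β)) L) S
          ≡⟨ total-swap (λ μ β → indicator (same ε (ev μ) ∧ hits A μ β)) S L ⟩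
        total (λ β → count (λ μ → same ε (ev μ) ∧ hits A μ β) S) L
          ≡⟨ total-cong L each ⟩
        total (λ _ → target (same ε b)) L ≡⟨ total-const (target (same ε b)) L ⟩
        length L * target (same ε b) ≡⟨ *-comm (length L) _ ⟩
        target (same ε b) * length L ∎
      where
      open ≡-Reasoning
      each : ∀ β → β ∈ L → count (λ μ → same ε (ev μ) ∧ hits A μ β) S ≡ target (same ε b)
      each β β∈ = trans (count-cong S (λ μ μ∈ → cong (_∧ hits A μ β) (trans (sym (same-shift ε b (ev μ)))
          (cong (same (same ε b)) (sym (trans (ev-∘ μ β (proj₁ (proj₂ perms) μ μ∈) (matching-injective (proj₁ (proj₂ ML) β β∈)))
            (cong (same (ev μ)) (ev-L β β∈))))))))
        (right-total perms β (proj₁ (proj₁ (proj₂ ML) β β∈)) (λ γ → indicator (same (same ε b) (ev γ) ∧ A (numCycles γ))))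

    -- Here α is fixed and only μ is averaged, over the parity class of α. In 14 = 2 * 7, the 7 = 3
    -- + 3 + 1 bounds the mean weight over all permutations, and the 2 is the price of restricting
    -- to one of the two classes of equal size.
    one-distribution : ∀ n → 2 ≤ N → N ≡ 2 * n → (∀ σ → ev σ ≡ evenF (lookup σ)) →
      ∀ s → (∀ x → lookup s (lookup s x) ≡ x) → ev s ≡ false → ∀ ε α {cs} → ev α ≡ ε →
      CycleList (lookup α) cs → (∀ c → c ∈ cs → 3 ≤ length c) → evenF (lookup α) ≡ not (parity (N + length cs)) →
      let E = count (λ μ → same (same ε b) (ev μ)) S in
      N * ∣ gluings A L α * E - target (same ε b) * length L ∣ ≤ 14 * scale * (E * length L)
    one-distribution n 2≤N N≡2n ev-evenF s inv odd ε α {cs} evα cl large even-α = begin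
        N * ∣ g α * E' - target (same ε b) * length L ∣
          ≡⟨ cong₂ (λ x y → N * ∣ x - y ∣) spread-α (sym (class-average ε)) ⟩
        N * ∣ total (λ μ → i μ * g α) S - total (λ μ → i μ * g μ) S ∣
          ≤⟨ *-monoʳ-≤ N (dist-total (λ μ → i μ * g α) (λ μ → i μ * g μ) S) ⟩
        N * total (λ μ → ∣ i μ * g α - i μ * g μ ∣) S
          ≡⟨ sym (total-* N (λ μ → ∣ i μ * g α - i μ * g μ ∣) S) ⟩
        total (λ μ → N * ∣ i μ * g α - i μ * g μ ∣) S ≤⟨ total-mono S each ⟩
        total (λ μ → K * w μ) S ≡⟨ total-* K w S ⟩
        K * total w S ≤⟨ *-monoʳ-≤ K weights ⟩
        K * (7 * length S) ≡⟨ cong (λ t → K * (7 * t)) (sym (class-halves s inv odd (same ε b))) ⟩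
        scale * length L * (7 * (2 * E')) ≡⟨ regroup scale (length L) E' ⟩
        14 * scale * (E' * length L) ∎
      where
      open ≤-Reasoning
      g i w : Tab N → ℕ
      g = gluings A L
      i μ = indicator (same ε (ev μ))
      w μ = fixedPoints μ * fixedPoints μ + twoCycled μ + 1
      K E' : ℕ
      K = scale * length L
      E' = count (λ μ → same (same ε b) (ev μ)) S
      regroup : ∀ c l e → c * l * (7 * (2 * e)) ≡ 14 * c * (e * l)
      regroup = solve-∀
      equal-classes : E' ≡ total i S
      equal-classes = *-cancelˡ-≡ _ _ 2 (trans (class-halves s inv odd (same ε b)) (sym (class-halves s inv odd ε)))
      spread-α : g α * E' ≡ total (λ μ → i μ * g α) S
      spread-α = trans (cong (g α *_) equal-classes) (trans (sym (total-* (g α) i S))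
        (total-cong S (λ μ _ → *-comm (g α) (i μ))))
      weights : total w S ≤ 7 * length S
      weights = begin
          total w S ≡⟨ trans (total-+ (λ μ → fixedPoints μ * fixedPoints μ + twoCycled μ) (λ _ → 1) S)
            (cong₂ _+_ (total-+ (λ μ → fixedPoints μ * fixedPoints μ) twoCycled S) (sym (length-total S))) ⟩
          total (λ μ → fixedPoints μ * fixedPoints μ) S + total twoCycled S + length S
            ≤⟨ +-monoˡ-≤ (length S) (+-mono-≤ (fixedPoints-moment perms 2≤N) (twoCycled-moment perms 2≤N)) ⟩
          3 * length S + 3 * length S + length S ≡⟨ seven (length S) ⟩
          7 * length S ∎
        where
        seven : ∀ l → 3 * l + 3 * l + l ≡ 7 * l
        seven = solve-∀
      each : ∀ μ → μ ∈ S → N * ∣ i μ * g α - i μ * g μ ∣ ≤ K * w μ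
      each μ μ∈ with same ε (ev μ) in eq
      ... | false = ≤-trans (≤-reflexive (*-zeroʳ N)) z≤n
      ... | true = ≤-trans (≤-reflexive (cong₂ (λ x y → N * ∣ x - y ∣) (+-identityʳ (g α)) (+-identityʳ (g μ))))
              (≤-trans (pair-bound ML A n (≤-trans (s≤s z≤n) 2≤N) N≡2n α μ cl large even-α (proj₁ (proj₂ perms) μ μ∈)
                (trans (sym (ev-evenF α)) (trans evα (trans (same-sound eq) (ev-evenF μ)))))
                (≤-reflexive (trans (*-assoc (w μ) scale (length L)) (*-comm (w μ) K))))

    all-distributions : ∀ n → 2 ≤ N → N ≡ 2 * n → (∀ σ → ev σ ≡ evenF (lookup σ)) →
      ∀ s → (∀ x → lookup s (lookup s x) ≡ x) → ev s ≡ false → ∀ ε Cs →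
      (∀ α → α ∈ Cs → ev α ≡ ε × ∃[ cs ] (CycleList (lookup α) cs × (∀ c → c ∈ cs → 3 ≤ length c) ×
        evenF (lookup α) ≡ not (parity (N + length cs)))) →
      TVBound (14 * scale) N (total (gluings A L) Cs) (length Cs * length L)
        (target (same ε b)) (count (λ μ → same (same ε b) (ev μ)) S)
    all-distributions n 2≤N N≡2n ev-evenF s inv odd ε Cs h = begin
        N * ∣ total g Cs * E - t * (length Cs * length L) ∣
          ≡⟨ cong₂ (λ x y → N * ∣ x - y ∣) left right ⟩
        N * ∣ total (λ α → g α * E) Cs - total (λ _ → t * length L) Cs ∣
          ≤⟨ *-monoʳ-≤ N (dist-total (λ α → g α * E) (λ _ → t * length L) Cs) ⟩
        N * total (λ α → ∣ g α * E - t * length L ∣) Cs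
          ≡⟨ sym (total-* N (λ α → ∣ g α * E - t * length L ∣) Cs) ⟩
        total (λ α → N * ∣ g α * E - t * length L ∣) Cs
          ≤⟨ total-mono Cs (λ α α∈ → let (e , cs , cl , large , ev-cs) = h α α∈ in
               one-distribution n 2≤N N≡2n ev-evenF s inv odd ε α e cl large ev-cs) ⟩
        total (λ _ → 14 * scale * (E * length L)) Cs ≡⟨ total-const (14 * scale * (E * length L)) Cs ⟩
        length Cs * (14 * scale * (E * length L)) ≡⟨ regroup (length Cs) (14 * scale) E (length L) ⟩
        14 * scale * (length Cs * length L * E) ∎
      where
      open ≤-Reasoning
      g : Tab N → ℕ
      g = gluings A L
      t E : ℕ
      t = target (same ε b)
      E = count (λ μ → same (same ε b) (ev μ)) S
      regroup : ∀ k c e l → k * (c * (e * l)) ≡ c * (k * l * e)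
      regroup = solve-∀
      left : total g Cs * E ≡ total (λ α → g α * E) Cs
      left = trans (*-comm (total g Cs) E) (trans (sym (total-* E g Cs)) (total-cong Cs (λ α _ → *-comm E (g α))))
      right : t * (length Cs * length L) ≡ total (λ _ → t * length L) Cs
      right = trans (commute t (length Cs) (length L)) (sym (total-const (t * length L) Cs))
        where
        commute : ∀ t k l → t * (k * l) ≡ k * (t * l)
        commute = solve-∀

-- Specialisation to the two conjugacy classes

TVBound-cong : ∀ {C N a a' b c c' d d'} → a ≡ a' → c ≡ c' → d ≡ d' →
  TVBound C N a' b c' d' → TVBound C N a b c d
TVBound-cong refl refl refl h = h

module _ {N : ℕ} where

  SymN-perms : Perms (SymN N)
  SymN-perms = SymN-unique , ∈-SymN , SymN-∈

  C2-matchings : Matchings (C2 N)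
  C2-matchings = C2-unique , C2-matching , matching-C2

  isEven-∘ : ∀ (μ β : Tab N) → Injective (lookup μ) → Injective (lookup β) →
    isEven (compose μ β) ≡ same (isEven μ) (isEven β)
  isEven-∘ μ β i j = trans (isEven-evenF (compose μ β)) (trans (evenF-cong (lookup-compose μ β))
    (trans (evenF-∘ (lookup β) j (lookup μ) i) (sym (cong₂ same (isEven-evenF μ) (isEven-evenF β)))))

  Prescribed : (ℕ → ℕ) → Tab N → Set
  Prescribed k σ = T (and (map (λ j → cyclesOfLen σ j ≡ᵇ k j) (upTo (suc N))))

  prescribed-length : ∀ k (σ : Tab N) {cs} → CycleList (lookup σ) cs → Prescribed k σ →
    length cs ≡ total k (upTo (suc N))
  prescribed-length k σ {cs} cl t = trans (length-total cs)
    (trans (count-fibres Data.Nat.Properties._≟_ (λ _ → true) length cs (upTo (suc N)) (Uniq.upTo⁺ (suc N))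
        (λ c c∈ _ → ∈-upTo⁺ (s≤s (proj₂ (proj₂ (All.lookup (proper-cycles σ cl) c∈))))))
      (total-cong (upTo (suc N)) (λ j j∈ → trans (sym (cyclesOfLen-count σ cl j))
        (T-eq (All.lookup (AllP.map⁻ {f = λ j → cyclesOfLen σ j ≡ᵇ k j} (true-and t)) j∈)))))

  -- The sign depends only on N and on the number of cycles, which k determines. So the parities of
  -- the given α and β are those of all members of their classes.
  prescribed-even : ∀ k (σ τ : Tab N) → Injective (lookup σ) → Injective (lookup τ) →
    Prescribed k σ → Prescribed k τ → isEven σ ≡ isEven τ
  prescribed-even k σ τ i j s t with cycles-exist (lookup σ) i | cycles-exist (lookup τ) j
  ... | cs , cl , e | ds , dl , e' = trans (isEven-evenF σ) (trans e (trans
        (cong (λ l → not (parity (N + l))) (trans (prescribed-length k σ cl s) (sym (prescribed-length k τ dl t))))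
        (sym (trans (isEven-evenF τ) e'))))

  countIn-target : ∀ (p q : Tab N → Bool) (A : ℕ → Bool) → (∀ σ → q σ ≡ p σ) →
    countIn (filterᵇ p (SymN N)) A ≡ count (λ σ → q σ ∧ A (numCycles σ)) (SymN N)
  countIn-target p q A h = trans (length-filterᵇ _ (filterᵇ p (SymN N)))
    (trans (count-filterᵇ _ p (SymN N)) (count-cong (SymN N) (λ σ _ → cong (_∧ A (numCycles σ)) (sym (h σ)))))

  length-class : ∀ (p q : Tab N → Bool) → (∀ σ → q σ ≡ p σ) → length (filterᵇ p (SymN N)) ≡ count q (SymN N)
  length-class p q h = trans (length-filterᵇ p (SymN N)) (count-cong (SymN N) (λ σ _ → sym (h σ)))

  countV-gluings : ∀ J n A → countV N J n A ≡ total (gluings A (C2 N)) (CJ N J n)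
  countV-gluings J n A = total-cong (CJ N J n) (λ α _ → length-filterᵇ (hits A α) (C2 N))

  odd-transposition : 2 ≤ N → ∃[ s ] ((∀ x → lookup s (lookup s x) ≡ x) × isEven s ≡ false)
  odd-transposition 2≤N = transposition i j , transposition-involutive i j ,
    trans (isEven-evenF (transposition i j)) (trans (evenF-cong (lookup-transposition i j))
      (trans (evenF-transpose (λ x → x) i j i≢j (λ e → e)) (cong not (evenF-identity {N}))))
    where
    i j : Fin N
    i = Fin.fromℕ< {0} (≤-trans (s≤s z≤n) 2≤N)
    j = Fin.fromℕ< {1} 2≤N
    i≢j : i ≢ j
    i≢j e with trans (sym (FinP.toℕ-fromℕ< (≤-trans (s≤s z≤n) 2≤N))) (trans (cong toℕ e) (FinP.toℕ-fromℕ< 2≤N))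
    ... | ()

  even-half : N % 2 ≡ 0 → N ≡ 2 * (N Data.Nat./ 2)
  even-half e = trans (DivMod.m≡m%n+[m/n]*n N 2) (trans (cong (_+ N Data.Nat./ 2 * 2) e) (*-comm (N Data.Nat./ 2) 2))

  prescribed-bound : ∀ {S L Cs : List (Tab N)} → Perms S → Matchings L → 2 ≤ N → N % 2 ≡ 0 →
    ∀ k k' → (∀ l → 1 ≤ k l → 3 ≤ l) → ∀ α β →
    (∀ σ → σ ∈ Cs → Injective (lookup σ) × Prescribed k σ) → (∀ σ → σ ∈ L → Prescribed k' σ) → α ∈ Cs → β ∈ L →
    ∀ A → TVBound (14 * scale) N (total (gluings A L) Cs) (length Cs * length L)
      (count (λ γ → same (same (isEven α) (isEven β)) (isEven γ) ∧ A (numCycles γ)) S)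
      (count (λ γ → same (same (isEven α) (isEven β)) (isEven γ)) S)
  prescribed-bound {S} {L} {Cs} perms ML 2≤N even k k' large α β in-k in-k' α∈ β∈ A =
    all-distributions perms isEven isEven-∘ ML (isEven β) same-β A (N Data.Nat./ 2) 2≤N (even-half even) isEven-evenF
      (proj₁ odd) (proj₁ (proj₂ odd)) (proj₂ (proj₂ odd)) (isEven α) Cs same-α
    where
    odd : ∃[ s ] ((∀ x → lookup s (lookup s x) ≡ x) × isEven s ≡ false)
    odd = odd-transposition 2≤N
    L-injective : ∀ σ → σ ∈ L → Injective (lookup σ)
    L-injective σ σ∈ = matching-injective (proj₁ (proj₂ ML) σ σ∈)
    same-β : ∀ β' → β' ∈ L → isEven β' ≡ isEven β
    same-β β' β'∈ = prescribed-even k' β' β (L-injective β' β'∈) (L-injective β β∈) (in-k' β' β'∈) (in-k' β β∈)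
    same-α : ∀ α' → α' ∈ Cs → isEven α' ≡ isEven α × ∃[ cs ] (CycleList (lookup α') cs ×
      (∀ c → c ∈ cs → 3 ≤ length c) × evenF (lookup α') ≡ not (parity (N + length cs)))
    same-α α' α'∈ with in-k α' α'∈ | in-k α α∈
    ... | inj , t | inj₀ , t₀ with cycles-exist (lookup α') inj
    ...   | cs , cl , e = prescribed-even k α' α inj inj₀ t t₀ ,
            cs , cl , (λ c c∈ → large (length c) (prescribed-lengths α' k cl t c∈)) , e

  CJ-bound : 2 ≤ N → N % 2 ≡ 0 → ∀ J n → (∀ j → T (J j) → 3 ≤ j) →
    ∀ (α β : Tab N) → T (inCJ J n α) → T (isPerm α) → T (inC2 β) → T (isPerm β) →
    ∀ p → (∀ σ → same (same (isEven α) (isEven β)) (isEven σ) ≡ p σ) → ∀ A →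
    TVBound (14 * scale) N (countV N J n A) (length (CJ N J n) * length (C2 N))
      (countIn (filterᵇ p (SymN N)) A) (length (filterᵇ p (SymN N)))
  CJ-bound 2≤N even J n J≥3 α β inα permα inβ permβ p class A =
    TVBound-cong {14 * scale} {N} {b = length (CJ N J n) * length (C2 N)} (countV-gluings J n A)
      (countIn-target p _ A class) (length-class p _ class)
      (prescribed-bound {SymN N} {C2 N} {CJ N J n} SymN-perms C2-matchings 2≤N even
        (λ j → if J j then n j else 0) (λ j → if j ≡ᵇ 2 then N Data.Nat./ 2 else 0) large α β in-J in-2
        (member (inCJ J n) α permα inα) (member inC2 β permβ inβ) A)
    where
    large : ∀ l → 1 ≤ (if J l then n l else 0) → 3 ≤ l
    large l h with J l in eq
    ... | true = J≥3 l (subst T (sym eq) tt)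
    large l () | false
    in-J : ∀ σ → σ ∈ CJ N J n → Injective (lookup σ) × Prescribed (λ j → if J j then n j else 0) σ
    in-J σ σ∈ with ∈-filterᵇ⁻ (inCJ J n) (SymN N) σ∈
    ... | σ∈S , t = ∈-SymN σ σ∈S , t
    in-2 : ∀ σ → σ ∈ C2 N → Prescribed (λ j → if j ≡ᵇ 2 then N Data.Nat./ 2 else 0) σ
    in-2 σ σ∈ = proj₂ (∈-filterᵇ⁻ inC2 (SymN N) σ∈)
    member : ∀ (p : Tab N → Bool) σ → T (isPerm σ) → T (p σ) → σ ∈ filterᵇ p (SymN N)
    member p σ t t' = Mem.∈-filter⁺ (λ σ → T? (p σ)) (SymN-∈ σ (isPerm-injective σ t)) t'

same-refl : ∀ {a b} → a ≡ b → same a b ≡ true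
same-refl {true} refl = refl
same-refl {false} refl = refl

same-distinct : ∀ {a b} → a ≢ b → same a b ≡ false
same-distinct {true} {true} h = ⊥-elim (h refl)
same-distinct {true} {false} h = refl
same-distinct {false} {true} h = refl
same-distinct {false} {false} h = ⊥-elim (h refl)

theorem3p1 : ∃[ C ] (0 < C × (∀ (N : ℕ) → 2 ≤ N → (N % 2) ≡ 0 →
    ∀ (J : ℕ → Bool) (n : ℕ → ℕ) →
    (∀ j → T (J j) → 3 ≤ j) →
    (∀ j → T (J j) → N < j → n j ≡ 0) →
    weightedSum N J n ≡ N →
    ∀ (α β : Tab N) → T (inCJ J n α) → T (isPerm α) → T (inC2 β) → T (isPerm β) →
    (isEven α ≡ isEven β → ∀ (A : ℕ → Bool) →
    TVBound C N (countV N J n A) (length (CJ N J n) * length (C2 N))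
    (countIn (EvenPerms N) A) (length (EvenPerms N))) ×
    (isEven α ≢ isEven β → ∀ (A : ℕ → Bool) →
    TVBound C N (countV N J n A) (length (CJ N J n) * length (C2 N))
    (countIn (OddPerms N) A) (length (OddPerms N)))))
theorem3p1 = 14 * scale , ≤-trans scale-positive (m≤n*m scale 14) ,
  λ N 2≤N even J n J≥3 _ _ α β inα permα inβ permβ →
    (λ e → CJ-bound 2≤N even J n J≥3 α β inα permα inβ permβ isEven
      (λ σ → trans (cong (λ ε → same ε (isEven σ)) (same-refl e)) (not-involutive (isEven σ)))) ,
    (λ e → CJ-bound 2≤N even J n J≥3 α β inα permα inβ permβ (not ∘ isEven)
      (λ σ → cong (λ ε → same ε (isEven σ)) (same-distinct e)))
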